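{- For any fixed complete graph $H$, Induced Graph Matching on $K_{1,4}$-free graphs (given a $K_{1,4}$-free graph $G$ and $k\in\mathbb N$, decide whether $G$ has an induced $H$-matching of size $k$), parameterized by the size $k$ of the sought induced $H$-matching, is $\mathsf{W}[1]$-hard.
   Context: All graphs are finite, simple and undirected. A graph is $K_{1,4}$-free if it does not contain $K_{1,4}$ (the star with four leaves) as an induced subgraph. An occurrence of $H$ in $G$ is an induced subgraph of $G$ isomorphic to $H$. An induced $H$-matching of size $k$ in $G$ is a set $\{H_1,\dots,H_k\}$ of occurrences of $H$ in $G$ that are pairwise vertex-disjoint and such that no edge of $G$ joins a vertex of $H_i$ to a vertex of $H_j$ for $i\neq j$. -}

module Defs where

open import Data.Bool.Base using (Bool; true; false; not; if_then_else_)
open import Data.Bool.ListAction using (all; any)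
open import Data.Fin.Base using (Fin; zero; suc; toℕ)
open import Data.Fin.Properties using (_≟_)
open import Data.Fin.Subset using (Subset; _∈_; _∉_; ∣_∣)
open import Data.List.Base using (List; []; _∷_; length; map; foldr; tabulate)
open import Data.Nat.Base using (ℕ; zero; suc; _+_; _*_; _^_; _⊔_; _≤_; _<ᵇ_)
open import Data.Product.Base using (Σ-syntax; ∃-syntax; _×_)
open import Data.Vec.Base using (Vec; _∷_; lookup; head; replicate)
open import Function.Bundles using (_⇔_)
open import Function.Definitions using (Injective)
open import Relation.Binary.PropositionalEquality using (_≡_; _≢_)
open import Relation.Nullary using (¬_)

------------------------------------------------------------------------
-- Model of computation

-- The WHILE language of N. D. Jones ("Computability and Complexity from a
-- Programming Perspective") over binary trees, in point-free form: a
-- program transforms a single tree, which serves as its store.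

infixr 5 _∙_

data Tree : Set where
  nil : Tree
  _∙_ : Tree → Tree → Tree

size : Tree → ℕ
size nil     = 1
size (s ∙ t) = suc (size s + size t)

infixr 4 _⨟_

data Prog : Set where
  idp nilp hd tl : Prog
  cons           : Prog → Prog → Prog
  _⨟_            : Prog → Prog → Prog
  cond           : (test yes no : Prog) → Prog
  while          : (test body : Prog) → Prog

-- p ⊢ x ⇓ y [ t ]: on input x, program p halts with output y in time t.
-- A test counts as false when it returns nil, and as true otherwise.
-- A step is charged the size of the tree it acts on, and not 1: with unit
-- cost, `cons idp idp` would build trees of exponential size in linear
-- time.  With this charge the size of the output never exceeds the
-- running time, and the model and Turing machines simulate each other
-- with polynomial overhead.

infix 3 _⊢_⇓_[_]

data _⊢_⇓_[_] : Prog → Tree → Tree → ℕ → Set where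
  ⇓id      : ∀ {x} → idp ⊢ x ⇓ x [ size x ]
  ⇓nil     : ∀ {x} → nilp ⊢ x ⇓ nil [ size x ]
  ⇓hd-nil  : hd ⊢ nil ⇓ nil [ size nil ]
  ⇓hd      : ∀ {x y} → hd ⊢ x ∙ y ⇓ x [ size (x ∙ y) ]
  ⇓tl-nil  : tl ⊢ nil ⇓ nil [ size nil ]
  ⇓tl      : ∀ {x y} → tl ⊢ x ∙ y ⇓ y [ size (x ∙ y) ]
  ⇓cons    : ∀ {p q x y z s t} →
             p ⊢ x ⇓ y [ s ] → q ⊢ x ⇓ z [ t ] →
             cons p q ⊢ x ⇓ y ∙ z [ size x + (s + t) ]
  ⇓seq     : ∀ {p q x y z s t} →
             p ⊢ x ⇓ y [ s ] → q ⊢ y ⇓ z [ t ] →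
             p ⨟ q ⊢ x ⇓ z [ s + t ]
  ⇓cond-no : ∀ {p q r x y s t} →
             p ⊢ x ⇓ nil [ s ] → r ⊢ x ⇓ y [ t ] →
             cond p q r ⊢ x ⇓ y [ size x + (s + t) ]
  ⇓cond-yes : ∀ {p q r x y u v s t} →
             p ⊢ x ⇓ u ∙ v [ s ] → q ⊢ x ⇓ y [ t ] →
             cond p q r ⊢ x ⇓ y [ size x + (s + t) ]
  ⇓stop    : ∀ {p q x s} →
             p ⊢ x ⇓ nil [ s ] →
             while p q ⊢ x ⇓ x [ size x + s ]
  ⇓loop    : ∀ {p q x y z u v s t r} →
             p ⊢ x ⇓ u ∙ v [ s ] → q ⊢ x ⇓ y [ t ] →
             while p q ⊢ y ⇓ z [ r ] →
             while p q ⊢ x ⇓ z [ size x + (s + t + r) ]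

-- Numbers are written in unary, and lists are right-nested.

encodeℕ : ℕ → Tree
encodeℕ zero    = nil
encodeℕ (suc n) = nil ∙ encodeℕ n

encodeBool : Bool → Tree
encodeBool false = nil
encodeBool true  = nil ∙ nil

encodeFin : ∀ {n} → Fin n → Tree
encodeFin i = encodeℕ (toℕ i)

encodeList : {A : Set} → (A → Tree) → List A → Tree
encodeList enc []       = nil
encodeList enc (x ∷ xs) = enc x ∙ encodeList enc xs

Computable : (ℕ → ℕ) → Set
Computable f = Σ[ p ∈ Prog ] (∀ n → ∃[ t ] p ⊢ encodeℕ n ⇓ encodeℕ (f n) [ t ])

------------------------------------------------------------------------
-- Parameterized problems and reductions

-- Programs read `encode a`.  Trees that encode no instance are outside
-- the problem: a reduction may do anything on them, and must not
-- output them.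

record ParamProblem : Set₁ where
  field
    Instance : Set
    encode   : Instance → Tree
    param    : Instance → ℕ
    Yes      : Instance → Set

-- Parameterized (many-one fpt) reductions.  Since sizes are at least 1,
-- size ^ c stands for an arbitrary polynomial, constants going into f.

infix 4 _≤fpt_

record _≤fpt_ (A B : ParamProblem) : Set where
  private
    module A = ParamProblem A
    module B = ParamProblem B
  field
    program      : Prog
    f g          : ℕ → ℕ
    f-computable : Computable f
    g-computable : Computable g
    c            : ℕ
    correct      : ∀ (a : A.Instance) →
      Σ[ b ∈ B.Instance ] Σ[ t ∈ ℕ ]
        (program ⊢ A.encode a ⇓ B.encode b [ t ])
        × t ≤ f (A.param a) * size (A.encode a) ^ c
        × B.param b ≤ g (A.param a)
        × (A.Yes a ⇔ B.Yes b)

------------------------------------------------------------------------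
-- Boolean circuits and the W-hierarchy

-- A Gate w reads from w already available wires.

data Gate (w : ℕ) : Set where
  notᵍ     : Fin w → Gate w
  andᵍ orᵍ : List (Fin w) → Gate w

-- Circuit n w: a circuit with n input nodes and w nodes in total, inputs
-- included.  Wires are de Bruijn indices: 0 is the most recently added
-- gate, and in `inputs` wire i is the i-th input.

infixl 5 _▷_

data Circuit (n : ℕ) : ℕ → Set where
  inputs : Circuit n n
  _▷_    : ∀ {w} → Circuit n w → Gate w → Circuit n (suc w)

operands : ∀ {w} → Gate w → List (Fin w)
operands (notᵍ i)  = i ∷ []
operands (andᵍ is) = is
operands (orᵍ is)  = is

evalGate : ∀ {w} → Vec Bool w → Gate w → Bool
evalGate ρ (notᵍ i)  = not (lookup ρ i)
evalGate ρ (andᵍ is) = all (lookup ρ) is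
evalGate ρ (orᵍ is)  = any (lookup ρ) is

evalNodes : ∀ {n w} → Circuit n w → Vec Bool n → Vec Bool w
evalNodes inputs  ρ = ρ
evalNodes (C ▷ g) ρ = evalGate (evalNodes C ρ) g ∷ evalNodes C ρ

-- The maximal weight of a path from an input (or a gate of fan-in 0) to
-- each node, where every gate on the path contributes its cost.

pathCosts : (∀ {w} → Gate w → ℕ) → ∀ {n w} → Circuit n w → Vec ℕ w
pathCosts cost {n} inputs = replicate n 0
pathCosts cost (C ▷ g)    =
  cost g + foldr _⊔_ 0 (map (lookup ds) (operands g)) ∷ ds
  where ds = pathCosts cost C

-- A gate is large when its fan-in exceeds 2.

largeCost : ∀ {w} → Gate w → ℕ
largeCost g = if 2 <ᵇ length (operands g) then 1 else 0

-- The output node is wire 0; Circuit n (suc w) guarantees that it exists.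

output : ∀ {n w} → Circuit n (suc w) → Vec Bool n → Bool
output C ρ = head (evalNodes C ρ)

depth : ∀ {n w} → Circuit n (suc w) → ℕ
depth C = head (pathCosts (λ _ → 1) C)

weft : ∀ {n w} → Circuit n (suc w) → ℕ
weft C = head (pathCosts largeCost C)

encodeGate : ∀ {w} → Gate w → Tree
encodeGate (notᵍ i)  = encodeℕ 0 ∙ encodeFin i
encodeGate (andᵍ is) = encodeℕ 1 ∙ encodeList encodeFin is
encodeGate (orᵍ is)  = encodeℕ 2 ∙ encodeList encodeFin is

-- The list of gates, most recently added first.

encodeGates : ∀ {n w} → Circuit n w → Tree
encodeGates inputs  = nil
encodeGates (C ▷ g) = encodeGate g ∙ encodeGates C

record WCSInstance (t d : ℕ) : Set where
  field
    {n w}   : ℕ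
    circuit : Circuit n (suc w)
    weft≤   : weft circuit ≤ t
    depth≤  : depth circuit ≤ d
    k       : ℕ

-- Weighted Circuit Satisfiability for circuits of weft at most t and
-- depth at most d: is there a satisfying assignment with exactly k
-- true inputs?  An assignment is the Subset of true inputs.

WCS : ℕ → ℕ → ParamProblem
WCS t d = record
  { Instance = WCSInstance t d
  ; encode   = λ I → let open WCSInstance I in
                 encodeℕ k ∙ encodeℕ n ∙ encodeGates circuit
  ; param    = WCSInstance.k
  ; Yes      = λ I → let open WCSInstance I in
                 Σ[ ρ ∈ Subset n ] (∣ ρ ∣ ≡ k × output circuit ρ ≡ true)
  }

W[_] : ℕ → ParamProblem → Set
W[ t ] A = ∃[ d ] A ≤fpt WCS t d

W[_]-Hard : ℕ → ParamProblem → Set₁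
W[ t ]-Hard B = ∀ (A : ParamProblem) → W[ t ] A → A ≤fpt B

------------------------------------------------------------------------
-- Graphs

record Graph : Set where
  field
    order  : ℕ
    adj    : Fin order → Fin order → Bool
    symm   : ∀ u v → adj u v ≡ adj v u
    irrefl : ∀ v → adj v v ≡ false

open Graph

IsComplete : Graph → Set
IsComplete G = ∀ u v → u ≢ v → adj G u v ≡ true

-- K_{1,m}; the centre is vertex 0.

star : ℕ → Graph
star m = record { order = suc m ; adj = a ; symm = s ; irrefl = i }
  where
  a : Fin (suc m) → Fin (suc m) → Bool
  a zero    zero    = false
  a zero    (suc _) = true
  a (suc _) zero    = true
  a (suc _) (suc _) = false

  s : ∀ u v → a u v ≡ a v u
  s zero    zero    = _≡_.refl
  s zero    (suc _) = _≡_.refl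
  s (suc _) zero    = _≡_.refl
  s (suc _) (suc _) = _≡_.refl

  i : ∀ v → a v v ≡ false
  i zero    = _≡_.refl
  i (suc _) = _≡_.refl

-- The subgraph of G induced by S is isomorphic to H; f is the isomorphism,
-- as a map into G with image S.

IsOccurrence : (H G : Graph) → Subset (order G) → Set
IsOccurrence H G S =
  Σ[ f ∈ (Fin (order H) → Fin (order G)) ]
    Injective _≡_ _≡_ f
    × (∀ v → v ∈ S ⇔ (∃[ u ] f u ≡ v))
    × (∀ u v → adj G (f u) (f v) ≡ adj H u v)

_-Free : Graph → Graph → Set
(H -Free) G = ¬ (∃[ S ] IsOccurrence H G S)

-- The set {H₁,…,H_k} is given by an injective enumeration of the vertex
-- sets of its members (an induced subgraph is determined by these).

record InducedMatching (H G : Graph) (k : ℕ) : Set where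
  field
    member     : Fin k → Subset (order G)
    distinct   : Injective _≡_ _≡_ member
    occurrence : ∀ i → IsOccurrence H G (member i)
    disjoint   : ∀ {i j} → i ≢ j → ∀ {v} → v ∈ member i → v ∉ member j
    no-edge    : ∀ {i j} → i ≢ j → ∀ {u v} → u ∈ member i → v ∈ member j →
                 adj G u v ≡ false

-- The adjacency matrix, as the list of its rows.

encodeGraph : Graph → Tree
encodeGraph G =
  encodeList (encodeList encodeBool) (tabulate λ u → tabulate λ v → adj G u v)

record IGMInstance (𝒢 : Graph → Set) : Set where
  field
    graph    : Graph
    in-class : 𝒢 graph
    k        : ℕ

-- Induced Graph Matching for the fixed graph H on the graph class 𝒢,
-- parameterized by k.

InducedGraphMatching : Graph → (Graph → Set) → ParamProblem
InducedGraphMatching H 𝒢 = record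
  { Instance = IGMInstance 𝒢
  ; encode   = λ I → let open IGMInstance I in encodeℕ k ∙ encodeGraph graph
  ; param    = IGMInstance.k
  ; Yes      = λ I → let open IGMInstance I in InducedMatching H graph k
  }

{-# OPTIONS --safe #-}

-- Let C be a circuit of weft 1 and depth d.  An assignment of weight k is cut
-- into k + 1 blocks, each but the last consisting of false inputs closed by a
-- true one, so that two numbers describe a block.  In addition one guesses a
-- set of fewer than 2 ^ (d + 1) claims "wire ℓ has the value b", containing
-- "the output is true", in which every claim is supported by claims on
-- operands; only a large gate whose claimed value must be shared by all its
-- operands needs no support, but none of its operands may be refuted.  These
-- operands have weft 0, hence depend on at most 2 ^ d inputs, and a refutation
-- involves at most 2 ^ d blocks.  Thus C is satisfiable with weight k iff
-- blocks and claims can be chosen such that every 2 ^ d-tuple of blocks passes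
-- a local test.  This is a binary constraint satisfaction problem: a variable
-- is a tuple of positions of blocks, and a value consists of the claims and of
-- the blocks at these positions.
--
-- From such a problem with K variables a graph is built out of K cyclically
-- ordered copies of each variable, every copy being a clique on the values.
-- A half graph between consecutive copies makes the selected values weakly
-- increasing around the cycle, hence constant, and copy j of variable i is
-- joined to copy i of variable j according to the constraint between them.
-- Solutions then correspond to independent sets of size K * K, and the half
-- graphs leave no four independent neighbours.  Replacing every vertex by as
-- many true twins as H has vertices turns independent sets into induced
-- H-matchings.

module Submission where

open import Defs
open import Data.Bool.Base using (Bool; true; false; not; _∧_; _∨_; if_then_else_; T)
open import Data.Bool.ListAction using (all; any)
import Data.Bool.Properties as Bool
open import Data.Bool.Properties using (T-≡; T-∧; T-∨; T-not-≡; ¬-not; T?)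
open import Data.Empty using (⊥; ⊥-elim)
import Data.Fin.Base as Fin
open import Data.Fin.Base using (Fin; zero; suc; toℕ; fromℕ<)
open import Data.Fin.Induction using (<-weakInduction; >-weakInduction)
import Data.Fin.Properties as Fin
open import Data.Fin.Subset using (Subset) renaming (_∈_ to _∈ˢ_; _∉_ to _∉ˢ_; ∣_∣ to ∣_∣ˢ)
open import Data.List.Base using
  (List; []; _∷_; _++_; length; map; foldr; foldl; reverse; replicate; drop; concatMap;
   cartesianProduct; cartesianProductWith; applyUpTo; upTo; downFrom; filterᵇ; tabulate; lookup)
open import Data.List.Membership.Propositional using (_∈_)
open import Data.List.Membership.Propositional.Properties
import Data.List.Properties as List
import Data.List.Relation.Unary.All as All
open import Data.List.Relation.Unary.AllPairs.Core using ([]; _∷_)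
open import Data.List.Relation.Unary.Any using (here; there; index)
open import Data.List.Relation.Unary.Any.Properties using (lookup-index)
open import Data.List.Relation.Unary.Unique.Propositional using (Unique)
import Data.List.Relation.Unary.Unique.Propositional.Properties as Unique
open import Data.Nat.Base
open import Data.Nat.Properties
open import Data.Product.Base using (Σ-syntax; _×_; _,_; proj₁; proj₂)
open import Data.Sum.Base using (_⊎_; inj₁; inj₂; [_,_]′)
open import Data.Unit.Base using (⊤; tt)
import Data.Vec.Base as Vec
import Data.Vec.Properties as Vec
open import Function.Base using (_∘_; flip)
open import Function.Bundles using (_⇔_; mk⇔; Equivalence)
open import Function.Construct.Composition using (_⇔-∘_)
open import Function.Definitions using (Injective)
open import Relation.Binary.PropositionalEquality
open import Relation.Nullary using (¬_; Dec; yes; no)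

-- Polynomial time on typed data

-- A test sees boundedly many blocks, so every fact it relies on needs a certificate of bounded
-- size. For this reason an assignment is not given by the positions of its k true inputs: that an
-- input is false would then be a statement about all of them, whereas a single interval of false
-- inputs certifies it. Likewise a large gate that owes its value to some operand names that operand
-- in a claim; only a value shared by all operands lacks a short certificate. What is short there is
-- a refutation, and all tests together exclude every refutation. Conflicts between all unequal
-- values of consecutive copies would also make the copies agree. But then one value, different from
-- that of the centre, could occur in the previous, own and next copy as three independent
-- neighbours, with a fourth across. The order in a half graph rules this out. The depth d is fixed
-- with the source problem, so `2 ^ d` and `cap d` are constants: the number `(k + 1) ^ (2 ^ d)` of
-- variables depends on the parameter alone, and the number of values is polynomial.

data Poly : Set where
  X           : Poly
  con         : ℕ → Poly
  _⊞_ _⊠_ _⊙_ : Poly → Poly → Poly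

infixl 6 _⊞_
infixl 7 _⊠_
infixr 8 _⊙_

-- Bounds are syntax rather than functions, so that each of them is monotone, lies below a monomial
-- and can itself be evaluated by a program.
⟪_⟫ : Poly → ℕ → ℕ
⟪ X ⟫     n = n
⟪ con c ⟫ n = c
⟪ p ⊞ q ⟫ n = ⟪ p ⟫ n + ⟪ q ⟫ n
⟪ p ⊠ q ⟫ n = ⟪ p ⟫ n * ⟪ q ⟫ n
⟪ p ⊙ q ⟫ n = ⟪ p ⟫ (⟪ q ⟫ n)

⟪⟫-mono : ∀ p {m n} → m ≤ n → ⟪ p ⟫ m ≤ ⟪ p ⟫ n
⟪⟫-mono X       m≤n = m≤n
⟪⟫-mono (con c) m≤n = ≤-refl
⟪⟫-mono (p ⊞ q) m≤n = +-mono-≤ (⟪⟫-mono p m≤n) (⟪⟫-mono q m≤n)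
⟪⟫-mono (p ⊠ q) m≤n = *-mono-≤ (⟪⟫-mono p m≤n) (⟪⟫-mono q m≤n)
⟪⟫-mono (p ⊙ q) m≤n = ⟪⟫-mono p (⟪⟫-mono q m≤n)

1≤^ : ∀ {n} c → 1 ≤ n → 1 ≤ n ^ c
1≤^ c (s≤s _) = m^n>0 _ c

^-bound-mono : ∀ {n c d} → 1 ≤ n → c ≤ d → n ^ c ≤ n ^ d
^-bound-mono (s≤s _) c≤d = ^-monoʳ-≤ _ c≤d

^-distrib-* : ∀ m n c → (m * n) ^ c ≡ m ^ c * n ^ c
^-distrib-* m n zero    = refl
^-distrib-* m n (suc c) = trans (cong (m * n *_) (^-distrib-* m n c)) ([m*n]*[o*p]≡[m*o]*[n*p] m n (m ^ c) (n ^ c))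

-- A reduction must exhibit a single exponent. The coefficient is written `suc C` to be positive,
-- which allows the case of composition to apply the outer bound to the inner one.
⟪⟫-monomial : ∀ p → Σ[ C ∈ ℕ ] Σ[ c ∈ ℕ ] (∀ {n} → 1 ≤ n → ⟪ p ⟫ n ≤ suc C * n ^ c)
⟪⟫-monomial X = 0 , 1 , λ {n} _ → ≤-reflexive (sym (trans (*-identityˡ (n * 1)) (*-identityʳ n)))
⟪⟫-monomial (con k) = k , 0 , λ _ → ≤-trans (n≤1+n k) (≤-reflexive (sym (*-identityʳ (suc k))))
⟪⟫-monomial (p ⊞ q) with ⟪⟫-monomial p | ⟪⟫-monomial q
... | C , c , hp | D , d , hq = C + suc D , c + d , λ {n} 1≤n → begin
  ⟪ p ⟫ n + ⟪ q ⟫ n                      ≤⟨ +-mono-≤ (hp 1≤n) (hq 1≤n) ⟩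
  suc C * n ^ c + suc D * n ^ d          ≤⟨ +-mono-≤ (*-monoʳ-≤ (suc C) (^-bound-mono 1≤n (m≤m+n c d)))
                                                     (*-monoʳ-≤ (suc D) (^-bound-mono 1≤n (m≤n+m d c))) ⟩
  suc C * n ^ (c + d) + suc D * n ^ (c + d) ≡⟨ sym (*-distribʳ-+ (n ^ (c + d)) (suc C) (suc D)) ⟩
  (suc C + suc D) * n ^ (c + d)          ∎
  where open ≤-Reasoning
⟪⟫-monomial (p ⊠ q) with ⟪⟫-monomial p | ⟪⟫-monomial q
... | C , c , hp | D , d , hq = D + C * suc D , c + d , λ {n} 1≤n → begin
  ⟪ p ⟫ n * ⟪ q ⟫ n                      ≤⟨ *-mono-≤ (hp 1≤n) (hq 1≤n) ⟩
  (suc C * n ^ c) * (suc D * n ^ d)      ≡⟨ [m*n]*[o*p]≡[m*o]*[n*p] (suc C) (n ^ c) (suc D) (n ^ d) ⟩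
  (suc C * suc D) * (n ^ c * n ^ d)      ≡⟨ cong ((suc C * suc D) *_) (sym (^-distribˡ-+-* n c d)) ⟩
  (suc C * suc D) * n ^ (c + d)          ∎
  where open ≤-Reasoning
⟪⟫-monomial (p ⊙ q) with ⟪⟫-monomial p | ⟪⟫-monomial q
... | C , c , hp | D , d , hq = C′ , d * c , λ {n} 1≤n → begin
  ⟪ p ⟫ (⟪ q ⟫ n)                        ≤⟨ ⟪⟫-mono p (hq 1≤n) ⟩
  ⟪ p ⟫ (suc D * n ^ d)                  ≤⟨ hp (*-mono-≤ {1} {suc D} (s≤s z≤n) (1≤^ d 1≤n)) ⟩
  suc C * (suc D * n ^ d) ^ c            ≡⟨ cong (suc C *_) (^-distrib-* (suc D) (n ^ d) c) ⟩
  suc C * (suc D ^ c * (n ^ d) ^ c)      ≡⟨ sym (*-assoc (suc C) (suc D ^ c) ((n ^ d) ^ c)) ⟩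
  (suc C * suc D ^ c) * (n ^ d) ^ c      ≡⟨ cong ((suc C * suc D ^ c) *_) (^-*-assoc n d c) ⟩
  (suc C * suc D ^ c) * n ^ (d * c)      ≤⟨ *-monoˡ-≤ (n ^ (d * c)) (n≤1+n C′) ⟩
  suc C′ * n ^ (d * c)                   ∎
  where
  open ≤-Reasoning
  C′ = suc C * suc D ^ c

-- Types and their encodings as trees

infixr 6 _⊗_

data Ty : Set where
  unit nat bool : Ty
  list          : Ty → Ty
  _⊗_           : Ty → Ty → Ty

⟦_⟧ : Ty → Set
⟦ unit ⟧   = ⊤
⟦ nat ⟧    = ℕ
⟦ bool ⟧   = Bool
⟦ list τ ⟧ = List ⟦ τ ⟧
⟦ σ ⊗ τ ⟧  = ⟦ σ ⟧ × ⟦ τ ⟧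

enc : (τ : Ty) → ⟦ τ ⟧ → Tree
enc unit     _       = nil
enc nat      n       = encodeℕ n
enc bool     b       = encodeBool b
enc (list τ) xs      = encodeList (enc τ) xs
enc (σ ⊗ τ)  (x , y) = enc σ x ∙ enc τ y

sz : (τ : Ty) → ⟦ τ ⟧ → ℕ
sz τ x = size (enc τ x)

1≤size : ∀ x → 1 ≤ size x
1≤size nil     = s≤s z≤n
1≤size (x ∙ y) = s≤s z≤n

-- Every step is charged the size of its tree. A time bound is therefore a size bound as well, and
-- this bounds the input of the second program in a composition.
size≤time : ∀ {p x y t} → p ⊢ x ⇓ y [ t ] → size y ≤ t
size≤time ⇓id     = ≤-refl
size≤time {x = x} ⇓nil = 1≤size x
size≤time ⇓hd-nil = ≤-refl
size≤time (⇓hd {x} {y}) = m≤n⇒m≤1+n (m≤m+n (size x) (size y))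
size≤time ⇓tl-nil = ≤-refl
size≤time (⇓tl {x} {y}) = m≤n⇒m≤1+n (m≤n+m (size y) (size x))
size≤time {x = x} (⇓cons d e) = +-mono-≤ (1≤size x) (+-mono-≤ (size≤time d) (size≤time e))
size≤time (⇓seq {s = s} d e) = ≤-trans (size≤time e) (m≤n+m _ s)
size≤time {x = x} (⇓cond-no {s = s} d e) = ≤-trans (size≤time e) (≤-trans (m≤n+m _ s) (m≤n+m _ (size x)))
size≤time {x = x} (⇓cond-yes {s = s} d e) = ≤-trans (size≤time e) (≤-trans (m≤n+m _ s) (m≤n+m _ (size x)))
size≤time (⇓stop {s = s} d) = m≤m+n _ s
size≤time {x = x} (⇓loop {s = s} {t} d e f) = ≤-trans (size≤time f) (≤-trans (m≤n+m _ (s + t)) (m≤n+m _ (size x)))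

record PolyTime (Γ τ : Ty) (f : ⟦ Γ ⟧ → ⟦ τ ⟧) : Set where
  field
    prog : Prog
    time : Poly
    runs : ∀ γ → Σ[ t ∈ ℕ ] (prog ⊢ enc Γ γ ⇓ enc τ (f γ) [ t ]) × t ≤ ⟪ time ⟫ (sz Γ γ)

  output-size : ∀ γ → sz τ (f γ) ≤ ⟪ time ⟫ (sz Γ γ)
  output-size γ = let _ , d , t≤ = runs γ in ≤-trans (size≤time d) t≤

open PolyTime

-- One tree can encode values of several types: a number is a list of units, a boolean a list of at
-- most one unit, a nonempty list a pair. Programs for lists and pairs thus serve the other types as
-- they stand.
recode : ∀ {Γ σ τ} {f : ⟦ Γ ⟧ → ⟦ σ ⟧} {g : ⟦ Γ ⟧ → ⟦ τ ⟧} →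
         (∀ γ → enc σ (f γ) ≡ enc τ (g γ)) → PolyTime Γ σ f → PolyTime Γ τ g
recode f≗g F = record
  { prog = prog F
  ; time = time F
  ; runs = λ γ → let t , d , t≤ = runs F γ in t , subst (λ y → prog F ⊢ _ ⇓ y [ t ]) (f≗g γ) d , t≤
  }

extᵖ : ∀ {Γ τ} {f g : ⟦ Γ ⟧ → ⟦ τ ⟧} → (∀ γ → f γ ≡ g γ) → PolyTime Γ τ f → PolyTime Γ τ g
extᵖ {τ = τ} f≗g = recode (λ γ → cong (enc τ) (f≗g γ))

idᵖ : ∀ {Γ} → PolyTime Γ Γ (λ γ → γ)
idᵖ = record { prog = idp ; time = X ; runs = λ γ → _ , ⇓id , ≤-refl }

infixr 4 _⨾_

_⨾_ : ∀ {Γ σ τ} {f : ⟦ Γ ⟧ → ⟦ σ ⟧} {g : ⟦ σ ⟧ → ⟦ τ ⟧} →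
      PolyTime Γ σ f → PolyTime σ τ g → PolyTime Γ τ (λ γ → g (f γ))
_⨾_ {f = f} F G = record
  { prog = prog F ⨟ prog G
  ; time = time F ⊞ time G ⊙ time F
  ; runs = λ γ →
      let s , d , s≤ = runs F γ
          t , e , t≤ = runs G (f γ)
      in s + t , ⇓seq d e , +-mono-≤ s≤ (≤-trans t≤ (⟪⟫-mono (time G) (output-size F γ)))
  }

pairᵖ : ∀ {Γ σ τ} {f : ⟦ Γ ⟧ → ⟦ σ ⟧} {g : ⟦ Γ ⟧ → ⟦ τ ⟧} →
        PolyTime Γ σ f → PolyTime Γ τ g → PolyTime Γ (σ ⊗ τ) (λ γ → f γ , g γ)
pairᵖ F G = record
  { prog = cons (prog F) (prog G)
  ; time = X ⊞ (time F ⊞ time G)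
  ; runs = λ γ →
      let s , d , s≤ = runs F γ
          t , e , t≤ = runs G γ
      in _ , ⇓cons d e , +-monoʳ-≤ (sz _ γ) (+-mono-≤ s≤ t≤)
  }

fstᵖ : ∀ {σ τ} → PolyTime (σ ⊗ τ) σ proj₁
fstᵖ = record { prog = hd ; time = X ; runs = λ γ → _ , ⇓hd , ≤-refl }

sndᵖ : ∀ {σ τ} → PolyTime (σ ⊗ τ) τ proj₂
sndᵖ = record { prog = tl ; time = X ; runs = λ γ → _ , ⇓tl , ≤-refl }

[]ᵖ : ∀ {Γ τ} → PolyTime Γ (list τ) (λ _ → [])
[]ᵖ = record { prog = nilp ; time = X ; runs = λ γ → _ , ⇓nil , ≤-refl }

ttᵖ : ∀ {Γ} → PolyTime Γ unit (λ _ → tt)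
ttᵖ = record { prog = nilp ; time = X ; runs = λ γ → _ , ⇓nil , ≤-refl }

zeroᵖ : ∀ {Γ} → PolyTime Γ nat (λ _ → 0)
zeroᵖ = record { prog = nilp ; time = X ; runs = λ γ → _ , ⇓nil , ≤-refl }

falseᵖ : ∀ {Γ} → PolyTime Γ bool (λ _ → false)
falseᵖ = record { prog = nilp ; time = X ; runs = λ γ → _ , ⇓nil , ≤-refl }

infixr 5 _∷ᵖ_

_∷ᵖ_ : ∀ {Γ τ} {x : ⟦ Γ ⟧ → ⟦ τ ⟧} {xs : ⟦ Γ ⟧ → List ⟦ τ ⟧} →
       PolyTime Γ τ x → PolyTime Γ (list τ) xs → PolyTime Γ (list τ) (λ γ → x γ ∷ xs γ)
x ∷ᵖ xs = recode (λ _ → refl) (pairᵖ x xs)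

sucᵖ : ∀ {Γ} {n : ⟦ Γ ⟧ → ℕ} → PolyTime Γ nat n → PolyTime Γ nat (λ γ → suc (n γ))
sucᵖ n = recode (λ _ → refl) (pairᵖ ttᵖ n)

trueᵖ : ∀ {Γ} → PolyTime Γ bool (λ _ → true)
trueᵖ = recode (λ _ → refl) (pairᵖ ttᵖ ttᵖ)

caseList : {A B : Set} → List A → B → (A × List A → B) → B
caseList []       z s = z
caseList (x ∷ xs) z s = s (x , xs)

caseᵖ : ∀ {Γ σ τ} {xs : ⟦ Γ ⟧ → List ⟦ σ ⟧} {z : ⟦ Γ ⟧ → ⟦ τ ⟧} {s : ⟦ Γ ⟧ × ⟦ σ ⟧ × List ⟦ σ ⟧ → ⟦ τ ⟧} →
        PolyTime Γ (list σ) xs → PolyTime Γ τ z → PolyTime (Γ ⊗ σ ⊗ list σ) τ s →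
        PolyTime Γ τ (λ γ → caseList (xs γ) (z γ) (λ p → s (γ , p)))
caseᵖ {Γ} {σ} {τ} {xs} {z} {s} L Z S = record
  { prog = cond (prog L) (cons idp (prog L) ⨟ prog S) (prog Z)
  ; time = X ⊞ (time L ⊞ (time Z ⊞ ((X ⊞ (X ⊞ time L)) ⊞ time S ⊙ (X ⊞ (X ⊞ time L)))))
  ; runs = λ γ → run γ (xs γ) (runs L γ)
  }
  where
  run : ∀ γ ys → (Σ[ t ∈ ℕ ] (prog L ⊢ enc Γ γ ⇓ enc (list σ) ys [ t ]) × t ≤ ⟪ time L ⟫ (sz Γ γ)) →
        Σ[ t ∈ ℕ ] (cond (prog L) (cons idp (prog L) ⨟ prog S) (prog Z) ⊢ enc Γ γ ⇓
                      enc τ (caseList ys (z γ) (λ p → s (γ , p))) [ t ]) ×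
                   t ≤ _
  run γ [] (t , d , t≤) =
    let u , e , u≤ = runs Z γ in
    _ , ⇓cond-no d e , +-monoʳ-≤ (sz Γ γ) (+-mono-≤ t≤ (≤-trans u≤ (m≤m+n _ _)))
  run γ (y ∷ ys) (t , d , t≤) =
    let u , e , u≤ = runs S (γ , y , ys)
        d′ = ⇓cons ⇓id d
        t′≤ = +-monoʳ-≤ (sz Γ γ) (+-monoʳ-≤ (sz Γ γ) t≤)
    in _ , ⇓cond-yes d (⇓seq d′ e) ,
       +-monoʳ-≤ (sz Γ γ) (+-mono-≤ t≤ (≤-trans
         (+-mono-≤ t′≤ (≤-trans u≤ (⟪⟫-mono (time S) (≤-trans (size≤time d′) t′≤))))
         (m≤n+m _ (⟪ time Z ⟫ (sz Γ γ)))))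

unitsᵖ : ∀ {Γ} {n : ⟦ Γ ⟧ → ℕ} → PolyTime Γ nat n → PolyTime Γ (list unit) (λ γ → replicate (n γ) tt)
unitsᵖ {n = n} = recode (λ γ → units (n γ))
  where
  units : ∀ m → encodeℕ m ≡ enc (list unit) (replicate m tt)
  units zero    = refl
  units (suc m) = cong (nil ∙_) (units m)

lengthUnitsᵖ : ∀ {Γ} {us : ⟦ Γ ⟧ → List ⊤} → PolyTime Γ (list unit) us → PolyTime Γ nat (λ γ → length (us γ))
lengthUnitsᵖ {us = us} = recode (λ γ → units (us γ))
  where
  units : ∀ us → enc (list unit) us ≡ encodeℕ (length us)
  units []       = refl
  units (_ ∷ us) = cong (nil ∙_) (units us)

ifᵖ : ∀ {Γ τ} {b : ⟦ Γ ⟧ → Bool} {f g : ⟦ Γ ⟧ → ⟦ τ ⟧} →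
      PolyTime Γ bool b → PolyTime Γ τ f → PolyTime Γ τ g →
      PolyTime Γ τ (λ γ → if b γ then f γ else g γ)
ifᵖ {b = b} {f} {g} B F G =
  extᵖ (λ γ → lem (b γ)) (caseᵖ (recode {τ = list unit} (λ γ → asList (b γ)) B) G (fstᵖ ⨾ F))
  where
  asList : ∀ c → encodeBool c ≡ enc (list unit) (if c then tt ∷ [] else [])
  asList true  = refl
  asList false = refl
  lem : ∀ {A : Set} {x y : A} c → caseList (if c then tt ∷ [] else []) y (λ _ → x) ≡ (if c then x else y)
  lem true  = refl
  lem false = refl

length≤size : ∀ {σ} (l : List ⟦ σ ⟧) → length l ≤ sz (list σ) l
length≤size []              = z≤n
length≤size {σ} (x ∷ l) = s≤s (≤-trans (length≤size {σ} l) (m≤n+m _ (sz σ x)))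

sz-suffix : ∀ {σ} (xs ys : List ⟦ σ ⟧) → sz (list σ) ys ≤ sz (list σ) (xs ++ ys)
sz-suffix []           ys = ≤-refl
sz-suffix {σ} (x ∷ xs) ys = ≤-trans (sz-suffix {σ} xs ys) (≤-trans (m≤n+m _ (sz σ x)) (n≤1+n _))

-- Loops over lists

module _ {Γ σ τ : Ty} {f : (⟦ Γ ⟧ × ⟦ σ ⟧) × ⟦ τ ⟧ → ⟦ τ ⟧} (F : PolyTime ((Γ ⊗ σ) ⊗ τ) τ f) where

  private
    State = list σ ⊗ Γ ⊗ τ

    body : PolyTime ((σ ⊗ list σ) ⊗ Γ ⊗ τ) State (λ s → proj₂ (proj₁ s) , proj₁ (proj₂ s) , _)
    body = pairᵖ (fstᵖ ⨾ sndᵖ)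
             (pairᵖ (sndᵖ ⨾ fstᵖ)
               (pairᵖ (pairᵖ (sndᵖ ⨾ fstᵖ) (fstᵖ ⨾ fstᵖ)) (sndᵖ ⨾ sndᵖ) ⨾ F))

    loop : Prog
    -- The first component of the state is the rest of the list, and its tree is `nil` exactly when
    -- nothing is left.
    loop = while hd (prog body)

    iteration : ℕ → ℕ
    iteration B = B + (B + ⟪ time body ⟫ B)

    step : ⟦ Γ ⟧ → ⟦ τ ⟧ → ⟦ σ ⟧ → ⟦ τ ⟧
    step γ a x = f ((γ , x) , a)

    -- The bound `B` on all intermediate states is a hypothesis because it does not follow from the
    -- cost of one round. The `suc` pays for the final test, which fails.
    loop-runs : ∀ B γ l a →
      (∀ xs ys → l ≡ xs ++ ys → sz State (ys , γ , foldl (step γ) a xs) ≤ B) →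
      Σ[ t ∈ ℕ ] (loop ⊢ enc State (l , γ , a) ⇓ enc State ([] , γ , foldl (step γ) a l) [ t ])
                 × t ≤ suc (length l) * iteration B
    loop-runs B γ [] a small =
      _ , ⇓stop ⇓hd ,
      ≤-trans (+-mono-≤ (small [] [] refl) (≤-trans (small [] [] refl) (m≤m+n B _))) (m≤m+n _ 0)
    loop-runs B γ (x ∷ l) a small =
      let n≤ = small [] (x ∷ l) refl
          t , d , t≤ = runs body ((x , l) , γ , a)
          r , e , r≤ = loop-runs B γ l (step γ a x) (λ xs ys eq → small (x ∷ xs) ys (cong (x ∷_) eq))
          n = sz State (x ∷ l , γ , a)
      in _ , ⇓loop ⇓hd d e ,
         ≤-trans (≤-reflexive (sym (+-assoc n (n + t) r)))
           (+-mono-≤ (+-mono-≤ n≤ (+-mono-≤ n≤ (≤-trans t≤ (⟪⟫-mono (time body) n≤)))) r≤)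

  foldlᵖ : {l : ⟦ Γ ⟧ → List ⟦ σ ⟧} {z : ⟦ Γ ⟧ → ⟦ τ ⟧} →
           PolyTime Γ (list σ) l → PolyTime Γ τ z →
           (bound : Poly) →
           (∀ γ xs ys → l γ ≡ xs ++ ys → sz τ (foldl (λ a x → f ((γ , x) , a)) (z γ) xs) ≤ ⟪ bound ⟫ (sz Γ γ)) →
           PolyTime Γ τ (λ γ → foldl (λ a x → f ((γ , x) , a)) (z γ) (l γ))
  foldlᵖ {l} {z} L Z bound small = record
    { prog = prog init ⨟ loop ⨟ tl ⨟ tl
    ; time = time init ⊞ ((con 1 ⊞ time L) ⊠ (B ⊞ (B ⊞ time body ⊙ B)) ⊞ (B ⊞ B))
    ; runs = λ γ →
        let s , d , s≤ = runs init γ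
            n = sz Γ γ
            ok : ∀ xs ys → l γ ≡ xs ++ ys → sz State (ys , γ , foldl (step γ) (z γ) xs) ≤ ⟪ B ⟫ n
            ok xs ys eq = s≤s (+-mono-≤
              (≤-trans (≤-trans (sz-suffix {σ} xs ys) (≤-reflexive (cong (sz (list σ)) (sym eq)))) (output-size L γ))
              (s≤s (+-monoʳ-≤ n (small γ xs ys eq))))
            t , e , t≤ = loop-runs (⟪ B ⟫ n) γ (l γ) (z γ) ok
            last = ok (l γ) [] (sym (List.++-identityʳ (l γ)))
        in _ , ⇓seq d (⇓seq e (⇓seq ⇓tl ⇓tl)) ,
           +-mono-≤ s≤ (+-mono-≤
             (≤-trans t≤ (*-monoˡ-≤ (iteration (⟪ B ⟫ n)) (s≤s (≤-trans (length≤size {σ} (l γ)) (output-size L γ)))))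
             (+-mono-≤ last (≤-trans (≤-trans (n≤1+n _) (n≤1+n _)) last)))
    }
    where
    init = pairᵖ L (pairᵖ idᵖ Z)
    B = con 1 ⊞ (time L ⊞ (con 1 ⊞ (X ⊞ bound)))

reverseᵖ : ∀ {Γ σ} {l : ⟦ Γ ⟧ → List ⟦ σ ⟧} → PolyTime Γ (list σ) l → PolyTime Γ (list σ) (λ γ → reverse (l γ))
reverseᵖ {Γ} {σ} {l} L = foldlᵖ {Γ} {σ} {list σ} ((fstᵖ ⨾ sndᵖ) ∷ᵖ sndᵖ) L []ᵖ (con 1 ⊞ time L) small
  where
  sz-foldl : ∀ zs xs ys → sz (list σ) (foldl (flip _∷_) zs xs) ≤ sz (list σ) zs + sz (list σ) (xs ++ ys)
  sz-foldl zs []       ys = m≤m+n _ _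
  sz-foldl zs (x ∷ xs) ys = begin
    sz (list σ) (foldl (flip _∷_) (x ∷ zs) xs) ≤⟨ sz-foldl (x ∷ zs) xs ys ⟩
    suc (s + z) + r                            ≡⟨ cong (λ w → suc w + r) (+-comm s z) ⟩
    suc (z + s + r)                            ≡⟨ cong suc (+-assoc z s r) ⟩
    suc (z + (s + r))                          ≡⟨ sym (+-suc z (s + r)) ⟩
    z + suc (s + r)                            ∎
    where
    open ≤-Reasoning
    s = sz σ x
    z = sz (list σ) zs
    r = sz (list σ) (xs ++ ys)

  small : ∀ γ xs ys → l γ ≡ xs ++ ys → sz (list σ) (foldl (flip _∷_) [] xs) ≤ ⟪ con 1 ⊞ time L ⟫ (sz Γ γ)
  small γ xs ys eq = ≤-trans (sz-foldl [] xs ys)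
    (s≤s (≤-trans (≤-reflexive (cong (sz (list σ)) (sym eq))) (output-size L γ)))

-- A right fold is a left fold over the reversed list. Its intermediate results are the folds of the
-- suffixes, so these are what has to be bounded.
foldrᵖ : ∀ {Γ σ τ} {f : (⟦ Γ ⟧ × ⟦ σ ⟧) × ⟦ τ ⟧ → ⟦ τ ⟧} {l : ⟦ Γ ⟧ → List ⟦ σ ⟧} {z : ⟦ Γ ⟧ → ⟦ τ ⟧} →
         PolyTime ((Γ ⊗ σ) ⊗ τ) τ f → PolyTime Γ (list σ) l → PolyTime Γ τ z →
         (bound : Poly) →
         (∀ γ xs ys → l γ ≡ xs ++ ys → sz τ (foldr (λ x a → f ((γ , x) , a)) (z γ) ys) ≤ ⟪ bound ⟫ (sz Γ γ)) →
         PolyTime Γ τ (λ γ → foldr (λ x a → f ((γ , x) , a)) (z γ) (l γ))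
foldrᵖ {Γ} {σ} {τ} {f} {l} {z} F L Z bound small =
  extᵖ (λ γ → trans (sym (List.reverse-foldr (step γ) (z γ) (reverse (l γ))))
                    (cong (foldr (step γ) (z γ)) (List.reverse-involutive (l γ))))
       (foldlᵖ F (reverseᵖ L) Z bound λ γ xs ys eq →
         ≤-trans (≤-reflexive (cong (sz τ) (trans (cong (foldl (flip (step γ)) (z γ)) (sym (List.reverse-involutive xs)))
                                                  (foldl-reverse γ (reverse xs)))))
                 (small γ (reverse ys) (reverse xs)
                   (trans (sym (List.reverse-involutive (l γ))) (trans (cong reverse eq) (List.reverse-++ xs ys)))))
  where
  step : ⟦ Γ ⟧ → ⟦ σ ⟧ → ⟦ τ ⟧ → ⟦ τ ⟧
  step γ x a = f ((γ , x) , a)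
  foldl-reverse : ∀ γ xs → foldl (flip (step γ)) (z γ) (reverse xs) ≡ foldr (step γ) (z γ) xs
  foldl-reverse γ xs = trans (sym (List.reverse-foldr (step γ) (z γ) (reverse xs)))
                             (cong (foldr (step γ) (z γ)) (List.reverse-involutive xs))

-- Growth by an amount that does not depend on the accumulator keeps its size
-- polynomial, whereas repeated polynomial growth would not.
foldr⁺ᵖ : ∀ {Γ σ τ} {f : (⟦ Γ ⟧ × ⟦ σ ⟧) × ⟦ τ ⟧ → ⟦ τ ⟧} {l : ⟦ Γ ⟧ → List ⟦ σ ⟧} {z : ⟦ Γ ⟧ → ⟦ τ ⟧} →
          PolyTime ((Γ ⊗ σ) ⊗ τ) τ f → PolyTime Γ (list σ) l → PolyTime Γ τ z →
          (growth : Poly) →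
          (∀ γ x a → sz τ (f ((γ , x) , a)) ≤ ⟪ growth ⟫ (sz (Γ ⊗ σ) (γ , x)) + sz τ a) →
          PolyTime Γ τ (λ γ → foldr (λ x a → f ((γ , x) , a)) (z γ) (l γ))
foldr⁺ᵖ {Γ} {σ} {τ} {f} {l} {z} F L Z growth grow =
  foldrᵖ F L Z (time L ⊠ growth ⊙ (con 1 ⊞ (X ⊞ time L)) ⊞ time Z) small
  where
  sz-foldr : ∀ γ B ys → sz (list σ) ys ≤ B →
             sz τ (foldr (λ x a → f ((γ , x) , a)) (z γ) ys) ≤ length ys * ⟪ growth ⟫ (1 + (sz Γ γ + B)) + sz τ (z γ)
  sz-foldr γ B []       _  = ≤-refl
  sz-foldr γ B (y ∷ ys) le = begin
    sz τ (f ((γ , y) , r))                       ≤⟨ grow γ y r ⟩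
    ⟪ growth ⟫ (1 + (sz Γ γ + sz σ y)) + sz τ r
      ≤⟨ +-mono-≤ (⟪⟫-mono growth (s≤s (+-monoʳ-≤ (sz Γ γ) (≤-trans (≤-trans (m≤m+n _ _) (n≤1+n _)) le))))
                  (sz-foldr γ B ys (≤-trans (≤-trans (m≤n+m _ (sz σ y)) (n≤1+n _)) le)) ⟩
    G + (length ys * G + sz τ (z γ))             ≡⟨ sym (+-assoc G _ _) ⟩
    G + length ys * G + sz τ (z γ)               ∎
    where
    open ≤-Reasoning
    r = foldr (λ x a → f ((γ , x) , a)) (z γ) ys
    G = ⟪ growth ⟫ (1 + (sz Γ γ + B))

  small : ∀ γ xs ys → l γ ≡ xs ++ ys → sz τ (foldr (λ x a → f ((γ , x) , a)) (z γ) ys) ≤ _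
  small γ xs ys eq =
    let ys≤ = ≤-trans (≤-trans (sz-suffix {σ} xs ys) (≤-reflexive (cong (sz (list σ)) (sym eq)))) (output-size L γ)
    in ≤-trans (sz-foldr γ (⟪ time L ⟫ (sz Γ γ)) ys ys≤)
         (+-mono-≤ (*-monoˡ-≤ _ (≤-trans (length≤size {σ} ys) ys≤)) (output-size Z γ))

-- List operations and unary arithmetic

mapᵖ : ∀ {Γ σ τ} {f : ⟦ Γ ⟧ × ⟦ σ ⟧ → ⟦ τ ⟧} {l : ⟦ Γ ⟧ → List ⟦ σ ⟧} →
       PolyTime (Γ ⊗ σ) τ f → PolyTime Γ (list σ) l →
       PolyTime Γ (list τ) (λ γ → map (λ x → f (γ , x)) (l γ))
mapᵖ {τ = τ} {l = l} F L =
  extᵖ (λ γ → sym (List.map-is-foldr (l γ)))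
       (foldr⁺ᵖ ((fstᵖ ⨾ F) ∷ᵖ sndᵖ) L []ᵖ (con 1 ⊞ time F)
         (λ γ x a → s≤s (+-monoˡ-≤ (sz (list τ) a) (output-size F (γ , x)))))

size-bool : ∀ b → sz bool b ≤ 3
size-bool true  = ≤-refl
size-bool false = s≤s z≤n

notᵖ : ∀ {Γ} {b : ⟦ Γ ⟧ → Bool} → PolyTime Γ bool b → PolyTime Γ bool (λ γ → not (b γ))
notᵖ {b = b} B = extᵖ (λ γ → lem (b γ)) (ifᵖ B falseᵖ trueᵖ)
  where
  lem : ∀ b → (if b then false else true) ≡ not b
  lem true  = refl
  lem false = refl

infixr 6 _∧ᵖ_
infixr 5 _∨ᵖ_

_∧ᵖ_ : ∀ {Γ} {a b : ⟦ Γ ⟧ → Bool} → PolyTime Γ bool a → PolyTime Γ bool b → PolyTime Γ bool (λ γ → a γ ∧ b γ)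
_∧ᵖ_ {a = a} {b} A B = extᵖ (λ γ → lem (a γ) (b γ)) (ifᵖ A B falseᵖ)
  where
  lem : ∀ a b → (if a then b else false) ≡ a ∧ b
  lem true  b = refl
  lem false b = refl

_∨ᵖ_ : ∀ {Γ} {a b : ⟦ Γ ⟧ → Bool} → PolyTime Γ bool a → PolyTime Γ bool b → PolyTime Γ bool (λ γ → a γ ∨ b γ)
_∨ᵖ_ {a = a} {b} A B = extᵖ (λ γ → lem (a γ) (b γ)) (ifᵖ A trueᵖ B)
  where
  lem : ∀ a b → (if a then true else b) ≡ a ∨ b
  lem true  b = refl
  lem false b = refl

allᵖ : ∀ {Γ σ} {p : ⟦ Γ ⟧ × ⟦ σ ⟧ → Bool} {l : ⟦ Γ ⟧ → List ⟦ σ ⟧} →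
       PolyTime (Γ ⊗ σ) bool p → PolyTime Γ (list σ) l → PolyTime Γ bool (λ γ → all (λ x → p (γ , x)) (l γ))
allᵖ P L = foldr⁺ᵖ ((fstᵖ ⨾ sndᵖ) ∧ᵖ sndᵖ) (mapᵖ P L) trueᵖ (con 3) (λ γ x a → ≤-trans (size-bool (x ∧ a)) (m≤m+n 3 _))

anyᵖ : ∀ {Γ σ} {p : ⟦ Γ ⟧ × ⟦ σ ⟧ → Bool} {l : ⟦ Γ ⟧ → List ⟦ σ ⟧} →
       PolyTime (Γ ⊗ σ) bool p → PolyTime Γ (list σ) l → PolyTime Γ bool (λ γ → any (λ x → p (γ , x)) (l γ))
anyᵖ P L = foldr⁺ᵖ ((fstᵖ ⨾ sndᵖ) ∨ᵖ sndᵖ) (mapᵖ P L) falseᵖ (con 3) (λ γ x a → ≤-trans (size-bool (x ∨ a)) (m≤m+n 3 _))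

infixr 5 _++ᵖ_

_++ᵖ_ : ∀ {Γ σ} {xs ys : ⟦ Γ ⟧ → List ⟦ σ ⟧} → PolyTime Γ (list σ) xs → PolyTime Γ (list σ) ys →
        PolyTime Γ (list σ) (λ γ → xs γ ++ ys γ)
_++ᵖ_ {Γ} {σ} {xs} {ys} Xs Ys =
  extᵖ (λ γ → sym (List.++-is-foldr (xs γ) (ys γ)))
       (foldr⁺ᵖ ((fstᵖ ⨾ sndᵖ) ∷ᵖ sndᵖ) Xs Ys X (λ γ x a → s≤s (+-monoˡ-≤ (sz (list σ) a) (m≤n+m (sz σ x) (sz Γ γ)))))

sz-++ : ∀ σ (xs ys : List ⟦ σ ⟧) → sz (list σ) (xs ++ ys) ≤ sz (list σ) xs + sz (list σ) ys
sz-++ σ []       ys = n≤1+n _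
sz-++ σ (x ∷ xs) ys = s≤s (≤-trans (+-monoʳ-≤ (sz σ x) (sz-++ σ xs ys)) (≤-reflexive (sym (+-assoc (sz σ x) _ _))))

concatMapᵖ : ∀ {Γ σ τ} {f : ⟦ Γ ⟧ × ⟦ σ ⟧ → List ⟦ τ ⟧} {l : ⟦ Γ ⟧ → List ⟦ σ ⟧} →
             PolyTime (Γ ⊗ σ) (list τ) f → PolyTime Γ (list σ) l →
             PolyTime Γ (list τ) (λ γ → concatMap (λ x → f (γ , x)) (l γ))
concatMapᵖ {Γ} {τ = τ} F L =
  foldr⁺ᵖ ((fstᵖ ⨾ sndᵖ) ++ᵖ sndᵖ) (mapᵖ F L) []ᵖ X
    (λ γ x a → ≤-trans (sz-++ τ x a) (+-monoˡ-≤ (sz (list τ) a) (≤-trans (m≤n+m (sz (list τ) x) (sz Γ γ)) (n≤1+n _))))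

cartesianProductWithᵖ : ∀ {Γ ρ σ τ} {f : (⟦ Γ ⟧ × ⟦ ρ ⟧) × ⟦ σ ⟧ → ⟦ τ ⟧} {xs : ⟦ Γ ⟧ → List ⟦ ρ ⟧} {ys : ⟦ Γ ⟧ → List ⟦ σ ⟧} →
  PolyTime ((Γ ⊗ ρ) ⊗ σ) τ f → PolyTime Γ (list ρ) xs → PolyTime Γ (list σ) ys →
  PolyTime Γ (list τ) (λ γ → cartesianProductWith (λ x y → f ((γ , x) , y)) (xs γ) (ys γ))
cartesianProductWithᵖ {ρ = ρ} {f = f} {xs} {ys} F Xs Ys =
  extᵖ (λ γ → lem γ (ys γ) (xs γ)) (concatMapᵖ (mapᵖ F (fstᵖ ⨾ Ys)) Xs)
  where
  lem : ∀ γ zs ws → concatMap (λ x → map (λ y → f ((γ , x) , y)) zs) ws ≡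
                    cartesianProductWith (λ x y → f ((γ , x) , y)) ws zs
  lem γ zs []       = refl
  lem γ zs (w ∷ ws) = cong (map (λ y → f ((γ , w) , y)) zs ++_) (lem γ zs ws)

cartesianProductᵖ : ∀ {Γ σ τ} {xs : ⟦ Γ ⟧ → List ⟦ σ ⟧} {ys : ⟦ Γ ⟧ → List ⟦ τ ⟧} →
  PolyTime Γ (list σ) xs → PolyTime Γ (list τ) ys →
  PolyTime Γ (list (σ ⊗ τ)) (λ γ → cartesianProduct (xs γ) (ys γ))
cartesianProductᵖ = cartesianProductWithᵖ (pairᵖ (fstᵖ ⨾ sndᵖ) sndᵖ)

filterᵖ : ∀ {Γ σ} {p : ⟦ Γ ⟧ × ⟦ σ ⟧ → Bool} {l : ⟦ Γ ⟧ → List ⟦ σ ⟧} →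
          PolyTime (Γ ⊗ σ) bool p → PolyTime Γ (list σ) l →
          PolyTime Γ (list σ) (λ γ → filterᵇ (λ x → p (γ , x)) (l γ))
filterᵖ {p = p} {l} P L = extᵖ (λ γ → lem γ (l γ)) (concatMapᵖ (ifᵖ P (sndᵖ ∷ᵖ []ᵖ) []ᵖ) L)
  where
  lem : ∀ γ xs → concatMap (λ x → if p (γ , x) then x ∷ [] else []) xs ≡ filterᵇ (λ x → p (γ , x)) xs
  lem γ []       = refl
  lem γ (x ∷ xs) with p (γ , x)
  ... | true  = cong (x ∷_) (lem γ xs)
  ... | false = lem γ xs

lengthᵖ : ∀ {Γ σ} {l : ⟦ Γ ⟧ → List ⟦ σ ⟧} → PolyTime Γ (list σ) l → PolyTime Γ nat (λ γ → length (l γ))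
lengthᵖ {l = l} L = extᵖ (λ γ → List.length-map _ (l γ)) (lengthUnitsᵖ (mapᵖ ttᵖ L))

dropᵖ : ∀ {Γ σ} {n : ⟦ Γ ⟧ → ℕ} {l : ⟦ Γ ⟧ → List ⟦ σ ⟧} →
        PolyTime Γ nat n → PolyTime Γ (list σ) l → PolyTime Γ (list σ) (λ γ → drop (n γ) (l γ))
dropᵖ {Γ} {σ} {n} {l} N L =
  extᵖ (λ γ → lem (n γ) (l γ))
    (foldr⁺ᵖ (caseᵖ sndᵖ []ᵖ (sndᵖ ⨾ sndᵖ)) (unitsᵖ N) L (con 0) (λ γ x a → sz-tail a))
  where
  tail : List ⟦ σ ⟧ → List ⟦ σ ⟧
  tail xs = caseList xs [] proj₂
  sz-tail : ∀ a → sz (list σ) (tail a) ≤ sz (list σ) a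
  sz-tail []      = ≤-refl
  sz-tail (x ∷ a) = ≤-trans (m≤n+m _ (sz σ x)) (n≤1+n _)
  tail-drop : ∀ m xs → tail (drop m xs) ≡ drop (suc m) xs
  tail-drop zero    []       = refl
  tail-drop zero    (x ∷ xs) = refl
  tail-drop (suc m) []       = refl
  tail-drop (suc m) (x ∷ xs) = tail-drop m xs
  lem : ∀ m xs → foldr (λ _ → tail) xs (replicate m tt) ≡ drop m xs
  lem zero    xs = refl
  lem (suc m) xs = trans (cong tail (lem m xs)) (tail-drop m xs)

nth : {A : Set} → A → List A → ℕ → A
nth d []       _       = d
nth d (x ∷ xs) zero    = x
nth d (x ∷ xs) (suc m) = nth d xs m

nthᵖ : ∀ {Γ σ} {d : ⟦ Γ ⟧ → ⟦ σ ⟧} {l : ⟦ Γ ⟧ → List ⟦ σ ⟧} {n : ⟦ Γ ⟧ → ℕ} →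
       PolyTime Γ σ d → PolyTime Γ (list σ) l → PolyTime Γ nat n → PolyTime Γ σ (λ γ → nth (d γ) (l γ) (n γ))
nthᵖ {σ = σ} {d} {l} {n} D L N =
  extᵖ (λ γ → lem (d γ) (l γ) (n γ)) (caseᵖ (dropᵖ N L) D (sndᵖ ⨾ fstᵖ))
  where
  lem : ∀ (e : ⟦ σ ⟧) xs m → caseList (drop m xs) e proj₁ ≡ nth e xs m
  lem e []       zero    = refl
  lem e []       (suc m) = refl
  lem e (x ∷ xs) zero    = refl
  lem e (x ∷ xs) (suc m) = lem e xs m

infix 7 _≤ᵖ_ _<ᵖ_ _≡ᵖ_

-- In unary, `m ≤ n` means that nothing is left after dropping `n` of `m` units.
_≤ᵖ_ : ∀ {Γ} {m n : ⟦ Γ ⟧ → ℕ} → PolyTime Γ nat m → PolyTime Γ nat n → PolyTime Γ bool (λ γ → m γ ≤ᵇ n γ)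
_≤ᵖ_ {m = m} {n} M N = extᵖ (λ γ → lem (m γ) (n γ)) (caseᵖ (dropᵖ N (unitsᵖ M)) trueᵖ falseᵖ)
  where
  lem : ∀ m n → caseList (drop n (replicate m tt)) true (λ _ → false) ≡ (m ≤ᵇ n)
  lem zero          zero    = refl
  lem zero          (suc n) = refl
  lem (suc m)       zero    = refl
  lem (suc zero)    (suc n) = lem zero n
  lem (suc (suc m)) (suc n) = lem (suc m) n

_<ᵖ_ : ∀ {Γ} {m n : ⟦ Γ ⟧ → ℕ} → PolyTime Γ nat m → PolyTime Γ nat n → PolyTime Γ bool (λ γ → m γ <ᵇ n γ)
M <ᵖ N = sucᵖ M ≤ᵖ N

_≡ᵖ_ : ∀ {Γ} {m n : ⟦ Γ ⟧ → ℕ} → PolyTime Γ nat m → PolyTime Γ nat n → PolyTime Γ bool (λ γ → m γ ≡ᵇ n γ)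
_≡ᵖ_ {m = m} {n} M N = extᵖ (λ γ → lem (m γ) (n γ)) (M ≤ᵖ N ∧ᵖ N ≤ᵖ M)
  where
  lem : ∀ m n → (m ≤ᵇ n) ∧ (n ≤ᵇ m) ≡ (m ≡ᵇ n)
  lem zero          zero          = refl
  lem zero          (suc n)       = refl
  lem (suc m)       zero          = refl
  lem (suc zero)    (suc zero)    = refl
  lem (suc zero)    (suc (suc n)) = refl
  lem (suc (suc m)) (suc zero)    = refl
  lem (suc (suc m)) (suc (suc n)) = lem (suc m) (suc n)

size-ℕ : ∀ n → sz nat n ≡ 1 + (n + n)
size-ℕ zero    = refl
size-ℕ (suc n) = cong suc (cong suc (trans (size-ℕ n) (sym (+-suc n n))))

n≤size-ℕ : ∀ n → n ≤ sz nat n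
n≤size-ℕ n = ≤-trans (≤-trans (m≤m+n n n) (n≤1+n _)) (≤-reflexive (sym (size-ℕ n)))

-- A loop over units has no index, but the length of the list built so far is the next number to be
-- put in front.
downFromᵖ : ∀ {Γ} {n : ⟦ Γ ⟧ → ℕ} → PolyTime Γ nat n → PolyTime Γ (list nat) (λ γ → downFrom (n γ))
downFromᵖ {Γ} {n} N =
  extᵖ (λ γ → trans (fold (replicate (n γ) tt)) (cong downFrom (List.length-replicate (n γ))))
    (foldrᵖ (lengthᵖ sndᵖ ∷ᵖ sndᵖ) (unitsᵖ N) []ᵖ (con 1 ⊞ time N ⊠ (con 2 ⊞ (time N ⊞ time N))) small)
  where
  length-downFrom : ∀ m → length (downFrom m) ≡ m
  length-downFrom = List.length-applyDownFrom _
  fold : ∀ us → foldr (λ _ a → length a ∷ a) [] us ≡ downFrom (length us)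
  fold []       = refl
  fold (u ∷ us) = trans (cong (λ a → length a ∷ a) (fold us)) (cong (_∷ downFrom (length us)) (length-downFrom (length us)))
  sz-downFrom : ∀ {m k} → m ≤ k → sz (list nat) (downFrom m) ≤ 1 + m * (2 + (k + k))
  sz-downFrom {zero}  {k} _  = ≤-refl
  sz-downFrom {suc m} {k} le = s≤s (≤-trans
    (+-mono-≤ (≤-trans (≤-reflexive (size-ℕ m)) (s≤s (+-mono-≤ (<⇒≤ le) (<⇒≤ le)))) (sz-downFrom (<⇒≤ le)))
    (≤-reflexive (+-suc (suc (k + k)) (m * (2 + (k + k))))))
  small : ∀ γ xs ys → replicate (n γ) tt ≡ xs ++ ys → sz (list nat) (foldr (λ _ a → length a ∷ a) [] ys) ≤ _
  small γ xs ys eq =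
    let k = ⟪ time N ⟫ (sz Γ γ)
        le : length ys ≤ k
        le = begin
          length ys              ≤⟨ m≤n+m _ (length xs) ⟩
          length xs + length ys  ≡⟨ sym (List.length-++ xs) ⟩
          length (xs ++ ys)      ≡⟨ cong length (sym eq) ⟩
          length (replicate (n γ) tt) ≡⟨ List.length-replicate (n γ) ⟩
          n γ                    ≤⟨ n≤size-ℕ (n γ) ⟩
          sz nat (n γ)           ≤⟨ output-size N γ ⟩
          k                      ∎
    in ≤-trans (≤-reflexive (cong (sz (list nat)) (fold ys)))
         (≤-trans (sz-downFrom le) (s≤s (*-monoˡ-≤ _ le)))
    where open ≤-Reasoning

upToᵖ : ∀ {Γ} {n : ⟦ Γ ⟧ → ℕ} → PolyTime Γ nat n → PolyTime Γ (list nat) (λ γ → upTo (n γ))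
upToᵖ {n = n} N = extᵖ (λ γ → List.reverse-downFrom (n γ)) (reverseᵖ (downFromᵖ N))

conᵖ : ∀ {Γ} c → PolyTime Γ nat (λ _ → c)
conᵖ zero    = zeroᵖ
conᵖ (suc c) = sucᵖ (conᵖ c)

infixl 6 _+ᵖ_
infixl 7 _*ᵖ_

_+ᵖ_ : ∀ {Γ} {m n : ⟦ Γ ⟧ → ℕ} → PolyTime Γ nat m → PolyTime Γ nat n → PolyTime Γ nat (λ γ → m γ + n γ)
_+ᵖ_ {m = m} {n} M N =
  extᵖ (λ γ → trans (List.length-++ (replicate (m γ) tt)) (cong₂ _+_ (List.length-replicate (m γ)) (List.length-replicate (n γ))))
       (lengthᵖ (unitsᵖ M ++ᵖ unitsᵖ N))

_*ᵖ_ : ∀ {Γ} {m n : ⟦ Γ ⟧ → ℕ} → PolyTime Γ nat m → PolyTime Γ nat n → PolyTime Γ nat (λ γ → m γ * n γ)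
_*ᵖ_ {m = m} {n} M N = extᵖ (λ γ → lem (m γ) (n γ)) (lengthᵖ (concatMapᵖ (fstᵖ ⨾ unitsᵖ N) (unitsᵖ M)))
  where
  lem : ∀ m n → length (concatMap (λ _ → replicate n tt) (replicate m tt)) ≡ m * n
  lem zero    n = refl
  lem (suc m) n = trans (List.length-++ (replicate n tt)) (cong₂ _+_ (List.length-replicate n) (lem m n))

⟪_⟫ᵖ : ∀ p → PolyTime nat nat ⟪ p ⟫
⟪ X ⟫ᵖ     = idᵖ
⟪ con c ⟫ᵖ = conᵖ c
⟪ p ⊞ q ⟫ᵖ = ⟪ p ⟫ᵖ +ᵖ ⟪ q ⟫ᵖ
⟪ p ⊠ q ⟫ᵖ = ⟪ p ⟫ᵖ *ᵖ ⟪ q ⟫ᵖ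
⟪ p ⊙ q ⟫ᵖ = ⟪ q ⟫ᵖ ⨾ ⟪ p ⟫ᵖ

tuples : {A : Set} → ℕ → List A → List (List A)
tuples zero    l = [] ∷ []
tuples (suc m) l = cartesianProductWith _∷_ l (tuples m l)

-- The length `m` is no input of the program: the program and the degree of its time bound grow with
-- it. Tuples can be listed because their lengths will depend on `d` alone.
tuplesᵖ : ∀ {Γ σ} {l : ⟦ Γ ⟧ → List ⟦ σ ⟧} m → PolyTime Γ (list σ) l → PolyTime Γ (list (list σ)) (λ γ → tuples m (l γ))
tuplesᵖ zero    L = []ᵖ ∷ᵖ []ᵖ
tuplesᵖ (suc m) L = cartesianProductWithᵖ ((fstᵖ ⨾ sndᵖ) ∷ᵖ sndᵖ) L (tuplesᵖ m L)

-- Reductions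

power : ℕ → Poly
power zero    = con 1
power (suc c) = X ⊠ power c

⟪power⟫ : ∀ c n → ⟪ power c ⟫ n ≡ n ^ c
⟪power⟫ zero    n = refl
⟪power⟫ (suc c) n = cong (n *_) (⟪power⟫ c n)

computable-poly : ∀ {f} p → Computable f → Computable (λ n → ⟪ p ⟫ (f n))
computable-poly {f} p (pf , f-runs) = (pf ⨟ prog ⟪ p ⟫ᵖ) , λ n →
  let s , d = f-runs n
      t , e , _ = runs ⟪ p ⟫ᵖ (f n)
  in s + t , ⇓seq d e

-- A polynomial of `n * s ^ c` is at most a polynomial of `n` times a power of `s`, and the first
-- factor goes into `f`; so an fpt reduction followed by a polynomial-time map is fpt again. The map
-- works on typed values `x`, which have to match the encodings of actual instances only.
≤fpt-polyTime : ∀ {A B C} → A ≤fpt B →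
  ∀ {Γ τ f} → PolyTime Γ τ f → (G : Poly) →
  (∀ b → Σ[ x ∈ ⟦ Γ ⟧ ] Σ[ c ∈ ParamProblem.Instance C ]
           ParamProblem.encode B b ≡ enc Γ x
           × enc τ (f x) ≡ ParamProblem.encode C c
           × ParamProblem.param C c ≤ ⟪ G ⟫ (ParamProblem.param B b)
           × (ParamProblem.Yes B b ⇔ ParamProblem.Yes C c)) →
  A ≤fpt C
≤fpt-polyTime {A} {B} {C} R {Γ} {τ} {f} F G reduce = record
  { program      = R.program ⨟ prog F
  ; f            = λ n → ⟪ total ⟫ (R.f n)
  ; g            = λ n → ⟪ G ⟫ (R.g n)
  ; f-computable = computable-poly total R.f-computable
  ; g-computable = computable-poly G R.g-computable
  ; c            = R.c + R.c * e
  ; correct      = correct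
  }
  where
  module R = _≤fpt_ R
  module A = ParamProblem A
  module B = ParamProblem B
  module C = ParamProblem C

  D e : ℕ
  D = proj₁ (⟪⟫-monomial (time F))
  e = proj₁ (proj₂ (⟪⟫-monomial (time F)))

  total : Poly
  total = X ⊞ con (suc D) ⊠ power e

  time-bound : ∀ n m s → 1 ≤ n → m ≤ n * s ^ R.c → 1 ≤ m → 1 ≤ s →
               m + ⟪ time F ⟫ m ≤ ⟪ total ⟫ n * s ^ (R.c + R.c * e)
  time-bound n m s 1≤n m≤ 1≤m 1≤s = begin
    m + ⟪ time F ⟫ m
      ≤⟨ +-mono-≤ m≤ (proj₂ (proj₂ (⟪⟫-monomial (time F))) 1≤m) ⟩
    n * s ^ c + suc D * m ^ e
      ≤⟨ +-mono-≤ (*-monoʳ-≤ n (^-bound-mono 1≤s (m≤m+n c (c * e))))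
                  (*-monoʳ-≤ (suc D) (^-monoˡ-≤ e m≤)) ⟩
    n * S + suc D * (n * s ^ c) ^ e
      ≡⟨ cong (λ z → n * S + suc D * z) (trans (^-distrib-* n (s ^ c) e) (cong (n ^ e *_) (^-*-assoc s c e))) ⟩
    n * S + suc D * (n ^ e * s ^ (c * e))
      ≤⟨ +-monoʳ-≤ (n * S) (*-monoʳ-≤ (suc D) (*-monoʳ-≤ (n ^ e) (^-bound-mono 1≤s (m≤n+m (c * e) c)))) ⟩
    n * S + suc D * (n ^ e * S)
      ≡⟨ cong (n * S +_) (sym (*-assoc (suc D) (n ^ e) S)) ⟩
    n * S + suc D * n ^ e * S
      ≡⟨ sym (*-distribʳ-+ S n (suc D * n ^ e)) ⟩
    (n + suc D * n ^ e) * S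
      ≡⟨ cong (λ z → (n + suc D * z) * S) (sym (⟪power⟫ e n)) ⟩
    ⟪ total ⟫ n * S ∎
    where
    open ≤-Reasoning
    c = R.c
    S = s ^ (c + c * e)

  correct : ∀ (a : A.Instance) → Σ[ z ∈ C.Instance ] Σ[ t ∈ ℕ ]
      (R.program ⨟ prog F ⊢ A.encode a ⇓ C.encode z [ t ])
      × t ≤ ⟪ total ⟫ (R.f (A.param a)) * size (A.encode a) ^ (R.c + R.c * e)
      × C.param z ≤ ⟪ G ⟫ (R.g (A.param a))
      × (A.Yes a ⇔ C.Yes z)
  correct a with R.correct a
  ... | b , s , d , s≤ , param≤ , yes⇔ with reduce b
  ... | x , z , decode , encode , param′≤ , yes′⇔ with runs F x
  ... | t , d′ , t≤ =
    z , s + t ,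
    ⇓seq (subst (λ y → R.program ⊢ A.encode a ⇓ y [ s ]) decode d)
         (subst (λ y → prog F ⊢ enc Γ x ⇓ y [ t ]) encode d′) ,
    ≤-trans (+-monoʳ-≤ s (≤-trans t≤ (⟪⟫-mono (time F) (subst (λ y → size y ≤ s) decode (size≤time d)))))
            (time-bound n s (size (A.encode a)) 1≤n s≤ 1≤s (1≤size (A.encode a))) ,
    ≤-trans param′≤ (⟪⟫-mono G param≤) ,
    yes′⇔ ⇔-∘ yes⇔
    where
    n = R.f (A.param a)
    1≤s : 1 ≤ s
    1≤s = ≤-trans (1≤size (B.encode b)) (size≤time d)
    1≤n : 1 ≤ n
    1≤n = n≢0⇒n>0 λ n≡0 → n≮0 (≤-trans 1≤s (subst (λ k → s ≤ k * _) n≡0 s≤))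

-- From binary constraint satisfaction to induced matchings

record Solution (K N : ℕ) (rel : ℕ → ℕ → ℕ → ℕ → Bool) : Set where
  field
    α       : Fin K → ℕ
    α<N     : ∀ i → α i < N
    related : ∀ i j → T (rel (toℕ i) (α i) (toℕ j) (α j))

-- ((i , j) , (a , t)) is the t-th twin of the vertex for "copy j of
-- variable i takes the value a".
Vertex : Set
Vertex = (ℕ × ℕ) × (ℕ × ℕ)

next : ℕ → ℕ → ℕ
next K j = if suc j ≡ᵇ K then 0 else suc j

opaque
  samePair : ℕ × ℕ → ℕ × ℕ → Bool
  samePair (i , j) (i′ , j′) = (i ≡ᵇ i′) ∧ (j ≡ᵇ j′)

  samePair⁺ : ∀ {p q} → p ≡ q → T (samePair p q)
  samePair⁺ {i , j} refl = Equivalence.from T-∧ (≡⇒≡ᵇ i i refl , ≡⇒≡ᵇ j j refl)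

  samePair⁻ : ∀ {p q} → T (samePair p q) → p ≡ q
  samePair⁻ {i , j} {i′ , j′} s = let e , e′ = Equivalence.to T-∧ s in cong₂ _,_ (≡ᵇ⇒≡ i i′ e) (≡ᵇ⇒≡ j j′ e′)

opaque
  conflict : ℕ → (ℕ → ℕ → ℕ → ℕ → Bool) → Vertex → Vertex → Bool
  conflict K rel ((i , j) , (a , _)) ((i′ , j′) , (a′ , _)) =
    samePair (i , j) (i′ , j′)
    ∨ (samePair (i , next K j) (i′ , j′) ∧ (a′ <ᵇ a))
    ∨ (samePair (j , i) (i′ , j′) ∧ not (rel i a j a′))

opaque
  sameVertex : Vertex → Vertex → Bool
  sameVertex (c , p) (c′ , p′) = samePair c c′ ∧ samePair p p′

  sameVertex⁺ : ∀ {x y} → x ≡ y → T (sameVertex x y)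
  sameVertex⁺ refl = Equivalence.from T-∧ (samePair⁺ refl , samePair⁺ refl)

  sameVertex⁻ : ∀ {x y} → T (sameVertex x y) → x ≡ y
  sameVertex⁻ s = let e , e′ = Equivalence.to T-∧ s in cong₂ _,_ (samePair⁻ e) (samePair⁻ e′)

opaque
  adjacent : ℕ → (ℕ → ℕ → ℕ → ℕ → Bool) → Vertex → Vertex → Bool
  adjacent K rel x y = not (sameVertex x y) ∧ (conflict K rel x y ∨ conflict K rel y x)

-- The constraint of a variable with itself concerns a single value. Copy `i` of variable `i` has no
-- other copy across, so this constraint is enforced by omitting vertices.
vertices : ℕ → ℕ → ℕ → (ℕ → ℕ → ℕ → ℕ → Bool) → List Vertex
vertices h K N rel =
  filterᵇ (λ x → rel (proj₁ (proj₁ x)) (proj₁ (proj₂ x)) (proj₁ (proj₁ x)) (proj₁ (proj₂ x)))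
    (cartesianProduct (cartesianProduct (upTo K) (upTo K)) (cartesianProduct (upTo N) (upTo h)))

¬T⇒≡false : ∀ {b} → ¬ T b → b ≡ false
¬T⇒≡false ¬b = ¬-not (¬b ∘ Equivalence.from T-≡)

≡false⇒¬T : ∀ {b} → b ≡ false → ¬ T b
≡false⇒¬T refl ()

T-not : ∀ {b} → T (not b) → ¬ T b
T-not nb = ≡false⇒¬T (Equivalence.to T-not-≡ nb)

not-T : ∀ {b} → ¬ T b → T (not b)
not-T ¬b = Equivalence.from T-not-≡ (¬T⇒≡false ¬b)

T-≡-iff : ∀ {a b} → (T a → T b) → (T b → T a) → a ≡ b
T-≡-iff {false} {false} f g = refl
T-≡-iff {false} {true}  f g = ⊥-elim (g tt)
T-≡-iff {true}  {false} f g = ⊥-elim (f tt)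
T-≡-iff {true}  {true}  f g = refl

next-< : ∀ {K j} → suc j < K → next K j ≡ suc j
next-< {K} {j} j<K with suc j ≡ᵇ K in eq
... | false = refl
... | true  = ⊥-elim (<⇒≢ j<K (≡ᵇ⇒≡ (suc j) K (Equivalence.from T-≡ eq)))

next-last : ∀ j → next (suc j) j ≡ 0
next-last j with j ≡ᵇ j in eq
... | true  = refl
... | false = ⊥-elim (≡false⇒¬T eq (≡⇒≡ᵇ j j refl))

next-injective : ∀ {K j j′} → next K j ≡ next K j′ → j ≡ j′
next-injective {K} {j} {j′} e with suc j ≡ᵇ K in eq | suc j′ ≡ᵇ K in eq′
... | true  | true  = suc-injective (trans (≡ᵇ⇒≡ (suc j) K (Equivalence.from T-≡ eq))
                                           (sym (≡ᵇ⇒≡ (suc j′) K (Equivalence.from T-≡ eq′))))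
... | false | false = suc-injective e

-- The values rise from index `0` to the last one, and the step from there leads back to `0`, so the
-- chain of inequalities closes.
cyclic-monotone⇒constant : ∀ {K} (v : Fin (suc K) → ℕ) →
  (∀ j j′ → toℕ j′ ≡ next (suc K) (toℕ j) → v j ≤ v j′) → ∀ j → v j ≡ v zero
cyclic-monotone⇒constant {K} v mono j = ≤-antisym (v≤v₀ j) (v₀≤v j)
  where
  step : ∀ (i : Fin K) → v (Fin.inject₁ i) ≤ v (suc i)
  step i = mono (Fin.inject₁ i) (suc i)
    (trans (cong suc (sym (Fin.toℕ-inject₁ i)))
           (sym (next-< (s≤s (subst (_< K) (sym (Fin.toℕ-inject₁ i)) (Fin.toℕ<n i))))))
  v₀≤v : ∀ j → v zero ≤ v j
  v₀≤v = <-weakInduction (λ j → v zero ≤ v j) ≤-refl (λ i le → ≤-trans le (step i))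
  v≤v₀ : ∀ j → v j ≤ v zero
  v≤v₀ = >-weakInduction (λ j → v j ≤ v zero)
    (mono (Fin.fromℕ K) zero (sym (trans (cong (next (suc K)) (Fin.toℕ-fromℕ K)) (next-last K))))
    (λ i le → ≤-trans (step i) le)

-- Pigeonhole: if `y` were missed, taking it out would inject `suc n` points into `n`.
injective⇒surjective : ∀ {n} {f : Fin n → Fin n} → Injective _≡_ _≡_ f → ∀ y → Σ[ x ∈ Fin n ] f x ≡ y
injective⇒surjective {suc n} {f} inj y with Fin.any? (λ x → f x Fin.≟ y)
... | yes hit = hit
... | no miss = ⊥-elim (1+n≰n (Fin.injective⇒≤ {f = λ x → Fin.punchOut {i = y} (λ e → miss (x , sym e))}
                  (λ e → inj (Fin.punchOut-injective {i = y} _ _ e))))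

Unique-lookup-injective : ∀ {A : Set} {xs : List A} → Unique xs → ∀ i j → lookup xs i ≡ lookup xs j → i ≡ j
Unique-lookup-injective (_ ∷ _) zero    zero    _ = refl
Unique-lookup-injective {xs = _ ∷ xs} (x∉ ∷ _) zero    (suc j) e = ⊥-elim (All.lookup x∉ (∈-lookup {xs = xs} j) e)
Unique-lookup-injective {xs = _ ∷ xs} (x∉ ∷ _) (suc i) zero    e = ⊥-elim (All.lookup x∉ (∈-lookup {xs = xs} i) (sym e))
Unique-lookup-injective (_ ∷ u) (suc i) (suc j) e = cong suc (Unique-lookup-injective u i j e)

-- The graph of a constraint satisfaction problem

module CSPGraph (h K N : ℕ) (rel : ℕ → ℕ → ℕ → ℕ → Bool) where

  L : List Vertex
  L = vertices h K N rel

  copy : Vertex → ℕ × ℕ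
  copy x = proj₁ x

  value : Vertex → ℕ
  value x = proj₁ (proj₂ x)

  Adjacent : Vertex → Vertex → Set
  Adjacent x y = T (adjacent K rel x y)

  -- Directed, with `adjacent` as its symmetric closure off the diagonal. The number `t` of a twin
  -- occurs in no condition, so vertices that differ only in `t` are true twins.
  data Conflict : Vertex → Vertex → Set where
    same  : ∀ {c p p′} → Conflict (c , p) (c , p′)
    half  : ∀ {i j a a′ t t′} → a′ < a → Conflict ((i , j) , (a , t)) ((i , next K j) , (a′ , t′))
    cross : ∀ {i j a a′ t t′} → ¬ T (rel i a j a′) → Conflict ((i , j) , (a , t)) ((j , i) , (a′ , t′))

  opaque
    unfolding conflict

    conflict⁺ : ∀ {x y} → Conflict x y → T (conflict K rel x y)
    conflict⁺ same      = Equivalence.from T-∨ (inj₁ (samePair⁺ refl))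
    conflict⁺ {(i , j) , (a , t)} {y} (half lt) =
      Equivalence.from (T-∨ {samePair (i , j) (proj₁ y)}) (inj₂ (Equivalence.from T-∨ (inj₁ (Equivalence.from T-∧ (samePair⁺ refl , <⇒<ᵇ lt)))))
    conflict⁺ {(i , j) , (a , t)} {y@(_ , (a′ , _))} (cross ¬r) =
      Equivalence.from (T-∨ {samePair (i , j) (proj₁ y)}) (inj₂ (Equivalence.from (T-∨ {samePair (i , next K j) (proj₁ y) ∧ (a′ <ᵇ a)})
        (inj₂ (Equivalence.from T-∧ (samePair⁺ refl , not-T ¬r)))))

    conflict⁻ : ∀ {x y} → T (conflict K rel x y) → Conflict x y
    conflict⁻ {(i , j) , (a , t)} {(i′ , j′) , (a′ , t′)} c with Equivalence.to T-∨ c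
    ... | inj₁ s with samePair⁻ {i , j} {i′ , j′} s
    ...   | refl = same
    conflict⁻ {(i , j) , (a , t)} {(i′ , j′) , (a′ , t′)} c | inj₂ c′ with Equivalence.to T-∨ c′
    ... | inj₁ m with Equivalence.to T-∧ m
    ...   | s , lt with samePair⁻ {i , next K j} {i′ , j′} s
    ...     | refl = half (<ᵇ⇒< a′ a lt)
    conflict⁻ {(i , j) , (a , t)} {(i′ , j′) , (a′ , t′)} c | inj₂ c′ | inj₂ m with Equivalence.to T-∧ m
    ...   | s , nr with samePair⁻ {j , i} {i′ , j′} s
    ...     | refl = cross (T-not nr)

  opaque
    unfolding adjacent

    adjacent⁺ : ∀ {x y} → x ≢ y → Conflict x y ⊎ Conflict y x → Adjacent x y
    adjacent⁺ {x} {y} x≢y c = Equivalence.from T-∧ (not-T (x≢y ∘ sameVertex⁻ {x} {y}) , Equivalence.from T-∨ (either c))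
      where
      either : Conflict x y ⊎ Conflict y x → T (conflict K rel x y) ⊎ T (conflict K rel y x)
      either (inj₁ c) = inj₁ (conflict⁺ c)
      either (inj₂ c) = inj₂ (conflict⁺ c)

    adjacent⁻ : ∀ {x y} → Adjacent x y → x ≢ y × (Conflict x y ⊎ Conflict y x)
    adjacent⁻ {x} {y} adj with Equivalence.to T-∧ adj
    ... | ns , c = (λ e → T-not ns (sameVertex⁺ e)) , either (Equivalence.to T-∨ c)
      where
      either : T (conflict K rel x y) ⊎ T (conflict K rel y x) → Conflict x y ⊎ Conflict y x
      either (inj₁ c) = inj₁ (conflict⁻ c)
      either (inj₂ c) = inj₂ (conflict⁻ c)

  adjacent-sym : ∀ x y → adjacent K rel x y ≡ adjacent K rel y x
  adjacent-sym x y = T-≡-iff (swap x y) (swap y x)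
    where
    swap : ∀ x y → Adjacent x y → Adjacent y x
    swap x y adj with adjacent⁻ {x} {y} adj
    ... | x≢y , inj₁ c = adjacent⁺ (x≢y ∘ sym) (inj₂ c)
    ... | x≢y , inj₂ c = adjacent⁺ (x≢y ∘ sym) (inj₁ c)

  adjacent-irrefl : ∀ x → adjacent K rel x x ≡ false
  adjacent-irrefl x = ¬T⇒≡false (λ adj → proj₁ (adjacent⁻ {x} adj) refl)

  cspGraph : Graph
  cspGraph = record
    { order  = length L
    ; adj    = λ u v → adjacent K rel (lookup L u) (lookup L v)
    ; symm   = λ u v → adjacent-sym (lookup L u) (lookup L v)
    ; irrefl = λ v → adjacent-irrefl (lookup L v)
    }

  encode-cspGraph : encodeGraph cspGraph ≡ enc (list (list bool)) (map (λ x → map (adjacent K rel x) L) L)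
  encode-cspGraph = cong (enc (list (list bool))) (begin
    tabulate (λ u → tabulate (λ v → adjacent K rel (lookup L u) (lookup L v)))
      ≡⟨ List.tabulate-cong (λ u → row (lookup L u)) ⟩
    tabulate (λ u → map (adjacent K rel (lookup L u)) L)
      ≡⟨ sym (List.map-tabulate (lookup L) (λ x → map (adjacent K rel x) L)) ⟩
    map (λ x → map (adjacent K rel x) L) (tabulate (lookup L))
      ≡⟨ cong (map (λ x → map (adjacent K rel x) L)) (List.tabulate-lookup L) ⟩
    map (λ x → map (adjacent K rel x) L) L ∎)
    where
    open ≡-Reasoning
    row : ∀ x → tabulate (λ v → adjacent K rel x (lookup L v)) ≡ map (adjacent K rel x) L
    row x = trans (sym (List.map-tabulate (lookup L) (adjacent K rel x))) (cong (map (adjacent K rel x)) (List.tabulate-lookup L))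

  label : Fin (length L) → Vertex
  label = lookup L

  label-injective : ∀ {u v} → label u ≡ label v → u ≡ v
  label-injective {u} {v} = Unique-lookup-injective
    (Unique.filter⁺ (T? ∘ _) (Unique.cartesianProduct⁺ (Unique.cartesianProduct⁺ (Unique.upTo⁺ K) (Unique.upTo⁺ K))
                                                       (Unique.cartesianProduct⁺ (Unique.upTo⁺ N) (Unique.upTo⁺ h)))) u v

  ∈L⁺ : ∀ {i j a t} → i < K → j < K → a < N → t < h → T (rel i a i a) → ((i , j) , (a , t)) ∈ L
  ∈L⁺ i<K j<K a<N t<h r = ∈-filter⁺ (T? ∘ _)
    (∈-cartesianProduct⁺ (∈-cartesianProduct⁺ (∈-upTo⁺ i<K) (∈-upTo⁺ j<K)) (∈-cartesianProduct⁺ (∈-upTo⁺ a<N) (∈-upTo⁺ t<h))) r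

  ∈L⁻ : ∀ {i j a t} → ((i , j) , (a , t)) ∈ L → (i < K × j < K) × (a < N × t < h) × T (rel i a i a)
  ∈L⁻ m =
    let m′ , r = ∈-filter⁻ (T? ∘ _) {xs = cartesianProduct (cartesianProduct (upTo K) (upTo K)) (cartesianProduct (upTo N) (upTo h))} m
        ij , at = ∈-cartesianProduct⁻ (cartesianProduct (upTo K) (upTo K)) (cartesianProduct (upTo N) (upTo h)) m′
        i , j = ∈-cartesianProduct⁻ (upTo K) (upTo K) ij
        a , t = ∈-cartesianProduct⁻ (upTo N) (upTo h) at
    in (∈-upTo⁻ i , ∈-upTo⁻ j) , (∈-upTo⁻ a , ∈-upTo⁻ t) , r

  -- The neighbours of x lie in four cliques: its own, those of the next
  -- and of the previous copy, and the one across.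
  Slot : Fin 4 → Vertex → Vertex → Set
  Slot zero                   x y = copy y ≡ copy x
  Slot (suc zero)             x y = copy y ≡ (proj₁ (copy x) , next K (proj₂ (copy x))) × value y < value x
  Slot (suc (suc zero))       x y = copy x ≡ (proj₁ (copy y) , next K (proj₂ (copy y))) × value x < value y
  Slot (suc (suc (suc zero))) x y = copy y ≡ (proj₂ (copy x) , proj₁ (copy x))

  slot : ∀ {x y} → Conflict x y ⊎ Conflict y x → Σ[ s ∈ Fin 4 ] Slot s x y
  slot (inj₁ same)      = zero , refl
  slot (inj₁ (half lt)) = suc zero , refl , lt
  slot (inj₁ (cross _)) = suc (suc (suc zero)) , refl
  slot (inj₂ same)      = zero , refl
  slot (inj₂ (half lt)) = suc (suc zero) , refl , lt
  slot (inj₂ (cross _)) = suc (suc (suc zero)) , refl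

  same-slot : ∀ s {x y z} → Slot s x y → Slot s x z → copy y ≡ copy z
  same-slot zero                   e e′ = trans e (sym e′)
  same-slot (suc zero)             (e , _) (e′ , _) = trans e (sym e′)
  -- Both copies precede that of `x`, and `next K` is injective.
  same-slot (suc (suc zero))       (e , _) (e′ , _) =
    let f = trans (sym e) e′ in cong₂ _,_ (cong proj₁ f) (next-injective {K} (cong proj₂ f))
  same-slot (suc (suc (suc zero))) e e′ = trans e (sym e′)

  same-copy : ∀ {x y} → copy x ≡ copy y → Conflict x y
  same-copy refl = same

  -- Four independent neighbours of x occupy all four slots.  Those in the
  -- previous, own and next copy then have increasing values, while the
  -- value of x is both below the first and above the last.
  cspGraph-K₁₄-free : (star 4 -Free) cspGraph
  cspGraph-K₁₄-free (_ , f , f-inj , _ , f-adj) = contradiction₄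
    where
    x : Vertex
    x = label (f zero)
    leaf : Fin 4 → Vertex
    leaf l = label (f (suc l))
    leaf-slot : ∀ l → Σ[ s ∈ Fin 4 ] Slot s x (leaf l)
    leaf-slot l = slot (proj₂ (adjacent⁻ {x} {leaf l} (Equivalence.from T-≡ (f-adj zero (suc l)))))
    leaf-≢ : ∀ {l l′} → l ≢ l′ → leaf l ≢ leaf l′
    leaf-≢ l≢l′ e = l≢l′ (Fin.suc-injective (f-inj (label-injective e)))
    independent : ∀ {l l′} → l ≢ l′ → ¬ (Conflict (leaf l) (leaf l′))
    independent {l} {l′} l≢l′ c = ≡false⇒¬T (f-adj (suc l) (suc l′)) (adjacent⁺ (leaf-≢ l≢l′) (inj₁ c))
    slot-injective : Injective _≡_ _≡_ (λ l → proj₁ (leaf-slot l))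
    slot-injective {l} {l′} e with l Fin.≟ l′
    ... | yes l≡l′ = l≡l′
    ... | no  l≢l′ = ⊥-elim (independent l≢l′ (same-copy
          (same-slot (proj₁ (leaf-slot l′)) (subst (λ s → Slot s x (leaf l)) e (proj₂ (leaf-slot l))) (proj₂ (leaf-slot l′)))))
    in-slot : ∀ s → Σ[ l ∈ Fin 4 ] Σ[ t ∈ Slot s x (leaf l) ] proj₁ (leaf-slot l) ≡ s
    in-slot s = let l , e = injective⇒surjective slot-injective s in
      l , subst (λ s → Slot s x (leaf l)) e (proj₂ (leaf-slot l)) , e
    half-copy : ∀ {y z} → copy z ≡ (proj₁ (copy y) , next K (proj₂ (copy y))) → value z < value y → Conflict y z
    half-copy refl lt = half lt
    contradiction₄ : ⊥
    contradiction₄ with in-slot zero | in-slot (suc zero) | in-slot (suc (suc zero))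
    ... | o , own , o∈ | n , (nxt , n<x) , n∈ | p , (prv , x<p) , p∈ =
      <-irrefl refl (<-≤-trans x<p (≤-trans p≤o (≤-trans o≤n (<⇒≤ n<x))))
      where
      o≢n : o ≢ n
      o≢n refl with () ← trans (sym o∈) n∈
      p≢o : p ≢ o
      p≢o refl with () ← trans (sym p∈) o∈
      o≤n : value (leaf o) ≤ value (leaf n)
      o≤n = ≮⇒≥ (λ lt → independent o≢n (half-copy (trans nxt (cong (λ c → proj₁ c , next K (proj₂ c)) (sym own))) lt))
      p≤o : value (leaf p) ≤ value (leaf o)
      p≤o = ≮⇒≥ (λ lt → independent p≢o (half-copy (trans own prv) lt))

-- Solutions and induced matchings

module _ (H : Graph) (complete : IsComplete H) (K N : ℕ) (rel : ℕ → ℕ → ℕ → ℕ → Bool) where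

  open CSPGraph (Graph.order H) K N rel

  private
    h : ℕ
    h = Graph.order H

  -- The members are indexed by pairs of a variable and a copy, and each consists of the `h` twins
  -- that carry the chosen value. Twins are pairwise adjacent, and so are the vertices of the
  -- complete graph `H`.
  solution⇒matching : 0 < h → Solution K N rel → InducedMatching H cspGraph (K * K)
  solution⇒matching 0<h sol = record
    { member     = member
    ; distinct   = λ {m} {m′} → distinct {m} {m′}
    ; occurrence = occurrence
    ; disjoint   = λ {m} {m′} → disjoint {m} {m′}
    ; no-edge    = λ {m} {m′} → no-edge {m} {m′}
    }
    where
    open Solution sol

    fst snd : Fin (K * K) → Fin K
    fst m = proj₁ (Fin.remQuot {K} K m)
    snd m = proj₂ (Fin.remQuot {K} K m)

    copyOf : Fin (K * K) → ℕ × ℕ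
    copyOf m = toℕ (fst m) , toℕ (snd m)

    copyOf-injective : ∀ {m m′} → copyOf m ≡ copyOf m′ → m ≡ m′
    copyOf-injective {m} {m′} e = begin
      m                                      ≡⟨ sym (Fin.combine-remQuot {K} K m) ⟩
      Fin.combine (fst m) (snd m)            ≡⟨ cong₂ Fin.combine (Fin.toℕ-injective (cong proj₁ e)) (Fin.toℕ-injective (cong proj₂ e)) ⟩
      Fin.combine (fst m′) (snd m′)          ≡⟨ Fin.combine-remQuot {K} K m′ ⟩
      m′                                     ∎
      where open ≡-Reasoning

    selected : Fin (K * K) → Vertex → Bool
    selected m x = samePair (copy x) (copyOf m) ∧ (value x ≡ᵇ α (fst m))

    member : Fin (K * K) → Subset (length L)
    member m = Vec.tabulate (λ v → selected m (label v))

    Selected : Fin (K * K) → Vertex → Set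
    Selected m x = copy x ≡ copyOf m × value x ≡ α (fst m)

    member⁻ : ∀ {m v} → v ∈ˢ member m → Selected m (label v)
    member⁻ {m} {v} v∈ =
      let s , e = Equivalence.to T-∧ (Equivalence.from T-≡
                    (trans (sym (Vec.lookup∘tabulate (λ v → selected m (label v)) v)) (Vec.[]=⇒lookup v∈)))
      in samePair⁻ s , ≡ᵇ⇒≡ _ _ e

    member⁺ : ∀ {m v} → Selected m (label v) → v ∈ˢ member m
    member⁺ {m} {v} (c , e) = Vec.lookup⇒[]= v (member m)
      (trans (Vec.lookup∘tabulate (λ v → selected m (label v)) v)
             (Equivalence.to T-≡ (Equivalence.from T-∧ (samePair⁺ c , ≡⇒≡ᵇ _ _ e))))

    twin∈L : ∀ m (t : Fin h) → (copyOf m , (α (fst m) , toℕ t)) ∈ L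
    twin∈L m t = ∈L⁺ (Fin.toℕ<n (fst m)) (Fin.toℕ<n (snd m)) (α<N (fst m)) (Fin.toℕ<n t) (related (fst m) (fst m))

    twin : Fin (K * K) → Fin h → Fin (length L)
    twin m t = index (twin∈L m t)

    label-twin : ∀ m t → label (twin m t) ≡ (copyOf m , (α (fst m) , toℕ t))
    label-twin m t = sym (lookup-index (twin∈L m t))

    twin∈member : ∀ m t → twin m t ∈ˢ member m
    twin∈member m t = member⁺ {m} (cong proj₁ (label-twin m t) , cong (proj₁ ∘ proj₂) (label-twin m t))

    twin-injective : ∀ m → Injective _≡_ _≡_ (twin m)
    twin-injective m {t} {t′} e = Fin.toℕ-injective (cong (proj₂ ∘ proj₂)
      (trans (sym (label-twin m t)) (trans (cong label e) (label-twin m t′))))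

    disjoint : ∀ {m m′} → m ≢ m′ → ∀ {v} → v ∈ˢ member m → v ∉ˢ member m′
    disjoint {m} {m′} m≢m′ v∈ v∈′ =
      m≢m′ (copyOf-injective (trans (sym (proj₁ (member⁻ {m} v∈))) (proj₁ (member⁻ {m′} v∈′))))

    distinct : Injective _≡_ _≡_ member
    distinct {m} {m′} e with m Fin.≟ m′
    ... | yes m≡m′ = m≡m′
    -- Disjoint members could coincide only if they were empty, and `0 < h` provides a vertex.
    ... | no  m≢m′ = ⊥-elim (disjoint m≢m′ (twin∈member m t) (subst (twin m t ∈ˢ_) e (twin∈member m t)))
      where
      t : Fin h
      t = fromℕ< 0<h

    occurrence : ∀ m → IsOccurrence H cspGraph (member m)
    occurrence m = twin m , twin-injective m , (λ v → mk⇔ (to v) (from v)) , adj-twin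
      where
      to : ∀ v → v ∈ˢ member m → Σ[ t ∈ Fin h ] twin m t ≡ v
      to v v∈ = t , label-injective (trans (label-twin m t)
                  (cong₂ _,_ (sym (proj₁ sel)) (cong₂ _,_ (sym (proj₂ sel)) (Fin.toℕ-fromℕ< t<h))))
        where
        sel = member⁻ {m} v∈
        t<h : proj₂ (proj₂ (label v)) < h
        t<h = proj₂ (proj₁ (proj₂ (∈L⁻ (∈-lookup {xs = L} v))))
        t = fromℕ< t<h
      from : ∀ v → Σ[ t ∈ Fin h ] twin m t ≡ v → v ∈ˢ member m
      from v (t , refl) = twin∈member m t
      adj-twin : ∀ t t′ → Graph.adj cspGraph (twin m t) (twin m t′) ≡ Graph.adj H t t′
      adj-twin t t′ with t Fin.≟ t′
      ... | yes refl = trans (Graph.irrefl cspGraph (twin m t)) (sym (Graph.irrefl H t))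
      ... | no t≢t′  = trans
        (Equivalence.to T-≡ (adjacent⁺ (λ e → t≢t′ (twin-injective m (label-injective e)))
          (inj₁ (same-copy (trans (cong proj₁ (label-twin m t)) (cong proj₁ (sym (label-twin m t′))))))))
        (sym (complete t t′ t≢t′))

    no-conflict : ∀ {m m′ x y} → m ≢ m′ → Selected m x → Selected m′ y → ¬ Conflict x y
    no-conflict m≢m′ (refl , refl) (e , _) same = m≢m′ (copyOf-injective e)
    no-conflict {m} {m′} m≢m′ (refl , refl) (e , e′) (half a′<a) =
      <⇒≢ a′<a (trans e′ (cong α (Fin.toℕ-injective (sym (cong proj₁ e)))))
    no-conflict {m} {m′} m≢m′ (refl , refl) (e , e′) (cross ¬r) =
      ¬r (subst₂ (λ j a → T (rel (toℕ (fst m)) (α (fst m)) j a)) (sym (cong proj₁ e)) (sym e′) (related (fst m) (fst m′)))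

    no-edge : ∀ {m m′} → m ≢ m′ → ∀ {u v} → u ∈ˢ member m → v ∈ˢ member m′ → Graph.adj cspGraph u v ≡ false
    no-edge {m} {m′} m≢m′ {u} {v} u∈ v∈ = ¬T⇒≡false (λ adj → none (proj₂ (adjacent⁻ {label u} {label v} adj)))
      where
      none : ¬ (Conflict (label u) (label v) ⊎ Conflict (label v) (label u))
      none (inj₁ c) = no-conflict m≢m′ (member⁻ {m} u∈) (member⁻ {m′} v∈) c
      none (inj₂ c) = no-conflict (m≢m′ ∘ sym) (member⁻ {m′} v∈) (member⁻ {m} u∈) c

  -- One vertex from each member gives `K * K` independent vertices. They lie in different copies,
  -- of which there are `K * K`, so every copy contains one. All copies of a variable then carry the
  -- same value, and it is read off copy `i` of variable `i`.
  matching⇒solution : 0 < h → InducedMatching H cspGraph (K * K) → Solution K N rel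
  matching⇒solution 0<h M = record { α = λ i → val i i ; α<N = λ i → value<N i i ; related = related }
    where
    open InducedMatching M

    rep : Fin (K * K) → Fin (length L)
    rep m = proj₁ (occurrence m) (fromℕ< 0<h)

    rep∈ : ∀ m → rep m ∈ˢ member m
    rep∈ m = Equivalence.from (proj₁ (proj₂ (proj₂ (occurrence m))) (rep m)) (_ , refl)

    independent : ∀ {m m′} → m ≢ m′ → ¬ Conflict (label (rep m)) (label (rep m′))
    independent {m} {m′} m≢m′ c = ≡false⇒¬T (no-edge m≢m′ (rep∈ m) (rep∈ m′))
      (adjacent⁺ (λ e → disjoint m≢m′ (subst (_∈ˢ member m) (label-injective e) (rep∈ m)) (rep∈ m′)) (inj₁ c))

    i<K : ∀ v → proj₁ (copy (label v)) < K
    i<K v = proj₁ (proj₁ (∈L⁻ (∈-lookup {xs = L} v)))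

    j<K : ∀ v → proj₂ (copy (label v)) < K
    j<K v = proj₂ (proj₁ (∈L⁻ (∈-lookup {xs = L} v)))

    clique : Fin (K * K) → Fin (K * K)
    clique m = Fin.combine (fromℕ< (i<K (rep m))) (fromℕ< (j<K (rep m)))

    clique-injective : Injective _≡_ _≡_ clique
    clique-injective {m} {m′} e with m Fin.≟ m′
    ... | yes m≡m′ = m≡m′
    ... | no  m≢m′ =
      let ei , ej = Fin.combine-injective (fromℕ< (i<K (rep m))) (fromℕ< (j<K (rep m))) _ _ e
      in ⊥-elim (independent m≢m′ (same-copy (cong₂ _,_
           (Fin.fromℕ<-injective _ _ (i<K (rep m)) (i<K (rep m′)) ei)
           (Fin.fromℕ<-injective _ _ (j<K (rep m)) (j<K (rep m′)) ej))))

    at : Fin K → Fin K → Fin (K * K)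
    at i j = proj₁ (injective⇒surjective clique-injective (Fin.combine i j))

    vertex : Fin K → Fin K → Vertex
    vertex i j = label (rep (at i j))

    copy-vertex : ∀ i j → copy (vertex i j) ≡ (toℕ i , toℕ j)
    copy-vertex i j =
      let v = rep (at i j)
          ei , ej = Fin.combine-injective (fromℕ< (i<K v)) (fromℕ< (j<K v)) i j
                      (proj₂ (injective⇒surjective clique-injective (Fin.combine i j)))
      in cong₂ _,_ (trans (sym (Fin.toℕ-fromℕ< (i<K v))) (cong toℕ ei)) (trans (sym (Fin.toℕ-fromℕ< (j<K v))) (cong toℕ ej))

    val : Fin K → Fin K → ℕ
    val i j = value (vertex i j)

    value<N : ∀ i j → val i j < N
    value<N i j = proj₁ (proj₁ (proj₂ (∈L⁻ (∈-lookup {xs = L} (rep (at i j))))))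

    vertices-independent : ∀ {i j i′ j′} → (i , j) ≢ (i′ , j′) → ¬ Conflict (vertex i j) (vertex i′ j′)
    vertices-independent {i} {j} {i′} {j′} ≢ = independent λ e → ≢
      (let c = trans (sym (copy-vertex i j)) (trans (cong (copy ∘ label ∘ rep) e) (copy-vertex i′ j′))
       in cong₂ _,_ (Fin.toℕ-injective (cong proj₁ c)) (Fin.toℕ-injective (cong proj₂ c)))

    half′ : ∀ {x y i j} → copy x ≡ (i , j) → copy y ≡ (i , next K j) → value y < value x → Conflict x y
    half′ refl refl lt = half lt

    cross′ : ∀ {x y i j} → copy x ≡ (i , j) → copy y ≡ (j , i) → ¬ T (rel i (value x) j (value y)) → Conflict x y
    cross′ refl refl ¬r = cross ¬r

    val-monotone : ∀ i j j′ → toℕ j′ ≡ next K (toℕ j) → val i j ≤ val i j′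
    val-monotone i j j′ e with j Fin.≟ j′
    ... | yes refl = ≤-refl
    ... | no  j≢j′ = ≮⇒≥ λ lt → vertices-independent (j≢j′ ∘ cong proj₂)
          (half′ (copy-vertex i j) (trans (copy-vertex i j′) (cong (toℕ i ,_) e)) lt)

    constant : ∀ {K′} (v : Fin K′ → ℕ) → (∀ j j′ → toℕ j′ ≡ next K′ (toℕ j) → v j ≤ v j′) → ∀ j j′ → v j ≡ v j′
    constant {suc K′} v mono j j′ = trans (cyclic-monotone⇒constant v mono j) (sym (cyclic-monotone⇒constant v mono j′))

    related : ∀ i j → T (rel (toℕ i) (val i i) (toℕ j) (val j j))
    related i j with i Fin.≟ j
    ... | yes refl = subst (λ k → T (rel k (val i i) k (val i i))) (cong proj₁ (copy-vertex i i))
                       (proj₂ (proj₂ (∈L⁻ (∈-lookup {xs = L} (rep (at i i))))))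
    -- Only copy `j` of variable `i` and copy `i` of variable `j` see the constraint between the
    -- two; constancy carries it to the copies from which the solution is read.
    ... | no  i≢j with T? (rel (toℕ i) (val i j) (toℕ j) (val j i))
    ...   | yes r = subst₂ (λ a b → T (rel (toℕ i) a (toℕ j) b))
                      (constant (val i) (val-monotone i) j i) (constant (val j) (val-monotone j) i j) r
    ...   | no ¬r = ⊥-elim (vertices-independent (i≢j ∘ cong proj₁) (cross′ (copy-vertex i j) (copy-vertex j i) ¬r))

-- From circuits of weft one to binary constraint satisfaction

Block Claim RawGate Half Entry : Set
Block   = ℕ × (ℕ × ℕ)
Claim   = ℕ × Bool
RawGate = ℕ × List ℕ
Half    = Bool × (Bool × Bool)
Entry   = Half × Half

blockᵗ claimᵗ gateᵗ halfᵗ entryᵗ instanceᵗ : Ty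
blockᵗ    = nat ⊗ nat ⊗ nat
claimᵗ    = nat ⊗ bool
gateᵗ     = nat ⊗ list nat
halfᵗ     = bool ⊗ bool ⊗ bool
entryᵗ    = halfᵗ ⊗ halfᵗ
instanceᵗ = nat ⊗ nat ⊗ list gateᵗ

halfOf : Bool → Entry → Half
halfOf true  e = proj₁ e
halfOf false e = proj₂ e

-- For a wire and a truth value b: do the blocks force the value b, is b
-- claimed, and is the claim (if made) supported?
is cl ok : Bool → Entry → Bool
is b e = proj₁ (halfOf b e)
cl b e = proj₁ (proj₂ (halfOf b e))
ok b e = proj₂ (proj₂ (halfOf b e))

noEntry : Entry
noEntry = (false , false , false) , (false , false , false)

hasValue : Bool → Bool → Bool
hasValue true  c = c
hasValue false c = not c

claimed : List Claim → ℕ → Bool → Bool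
claimed S ℓ b = any (λ c → (proj₁ c ≡ᵇ ℓ) ∧ hasValue b (proj₂ c)) S

-- A block (p , (s , e)) says that the inputs s, …, e − 1 are false and
-- input e (if there is one) is true.
inputIs : Bool → List Block → ℕ → Bool
inputIs true  Bs v = any (λ x → proj₂ (proj₂ x) ≡ᵇ v) Bs
inputIs false Bs v = any (λ x → (proj₁ (proj₂ x) ≤ᵇ v) ∧ (v <ᵇ proj₂ (proj₂ x))) Bs

-- A claim about an input is tested against the blocks at hand, and passes if none of them covers
-- the input. If it is false, the test of a tuple that contains the right block fails.
inputHalf : List Claim → List Block → ℕ → Bool → Half
inputHalf S Bs v b = inputIs b Bs v , claimed S v b , not (claimed S v b ∧ inputIs (not b) Bs v)

inputEntry : List Claim → List Block → ℕ → Entry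
inputEntry S Bs v = inputHalf S Bs v true , inputHalf S Bs v false

-- The gates with universalTag b have the value b iff all operands do, and
-- those with universalTag (not b) iff some operand does.
universalTag : Bool → ℕ
universalTag true  = 1
universalTag false = 2

operandEntries : List Entry → List ℕ → List Entry
operandEntries env is = map (nth noEntry env) is

-- This is Kleene's three-valued evaluation: `is true` and `is false` are both false where the
-- blocks at hand leave the value open.
gateIs : List Entry → RawGate → Bool → Bool
gateIs env (tag , is′) b =
  -- Tag `0` is negation, whose operand is stored as the length of the list.
  if tag ≡ᵇ 0 then is (not b) (nth noEntry env (length is′))
  else if tag ≡ᵇ universalTag b then all (is b) (operandEntries env is′)
  else any (is b) (operandEntries env is′)

gateSupport : List Entry → RawGate → Bool → Bool
gateSupport env (tag , is′) b =
  if tag ≡ᵇ 0 then cl (not b) (nth noEntry env (length is′))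
  else if tag ≡ᵇ universalTag b then
    (if 2 <ᵇ length is′ then all (λ e → not (is (not b) e)) (operandEntries env is′)
     else all (cl b) (operandEntries env is′))
  else any (cl b) (operandEntries env is′)

gateHalf : List Claim → List Entry → RawGate → Bool → Half
gateHalf S env g b = gateIs env g b , claimed S (length env) b , (not (claimed S (length env) b) ∨ gateSupport env g b)

gateEntry : List Claim → List Entry → RawGate → Entry
gateEntry S env g = gateHalf S env g true , gateHalf S env g false

entries : List Claim → List Block → ℕ → List RawGate → List Entry
entries S Bs n gs = foldr (λ g env → gateEntry S env g ∷ env) (map (inputEntry S Bs) (upTo n)) gs

accepts : List Claim → List Block → ℕ → List RawGate → Bool
accepts S Bs n gs =
  all (λ e → ok true e ∧ ok false e) (entries S Bs n gs) ∧ cl true (nth noEntry (entries S Bs n gs) 0)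

blockOK : ℕ → ℕ → Block → Bool
blockOK k n (p , s , e) = (s ≤ᵇ e) ∧ (not (p ≡ᵇ 0) ∨ (s ≡ᵇ 0)) ∧ (not (p ≡ᵇ k) ∨ (e ≡ᵇ n))

-- Tuples that share a position must show the same block there, and consecutive blocks must adjoin.
-- Any two positions occur together in some pair of variables, so these binary conditions glue the
-- tuples into one system of blocks.
compatible : Block → Block → Bool
compatible (p , s , e) (p′ , s′ , e′) =
  (not (p ≡ᵇ p′) ∨ ((s ≡ᵇ s′) ∧ (e ≡ᵇ e′))) ∧ (not (suc p ≡ᵇ p′) ∨ (suc e ≡ᵇ s′))

consistent : ℕ → ℕ → List Block → Bool
consistent k n Bs = all (blockOK k n) Bs ∧ all (λ x → all (compatible x) Bs) Bs

Instance : Set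
Instance = ℕ × (ℕ × List RawGate)

check : Instance → List Claim → List Block → Bool
check (k , n , gs) S Bs = consistent k n Bs ∧ accepts S Bs n gs

claimSets : ℕ → Instance → List (List Claim)
claimSets M (k , n , gs) = tuples M (cartesianProduct (upTo (n + length gs)) (true ∷ false ∷ []))

-- A variable is the number of a q-tuple of positions of blocks, and a value the
-- number of a pair: the number of a claim set, and the (s , e) of the q blocks.
variables : ℕ → ℕ → List (List ℕ)
variables q k = tuples q (upTo (suc k))

values : ℕ → ℕ → Instance → List (ℕ × List (ℕ × ℕ))
values q M I@(k , n , gs) =
  cartesianProduct (upTo (length (claimSets M I))) (tuples q (cartesianProduct (upTo (suc n)) (upTo (suc n))))

blocksOf : ℕ → List ℕ → List (ℕ × ℕ) → List Block
blocksOf q ps V = map (λ m → nth 0 ps m , nth (0 , 0) V m) (upTo q)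

-- The claims are not divided among the variables: every value carries the number of a whole claim
-- set, and equality of these numbers makes the set common to all.
relation : ℕ → ℕ → Instance → ℕ → ℕ → ℕ → ℕ → Bool
relation q M I i a j b =
  (proj₁ (nth (0 , []) (values q M I) a) ≡ᵇ proj₁ (nth (0 , []) (values q M I) b))
  ∧ check I (nth [] (claimSets M I) (proj₁ (nth (0 , []) (values q M I) a)))
      (blocksOf q (nth [] (variables q (proj₁ I)) i) (proj₂ (nth (0 , []) (values q M I) a))
       ++ blocksOf q (nth [] (variables q (proj₁ I)) j) (proj₂ (nth (0 , []) (values q M I) b)))

numVariables numValues : ℕ → ℕ → Instance → ℕ
numVariables q M I = length (variables q (proj₁ I))
numValues    q M I = length (values q M I)

instanceVertices : ℕ → ℕ → ℕ → Instance → List Vertex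
instanceVertices h q M I = vertices h (numVariables q M I) (numValues q M I) (relation q M I)

reduction : ℕ → ℕ → ℕ → Instance → ℕ × List (List Bool)
reduction h q M I =
  numVariables q M I * numVariables q M I ,
  map (λ x → map (adjacent (numVariables q M I) (relation q M I) x) (instanceVertices h q M I)) (instanceVertices h q M I)

-- The reduction is polynomial

halfOfᵖ : ∀ {Γ e} b → PolyTime Γ entryᵗ e → PolyTime Γ halfᵗ (λ γ → halfOf b (e γ))
halfOfᵖ true  E = E ⨾ fstᵖ
halfOfᵖ false E = E ⨾ sndᵖ

isᵖ : ∀ {Γ e} b → PolyTime Γ entryᵗ e → PolyTime Γ bool (λ γ → is b (e γ))
isᵖ b E = halfOfᵖ b E ⨾ fstᵖ

clᵖ : ∀ {Γ e} b → PolyTime Γ entryᵗ e → PolyTime Γ bool (λ γ → cl b (e γ))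
clᵖ b E = halfOfᵖ b E ⨾ sndᵖ ⨾ fstᵖ

okᵖ : ∀ {Γ e} b → PolyTime Γ entryᵗ e → PolyTime Γ bool (λ γ → ok b (e γ))
okᵖ b E = halfOfᵖ b E ⨾ sndᵖ ⨾ sndᵖ

noEntryᵖ : ∀ {Γ} → PolyTime Γ entryᵗ (λ _ → noEntry)
noEntryᵖ = pairᵖ noHalf noHalf
  where
  noHalf : ∀ {Γ} → PolyTime Γ halfᵗ (λ _ → false , false , false)
  noHalf = pairᵖ falseᵖ (pairᵖ falseᵖ falseᵖ)

hasValueᵖ : ∀ {Γ c} b → PolyTime Γ bool c → PolyTime Γ bool (λ γ → hasValue b (c γ))
hasValueᵖ true  C = C
hasValueᵖ false C = notᵖ C

claimedᵖ : ∀ {Γ S ℓ} → PolyTime Γ (list claimᵗ) S → PolyTime Γ nat ℓ → ∀ b → PolyTime Γ bool (λ γ → claimed (S γ) (ℓ γ) b)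
claimedᵖ S ℓ b = anyᵖ ((sndᵖ ⨾ fstᵖ) ≡ᵖ (fstᵖ ⨾ ℓ) ∧ᵖ hasValueᵖ b (sndᵖ ⨾ sndᵖ)) S

inputIsᵖ : ∀ {Γ Bs v} b → PolyTime Γ (list blockᵗ) Bs → PolyTime Γ nat v → PolyTime Γ bool (λ γ → inputIs b (Bs γ) (v γ))
inputIsᵖ true  Bs v = anyᵖ ((sndᵖ ⨾ sndᵖ ⨾ sndᵖ) ≡ᵖ (fstᵖ ⨾ v)) Bs
inputIsᵖ false Bs v = anyᵖ ((sndᵖ ⨾ sndᵖ ⨾ fstᵖ) ≤ᵖ (fstᵖ ⨾ v) ∧ᵖ (fstᵖ ⨾ v) <ᵖ (sndᵖ ⨾ sndᵖ ⨾ sndᵖ)) Bs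

inputHalfᵖ : ∀ {Γ S Bs v} → PolyTime Γ (list claimᵗ) S → PolyTime Γ (list blockᵗ) Bs → PolyTime Γ nat v →
             ∀ b → PolyTime Γ halfᵗ (λ γ → inputHalf (S γ) (Bs γ) (v γ) b)
inputHalfᵖ S Bs v b =
  pairᵖ (inputIsᵖ b Bs v) (pairᵖ (claimedᵖ S v b) (notᵖ (claimedᵖ S v b ∧ᵖ inputIsᵖ (not b) Bs v)))

operandEntriesᵖ : ∀ {Γ env is′} → PolyTime Γ (list entryᵗ) env → PolyTime Γ (list nat) is′ →
                  PolyTime Γ (list entryᵗ) (λ γ → operandEntries (env γ) (is′ γ))
operandEntriesᵖ env is′ = mapᵖ (nthᵖ noEntryᵖ (fstᵖ ⨾ env) sndᵖ) is′

gateIsᵖ : ∀ {Γ env g} → PolyTime Γ (list entryᵗ) env → PolyTime Γ gateᵗ g →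
          ∀ b → PolyTime Γ bool (λ γ → gateIs (env γ) (g γ) b)
gateIsᵖ env g b =
  ifᵖ ((g ⨾ fstᵖ) ≡ᵖ conᵖ 0) (isᵖ (not b) (nthᵖ noEntryᵖ env (lengthᵖ (g ⨾ sndᵖ))))
    (ifᵖ ((g ⨾ fstᵖ) ≡ᵖ conᵖ (universalTag b)) (allᵖ (isᵖ b sndᵖ) (operandEntriesᵖ env (g ⨾ sndᵖ)))
      (anyᵖ (isᵖ b sndᵖ) (operandEntriesᵖ env (g ⨾ sndᵖ))))

gateSupportᵖ : ∀ {Γ env g} → PolyTime Γ (list entryᵗ) env → PolyTime Γ gateᵗ g →
               ∀ b → PolyTime Γ bool (λ γ → gateSupport (env γ) (g γ) b)
gateSupportᵖ env g b =
  ifᵖ ((g ⨾ fstᵖ) ≡ᵖ conᵖ 0) (clᵖ (not b) (nthᵖ noEntryᵖ env (lengthᵖ (g ⨾ sndᵖ))))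
    (ifᵖ ((g ⨾ fstᵖ) ≡ᵖ conᵖ (universalTag b))
      (ifᵖ (conᵖ 2 <ᵖ lengthᵖ (g ⨾ sndᵖ)) (allᵖ (notᵖ (isᵖ (not b) sndᵖ)) (operandEntriesᵖ env (g ⨾ sndᵖ)))
        (allᵖ (clᵖ b sndᵖ) (operandEntriesᵖ env (g ⨾ sndᵖ))))
      (anyᵖ (clᵖ b sndᵖ) (operandEntriesᵖ env (g ⨾ sndᵖ))))

gateHalfᵖ : ∀ {Γ S env g} → PolyTime Γ (list claimᵗ) S → PolyTime Γ (list entryᵗ) env → PolyTime Γ gateᵗ g →
            ∀ b → PolyTime Γ halfᵗ (λ γ → gateHalf (S γ) (env γ) (g γ) b)
gateHalfᵖ S env g b =
  pairᵖ (gateIsᵖ env g b)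
    (pairᵖ (claimedᵖ S (lengthᵖ env) b) (notᵖ (claimedᵖ S (lengthᵖ env) b) ∨ᵖ gateSupportᵖ env g b))

sz-entry : ∀ e → sz entryᵗ e ≤ 23
sz-entry (x , y) = s≤s (+-mono-≤ (sz-half x) (sz-half y))
  where
  sz-half : ∀ x → sz halfᵗ x ≤ 11
  sz-half (a , b , c) = s≤s (+-mono-≤ (size-bool a) (s≤s (+-mono-≤ (size-bool b) (size-bool c))))

entriesᵖ : ∀ {Γ S Bs n gs} → PolyTime Γ (list claimᵗ) S → PolyTime Γ (list blockᵗ) Bs → PolyTime Γ nat n →
           PolyTime Γ (list gateᵗ) gs → PolyTime Γ (list entryᵗ) (λ γ → entries (S γ) (Bs γ) (n γ) (gs γ))
entriesᵖ {S = S₀} S Bs n gs =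
  foldr⁺ᵖ (pairᵖ (gateHalfᵖ (fstᵖ ⨾ fstᵖ ⨾ S) sndᵖ (fstᵖ ⨾ sndᵖ) true)
                 (gateHalfᵖ (fstᵖ ⨾ fstᵖ ⨾ S) sndᵖ (fstᵖ ⨾ sndᵖ) false) ∷ᵖ sndᵖ)
    gs
    (mapᵖ (pairᵖ (inputHalfᵖ (fstᵖ ⨾ S) (fstᵖ ⨾ Bs) sndᵖ true) (inputHalfᵖ (fstᵖ ⨾ S) (fstᵖ ⨾ Bs) sndᵖ false)) (upToᵖ n))
    -- An entry consists of six booleans and has size at most 23; the list cell adds 1.
    (con 24) (λ γ g env → s≤s (+-monoˡ-≤ (sz (list entryᵗ) env) (sz-entry (gateEntry (S₀ γ) env g))))

acceptsᵖ : ∀ {Γ S Bs n gs} → PolyTime Γ (list claimᵗ) S → PolyTime Γ (list blockᵗ) Bs → PolyTime Γ nat n →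
           PolyTime Γ (list gateᵗ) gs → PolyTime Γ bool (λ γ → accepts (S γ) (Bs γ) (n γ) (gs γ))
acceptsᵖ S Bs n gs =
  allᵖ (okᵖ true sndᵖ ∧ᵖ okᵖ false sndᵖ) (entriesᵖ S Bs n gs) ∧ᵖ clᵖ true (nthᵖ noEntryᵖ (entriesᵖ S Bs n gs) (conᵖ 0))

blockOKᵖ : ∀ {Γ k n x} → PolyTime Γ nat k → PolyTime Γ nat n → PolyTime Γ blockᵗ x →
           PolyTime Γ bool (λ γ → blockOK (k γ) (n γ) (x γ))
blockOKᵖ k n x =
  (x ⨾ sndᵖ ⨾ fstᵖ) ≤ᵖ (x ⨾ sndᵖ ⨾ sndᵖ)
  ∧ᵖ (notᵖ ((x ⨾ fstᵖ) ≡ᵖ conᵖ 0) ∨ᵖ (x ⨾ sndᵖ ⨾ fstᵖ) ≡ᵖ conᵖ 0)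
  ∧ᵖ (notᵖ ((x ⨾ fstᵖ) ≡ᵖ k) ∨ᵖ (x ⨾ sndᵖ ⨾ sndᵖ) ≡ᵖ n)

compatibleᵖ : ∀ {Γ x y} → PolyTime Γ blockᵗ x → PolyTime Γ blockᵗ y → PolyTime Γ bool (λ γ → compatible (x γ) (y γ))
compatibleᵖ x y =
  (notᵖ ((x ⨾ fstᵖ) ≡ᵖ (y ⨾ fstᵖ))
    ∨ᵖ ((x ⨾ sndᵖ ⨾ fstᵖ) ≡ᵖ (y ⨾ sndᵖ ⨾ fstᵖ) ∧ᵖ (x ⨾ sndᵖ ⨾ sndᵖ) ≡ᵖ (y ⨾ sndᵖ ⨾ sndᵖ)))
  ∧ᵖ (notᵖ (sucᵖ (x ⨾ fstᵖ) ≡ᵖ (y ⨾ fstᵖ)) ∨ᵖ sucᵖ (x ⨾ sndᵖ ⨾ sndᵖ) ≡ᵖ (y ⨾ sndᵖ ⨾ fstᵖ))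

consistentᵖ : ∀ {Γ k n Bs} → PolyTime Γ nat k → PolyTime Γ nat n → PolyTime Γ (list blockᵗ) Bs →
              PolyTime Γ bool (λ γ → consistent (k γ) (n γ) (Bs γ))
consistentᵖ k n Bs =
  allᵖ (blockOKᵖ (fstᵖ ⨾ k) (fstᵖ ⨾ n) sndᵖ) Bs
  ∧ᵖ allᵖ (allᵖ (compatibleᵖ (fstᵖ ⨾ sndᵖ) sndᵖ) (fstᵖ ⨾ Bs)) Bs

checkᵖ : ∀ {Γ I S Bs} → PolyTime Γ instanceᵗ I → PolyTime Γ (list claimᵗ) S → PolyTime Γ (list blockᵗ) Bs →
         PolyTime Γ bool (λ γ → check (I γ) (S γ) (Bs γ))
checkᵖ I S Bs = consistentᵖ (I ⨾ fstᵖ) (I ⨾ sndᵖ ⨾ fstᵖ) Bs ∧ᵖ acceptsᵖ S Bs (I ⨾ sndᵖ ⨾ fstᵖ) (I ⨾ sndᵖ ⨾ sndᵖ)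

module _ (q M : ℕ) where

  claimSetsᵖ : ∀ {Γ I} → PolyTime Γ instanceᵗ I → PolyTime Γ (list (list claimᵗ)) (λ γ → claimSets M (I γ))
  claimSetsᵖ I = tuplesᵖ M (cartesianProductᵖ (upToᵖ ((I ⨾ sndᵖ ⨾ fstᵖ) +ᵖ lengthᵖ (I ⨾ sndᵖ ⨾ sndᵖ))) (trueᵖ ∷ᵖ falseᵖ ∷ᵖ []ᵖ))

  variablesᵖ : ∀ {Γ k} → PolyTime Γ nat k → PolyTime Γ (list (list nat)) (λ γ → variables q (k γ))
  variablesᵖ k = tuplesᵖ q (upToᵖ (sucᵖ k))

  valuesᵖ : ∀ {Γ I} → PolyTime Γ instanceᵗ I → PolyTime Γ (list (nat ⊗ list (nat ⊗ nat))) (λ γ → values q M (I γ))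
  valuesᵖ I = cartesianProductᵖ (upToᵖ (lengthᵖ (claimSetsᵖ I)))
                (tuplesᵖ q (cartesianProductᵖ (upToᵖ (sucᵖ (I ⨾ sndᵖ ⨾ fstᵖ))) (upToᵖ (sucᵖ (I ⨾ sndᵖ ⨾ fstᵖ)))))

  blocksOfᵖ : ∀ {Γ ps V} → PolyTime Γ (list nat) ps → PolyTime Γ (list (nat ⊗ nat)) V →
              PolyTime Γ (list blockᵗ) (λ γ → blocksOf q (ps γ) (V γ))
  blocksOfᵖ ps V = mapᵖ (pairᵖ (nthᵖ (conᵖ 0) (fstᵖ ⨾ ps) sndᵖ) (nthᵖ (pairᵖ (conᵖ 0) (conᵖ 0)) (fstᵖ ⨾ V) sndᵖ)) (upToᵖ (conᵖ q))

  relationᵖ : ∀ {Γ I i a j b} → PolyTime Γ instanceᵗ I → PolyTime Γ nat i → PolyTime Γ nat a → PolyTime Γ nat j → PolyTime Γ nat b →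
              PolyTime Γ bool (λ γ → relation q M (I γ) (i γ) (a γ) (j γ) (b γ))
  relationᵖ {Γ} I i a j b =
    (value a ⨾ fstᵖ) ≡ᵖ (value b ⨾ fstᵖ)
    ∧ᵖ checkᵖ I (nthᵖ []ᵖ (claimSetsᵖ I) (value a ⨾ fstᵖ))
         (blocksOfᵖ (variable′ i) (value a ⨾ sndᵖ) ++ᵖ blocksOfᵖ (variable′ j) (value b ⨾ sndᵖ))
    where
    value : ∀ {c} → PolyTime Γ nat c → PolyTime Γ _ _
    value c = nthᵖ (pairᵖ (conᵖ 0) []ᵖ) (valuesᵖ I) c
    variable′ : ∀ {c} → PolyTime Γ nat c → PolyTime Γ (list nat) _
    variable′ c = nthᵖ []ᵖ (variablesᵖ (I ⨾ fstᵖ)) c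

  numVariablesᵖ : ∀ {Γ I} → PolyTime Γ instanceᵗ I → PolyTime Γ nat (λ γ → numVariables q M (I γ))
  numVariablesᵖ I = lengthᵖ (variablesᵖ (I ⨾ fstᵖ))

  vertexᵗ : Ty
  vertexᵗ = (nat ⊗ nat) ⊗ (nat ⊗ nat)

  instanceVerticesᵖ : ∀ {Γ I} h → PolyTime Γ instanceᵗ I → PolyTime Γ (list vertexᵗ) (λ γ → instanceVertices h q M (I γ))
  instanceVerticesᵖ h I =
    filterᵖ (relationᵖ (fstᵖ ⨾ I) i a i a)
      (cartesianProductᵖ (cartesianProductᵖ (upToᵖ (numVariablesᵖ I)) (upToᵖ (numVariablesᵖ I)))
                         (cartesianProductᵖ (upToᵖ (lengthᵖ (valuesᵖ I))) (upToᵖ (conᵖ h))))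
    where
    i : ∀ {Γ} → PolyTime (Γ ⊗ vertexᵗ) nat (λ γ → proj₁ (proj₁ (proj₂ γ)))
    i = sndᵖ ⨾ fstᵖ ⨾ fstᵖ
    a : ∀ {Γ} → PolyTime (Γ ⊗ vertexᵗ) nat (λ γ → proj₁ (proj₂ (proj₂ γ)))
    a = sndᵖ ⨾ sndᵖ ⨾ fstᵖ

  opaque
    unfolding samePair conflict sameVertex adjacent

    samePairᵖ : ∀ {Γ x y} → PolyTime Γ (nat ⊗ nat) x → PolyTime Γ (nat ⊗ nat) y → PolyTime Γ bool (λ γ → samePair (x γ) (y γ))
    samePairᵖ x y = (x ⨾ fstᵖ) ≡ᵖ (y ⨾ fstᵖ) ∧ᵖ (x ⨾ sndᵖ) ≡ᵖ (y ⨾ sndᵖ)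

    nextᵖ : ∀ {Γ K j} → PolyTime Γ nat K → PolyTime Γ nat j → PolyTime Γ nat (λ γ → next (K γ) (j γ))
    nextᵖ K j = ifᵖ (sucᵖ j ≡ᵖ K) (conᵖ 0) (sucᵖ j)

    conflictᵖ : ∀ {Γ I x y} → PolyTime Γ instanceᵗ I → PolyTime Γ vertexᵗ x → PolyTime Γ vertexᵗ y →
                PolyTime Γ bool (λ γ → conflict (numVariables q M (I γ)) (relation q M (I γ)) (x γ) (y γ))
    conflictᵖ I x y =
      samePairᵖ (x ⨾ fstᵖ) (y ⨾ fstᵖ)
      ∨ᵖ (samePairᵖ (pairᵖ (x ⨾ fstᵖ ⨾ fstᵖ) (nextᵖ (numVariablesᵖ I) (x ⨾ fstᵖ ⨾ sndᵖ))) (y ⨾ fstᵖ)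
          ∧ᵖ (y ⨾ sndᵖ ⨾ fstᵖ) <ᵖ (x ⨾ sndᵖ ⨾ fstᵖ))
      ∨ᵖ (samePairᵖ (pairᵖ (x ⨾ fstᵖ ⨾ sndᵖ) (x ⨾ fstᵖ ⨾ fstᵖ)) (y ⨾ fstᵖ)
          ∧ᵖ notᵖ (relationᵖ I (x ⨾ fstᵖ ⨾ fstᵖ) (x ⨾ sndᵖ ⨾ fstᵖ) (x ⨾ fstᵖ ⨾ sndᵖ) (y ⨾ sndᵖ ⨾ fstᵖ)))

    adjacentᵖ : ∀ {Γ I x y} → PolyTime Γ instanceᵗ I → PolyTime Γ vertexᵗ x → PolyTime Γ vertexᵗ y →
                PolyTime Γ bool (λ γ → adjacent (numVariables q M (I γ)) (relation q M (I γ)) (x γ) (y γ))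
    adjacentᵖ I x y =
      notᵖ (samePairᵖ (x ⨾ fstᵖ) (y ⨾ fstᵖ) ∧ᵖ samePairᵖ (x ⨾ sndᵖ) (y ⨾ sndᵖ))
      ∧ᵖ (conflictᵖ I x y ∨ᵖ conflictᵖ I y x)

  reductionᵖ : ∀ h → PolyTime instanceᵗ (nat ⊗ list (list bool)) (reduction h q M)
  reductionᵖ h =
    pairᵖ (numVariablesᵖ idᵖ *ᵖ numVariablesᵖ idᵖ)
      (mapᵖ (mapᵖ (adjacentᵖ (fstᵖ ⨾ fstᵖ) (fstᵖ ⨾ sndᵖ) sndᵖ) (fstᵖ ⨾ instanceVerticesᵖ h idᵖ)) (instanceVerticesᵖ h idᵖ))

-- Truth values in circuits

all⁺ : ∀ {A : Set} (p : A → Bool) xs → (∀ {x} → x ∈ xs → T (p x)) → T (all p xs)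
all⁺ p []       f = tt
all⁺ p (x ∷ xs) f = Equivalence.from T-∧ (f (here refl) , all⁺ p xs (f ∘ there))

all⁻ : ∀ {A : Set} (p : A → Bool) {xs x} → T (all p xs) → x ∈ xs → T (p x)
all⁻ p t (here refl) = proj₁ (Equivalence.to T-∧ t)
all⁻ p {y ∷ _} t (there x∈) = all⁻ p (proj₂ (Equivalence.to (T-∧ {p y}) t)) x∈

any⁺ : ∀ {A : Set} (p : A → Bool) {xs x} → x ∈ xs → T (p x) → T (any p xs)
any⁺ p (here refl) t = Equivalence.from T-∨ (inj₁ t)
any⁺ p {y ∷ _} (there x∈) t = Equivalence.from (T-∨ {p y}) (inj₂ (any⁺ p x∈ t))

any⁻ : ∀ {A : Set} (p : A → Bool) xs → T (any p xs) → Σ[ x ∈ A ] x ∈ xs × T (p x)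
any⁻ p (x ∷ xs) t with Equivalence.to (T-∨ {p x}) t
... | inj₁ px = x , here refl , px
... | inj₂ t′ = let y , y∈ , py = any⁻ p xs t′ in y , there y∈ , py

imp⁺ : ∀ {a b} → (T a → T b) → T (not a ∨ b)
imp⁺ {true}  f = f tt
imp⁺ {false} f = tt

imp⁻ : ∀ {a b} → T (not a ∨ b) → T a → T b
imp⁻ {true} t _ = t

hasValue⁺ : ∀ b {c} → c ≡ b → T (hasValue b c)
hasValue⁺ true  refl = tt
hasValue⁺ false refl = tt

hasValue⁻ : ∀ b {c} → T (hasValue b c) → c ≡ b
hasValue⁻ true  t = Equivalence.to T-≡ t
hasValue⁻ false t = Equivalence.to T-not-≡ t

claimed⁺ : ∀ {S ℓ b} → (ℓ , b) ∈ S → T (claimed S ℓ b)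
claimed⁺ {S} {ℓ} {b} ∈S = any⁺ (λ c → (proj₁ c ≡ᵇ ℓ) ∧ hasValue b (proj₂ c)) ∈S
  (Equivalence.from T-∧ (≡⇒≡ᵇ ℓ ℓ refl , hasValue⁺ b refl))

claimed⁻ : ∀ {S ℓ b} → T (claimed S ℓ b) → (ℓ , b) ∈ S
claimed⁻ {S} {ℓ} {b} t with any⁻ (λ c → (proj₁ c ≡ᵇ ℓ) ∧ hasValue b (proj₂ c)) S t
... | (ℓ′ , b′) , ∈S , m with Equivalence.to (T-∧ {ℓ′ ≡ᵇ ℓ}) m
...   | e , v = subst₂ (λ l c → (l , c) ∈ S) (≡ᵇ⇒≡ ℓ′ ℓ e) (hasValue⁻ b v) ∈S

-- By De Morgan duality a conjunction with value true behaves like a disjunction with value false,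
-- and likewise with the values exchanged. Every argument about a gate and a value so has only the
-- three cases of `Mode`.
data Universal {w} : Gate w → Bool → List (Fin w) → Set where
  andᵍ : ∀ is → Universal (andᵍ is) true is
  orᵍ  : ∀ is → Universal (orᵍ is) false is

data Existential {w} : Gate w → Bool → List (Fin w) → Set where
  andᵍ : ∀ is → Existential (andᵍ is) false is
  orᵍ  : ∀ is → Existential (orᵍ is) true is

data Mode {w} : Gate w → Bool → Set where
  negation    : ∀ {b} i → Mode (notᵍ i) b
  universal   : ∀ {g b is} → Universal g b is → Mode g b
  existential : ∀ {g b is} → Existential g b is → Mode g b

mode : ∀ {w} (g : Gate w) b → Mode g b
mode (notᵍ i)  b     = negation i
mode (andᵍ is) true  = universal (andᵍ is)
mode (andᵍ is) false = existential (andᵍ is)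
mode (orᵍ is)  true  = existential (orᵍ is)
mode (orᵍ is)  false = universal (orᵍ is)

module _ {w} (ρ : Vec.Vec Bool w) where

  private
    val′ : Fin w → Bool
    val′ = Vec.lookup ρ

  universal-value⁺ : ∀ {g b is} → Universal g b is → (∀ {i} → i ∈ is → val′ i ≡ b) → evalGate ρ g ≡ b
  universal-value⁺ (andᵍ is) f = Equivalence.to T-≡ (all⁺ val′ is (λ i∈ → Equivalence.from T-≡ (f i∈)))
  universal-value⁺ (orᵍ is)  f = ¬T⇒≡false λ t →
    let _ , i∈ , v = any⁻ val′ is t in ≡false⇒¬T (f i∈) v

  universal-value⁻ : ∀ {g b is} → Universal g b is → evalGate ρ g ≡ b → ∀ {i} → i ∈ is → val′ i ≡ b
  universal-value⁻ (andᵍ is) e i∈ = Equivalence.to T-≡ (all⁻ val′ (Equivalence.from T-≡ e) i∈)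
  universal-value⁻ (orᵍ is)  e i∈ = ¬T⇒≡false λ v → ≡false⇒¬T e (any⁺ val′ i∈ v)

  existential-value⁺ : ∀ {g b is} → Existential g b is → ∀ {i} → i ∈ is → val′ i ≡ b → evalGate ρ g ≡ b
  existential-value⁺ (andᵍ is) i∈ e = ¬T⇒≡false λ t → ≡false⇒¬T e (all⁻ val′ t i∈)
  existential-value⁺ (orᵍ is)  i∈ e = Equivalence.to T-≡ (any⁺ val′ i∈ (Equivalence.from T-≡ e))

  existential-value⁻ : ∀ {g b is} → Existential g b is → evalGate ρ g ≡ b → Σ[ i ∈ Fin w ] i ∈ is × val′ i ≡ b
  existential-value⁻ (andᵍ is) e = search is e
    where
    search : ∀ is → all val′ is ≡ false → Σ[ i ∈ Fin w ] i ∈ is × val′ i ≡ false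
    search (i ∷ is) e with val′ i in eq
    ... | false = i , here refl , eq
    ... | true  = let j , j∈ , v = search is e in j , there j∈ , v
  existential-value⁻ (orᵍ is) e =
    let i , i∈ , v = any⁻ val′ is (Equivalence.from T-≡ e) in i , i∈ , Equivalence.to T-≡ v

-- The encoding of a negation has a number where the other gates have a list of numbers. As a tree,
-- the number `m` is also a list of `m` zeros, which gives all gates one type; the operand is
-- recovered as a length.
rawGate : ∀ {w} → Gate w → RawGate
rawGate (notᵍ i)  = 0 , replicate (toℕ i) 0
rawGate (andᵍ is) = 1 , map toℕ is
rawGate (orᵍ is)  = 2 , map toℕ is

raw : ∀ {n w} → Circuit n w → List RawGate
raw inputs  = []
raw (C ▷ g) = rawGate g ∷ raw C

encode-raw : ∀ {n w} (C : Circuit n w) → encodeGates C ≡ enc (list gateᵗ) (raw C)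
encode-raw inputs  = refl
encode-raw (C ▷ g) = cong₂ _∙_ (encode-rawGate g) (encode-raw C)
  where
  encode-index : ∀ m → encodeℕ m ≡ enc (list nat) (replicate m 0)
  encode-index zero    = refl
  encode-index (suc m) = cong (nil ∙_) (encode-index m)
  encode-indices : ∀ {w} (is : List (Fin w)) → encodeList encodeFin is ≡ enc (list nat) (map toℕ is)
  encode-indices []       = refl
  encode-indices (i ∷ is) = cong (encodeFin i ∙_) (encode-indices is)
  encode-rawGate : ∀ {w} (g : Gate w) → encodeGate g ≡ enc gateᵗ (rawGate g)
  encode-rawGate (notᵍ i)  = cong (nil ∙_) (encode-index (toℕ i))
  encode-rawGate (andᵍ is) = cong (encodeℕ 1 ∙_) (encode-indices is)
  encode-rawGate (orᵍ is)  = cong (encodeℕ 2 ∙_) (encode-indices is)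

length-raw : ∀ {n w} (C : Circuit n w) → n + length (raw C) ≡ w
length-raw {n} inputs = +-identityʳ n
length-raw {n} (C ▷ g) = trans (+-suc n (length (raw C))) (cong suc (length-raw C))

nth-∈ : ∀ {A : Set} (d : A) xs {m} → m < length xs → nth d xs m ∈ xs
nth-∈ d (x ∷ xs) {zero}  _        = here refl
nth-∈ d (x ∷ xs) {suc m} (s≤s m<) = there (nth-∈ d xs m<)

nth-map-applyUpTo : ∀ {A : Set} (d : A) (f : ℕ → A) (g : ℕ → ℕ) {n m} → m < n →
                    nth d (map f (applyUpTo g n)) m ≡ f (g m)
nth-map-applyUpTo d f g {suc n} {zero}  _        = refl
nth-map-applyUpTo d f g {suc n} {suc m} (s≤s m<) = nth-map-applyUpTo d f (g ∘ suc) m<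

-- Weft, depth and level of a wire

weftAt depthAt : ∀ {n w} → Circuit n w → Fin w → ℕ
weftAt  C i = Vec.lookup (pathCosts largeCost C) i
depthAt C i = Vec.lookup (pathCosts (λ _ → 1) C) i

≤-maximum : ∀ {A : Set} (f : A → ℕ) {is i} → i ∈ is → f i ≤ foldr _⊔_ 0 (map f is)
≤-maximum f (here refl) = m≤m⊔n _ _
≤-maximum f {j ∷ _} (there i∈) = ≤-trans (≤-maximum f i∈) (m≤n⊔m (f j) _)

operand-weft : ∀ {n w} (C : Circuit n w) g {i} → i ∈ operands g → largeCost g + weftAt C i ≤ weftAt (C ▷ g) zero
operand-weft C g i∈ = +-monoʳ-≤ (largeCost g) (≤-maximum (weftAt C) i∈)

operand-depth : ∀ {n w} (C : Circuit n w) g {i} → i ∈ operands g → suc (depthAt C i) ≤ depthAt (C ▷ g) zero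
operand-depth C g i∈ = s≤s (≤-maximum (depthAt C) i∈)

small-gate : ∀ {w} (g : Gate w) → ¬ T (2 <ᵇ length (operands g)) → length (operands g) ≤ 2
small-gate g small = ≮⇒≥ (small ∘ <⇒<ᵇ)

largeCost≡1 : ∀ {w} (g : Gate w) → T (2 <ᵇ length (operands g)) → largeCost g ≡ 1
largeCost≡1 g t with 2 <ᵇ length (operands g)
... | true = refl

universal-operands : ∀ {w} {g : Gate w} {b is} → Universal g b is → operands g ≡ is
universal-operands (andᵍ is) = refl
universal-operands (orᵍ is)  = refl

existential-operands : ∀ {w} {g : Gate w} {b is} → Existential g b is → operands g ≡ is
existential-operands (andᵍ is) = refl
existential-operands (orᵍ is)  = refl

-- Claims refer to levels because a wire keeps its level when gates are added, unlike its de Bruijn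
-- index. In `gateHalf` the level of the new gate appears as `length env`.
level : ∀ {n w} → Circuit n w → Fin w → ℕ
level inputs            i       = toℕ i
level (_▷_ {w = w} C g) zero    = w
level (C ▷ g)           (suc i) = level C i

level< : ∀ {n w} (C : Circuit n w) i → level C i < w
level< inputs  i       = Fin.toℕ<n i
level< (C ▷ g) zero    = n<1+n _
level< (C ▷ g) (suc i) = m≤n⇒m≤1+n (level< C i)

module _ {n : ℕ} (S : List Claim) (Bs : List Block) where

  env : ∀ {w} → Circuit n w → List Entry
  env C = entries S Bs n (raw C)

  entry : ∀ {w} → Circuit n w → Fin w → Entry
  entry C i = nth noEntry (env C) (toℕ i)

  length-env : ∀ {w} (C : Circuit n w) → length (env C) ≡ w
  length-env inputs  = trans (List.length-map _ (upTo n)) (List.length-upTo n)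
  length-env (C ▷ g) = cong suc (length-env C)

  entry-input : ∀ i → entry inputs i ≡ inputEntry S Bs (toℕ i)
  entry-input i = nth-map-applyUpTo noEntry (inputEntry S Bs) (λ v → v) (Fin.toℕ<n i)

  is-input : ∀ b i → is b (entry inputs i) ≡ inputIs b Bs (toℕ i)
  is-input true  i = cong (is true) (entry-input i)
  is-input false i = cong (is false) (entry-input i)

  ok-input : ∀ b v → ok b (inputEntry S Bs v) ≡ not (claimed S v b ∧ inputIs (not b) Bs v)
  ok-input true  v = refl
  ok-input false v = refl

  is-gate : ∀ {w} b (C : Circuit n w) g → is b (entry (C ▷ g) zero) ≡ gateIs (env C) (rawGate g) b
  is-gate true  C g = refl
  is-gate false C g = refl

  ok-gate : ∀ {w} b (C : Circuit n w) g →
            ok b (entry (C ▷ g) zero) ≡ not (claimed S w b) ∨ gateSupport (env C) (rawGate g) b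
  ok-gate true  C g = cong (λ ℓ → not (claimed S ℓ true) ∨ gateSupport (env C) (rawGate g) true) (length-env C)
  ok-gate false C g = cong (λ ℓ → not (claimed S ℓ false) ∨ gateSupport (env C) (rawGate g) false) (length-env C)

  cl-entry : ∀ {w} b (C : Circuit n w) i → cl b (entry C i) ≡ claimed S (level C i) b
  cl-entry true  inputs i = cong (cl true) (entry-input i)
  cl-entry false inputs i = cong (cl false) (entry-input i)
  cl-entry true  (C ▷ g) zero = cong (λ ℓ → claimed S ℓ true) (length-env C)
  cl-entry false (C ▷ g) zero = cong (λ ℓ → claimed S ℓ false) (length-env C)
  cl-entry b     (C ▷ g) (suc i) = cl-entry b C i

  module _ {w} (C : Circuit n w) where

    operands-all⁺ : ∀ (p : Entry → Bool) is → (∀ {i} → i ∈ is → T (p (entry C i))) → T (all p (operandEntries (env C) (map toℕ is)))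
    operands-all⁺ p []       f = tt
    operands-all⁺ p (i ∷ is) f = Equivalence.from T-∧ (f (here refl) , operands-all⁺ p is (f ∘ there))

    operands-all⁻ : ∀ (p : Entry → Bool) {is i} → T (all p (operandEntries (env C) (map toℕ is))) → i ∈ is → T (p (entry C i))
    operands-all⁻ p t i∈ = all⁻ p t (∈-map⁺ (nth noEntry (env C)) (∈-map⁺ toℕ i∈))

    operands-any⁺ : ∀ (p : Entry → Bool) {is i} → i ∈ is → T (p (entry C i)) → T (any p (operandEntries (env C) (map toℕ is)))
    operands-any⁺ p i∈ t = any⁺ p (∈-map⁺ (nth noEntry (env C)) (∈-map⁺ toℕ i∈)) t

    operands-any⁻ : ∀ (p : Entry → Bool) is → T (any p (operandEntries (env C) (map toℕ is))) → Σ[ i ∈ Fin w ] i ∈ is × T (p (entry C i))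
    operands-any⁻ p (i ∷ is) t with Equivalence.to (T-∨ {p (entry C i)}) t
    ... | inj₁ pi = i , here refl , pi
    ... | inj₂ t′ = let j , j∈ , pj = operands-any⁻ p is t′ in j , there j∈ , pj

    negated-operand : ∀ i → nth noEntry (env C) (length (replicate (toℕ i) 0)) ≡ entry C i
    negated-operand i = cong (nth noEntry (env C)) (List.length-replicate (toℕ i))

    gateIs-negation : ∀ i b → gateIs (env C) (rawGate (notᵍ i)) b ≡ is (not b) (entry C i)
    gateIs-negation i b = cong (is (not b)) (negated-operand i)

    gateIs-universal : ∀ {g : Gate w} {b is′} → Universal g b is′ →
                       gateIs (env C) (rawGate g) b ≡ all (is b) (operandEntries (env C) (map toℕ is′))
    gateIs-universal (andᵍ _) = refl
    gateIs-universal (orᵍ _)  = refl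

    gateIs-existential : ∀ {g : Gate w} {b is′} → Existential g b is′ →
                         gateIs (env C) (rawGate g) b ≡ any (is b) (operandEntries (env C) (map toℕ is′))
    gateIs-existential (andᵍ _) = refl
    gateIs-existential (orᵍ _)  = refl

    support-negation : ∀ i b → gateSupport (env C) (rawGate (notᵍ i)) b ≡ cl (not b) (entry C i)
    support-negation i b = cong (cl (not b)) (negated-operand i)

    support-universal : ∀ {g : Gate w} {b is′} → Universal g b is′ →
      gateSupport (env C) (rawGate g) b ≡
        (if 2 <ᵇ length is′ then all (λ e → not (is (not b) e)) (operandEntries (env C) (map toℕ is′))
         else all (cl b) (operandEntries (env C) (map toℕ is′)))
    support-universal {b = b} {is′} u = trans (lem u)
      (cong (λ m → if 2 <ᵇ m then all (λ e → not (is (not b) e)) (operandEntries (env C) (map toℕ is′))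
                   else all (cl b) (operandEntries (env C) (map toℕ is′))) (List.length-map toℕ is′))
      where
      lem : ∀ {g : Gate w} {b is′} → Universal g b is′ →
        gateSupport (env C) (rawGate g) b ≡
          (if 2 <ᵇ length (map toℕ is′) then all (λ e → not (is (not b) e)) (operandEntries (env C) (map toℕ is′))
           else all (cl b) (operandEntries (env C) (map toℕ is′)))
      lem (andᵍ _) = refl
      lem (orᵍ _)  = refl

    support-existential : ∀ {g : Gate w} {b is′} → Existential g b is′ →
                          gateSupport (env C) (rawGate g) b ≡ any (cl b) (operandEntries (env C) (map toℕ is′))
    support-existential (andᵍ _) = refl
    support-existential (orᵍ _)  = refl

  AllOK : ∀ {w} → Circuit n w → Set
  AllOK C = T (all (λ e → ok true e ∧ ok false e) (env C))

  okAt : ∀ {w} (C : Circuit n w) → AllOK C → ∀ b i → T (ok b (entry C i))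
  okAt C t b i with Equivalence.to (T-∧ {ok true (entry C i)}) (all⁻ (λ e → ok true e ∧ ok false e) t (nth-∈ noEntry (env C) (subst (toℕ i <_) (sym (length-env C)) (Fin.toℕ<n i))))
  okAt C t true  i | t₁ , _ = t₁
  okAt C t false i | _ , t₂ = t₂

  AllOK-prefix : ∀ {w} (C : Circuit n w) g → AllOK (C ▷ g) → AllOK C
  AllOK-prefix C g t = proj₂ (Equivalence.to (T-∧ {ok true (entry (C ▷ g) zero) ∧ ok false (entry (C ▷ g) zero)}) t)

-- Soundness: claims that pass every test are true

val : ∀ {n w} → Vec.Vec Bool n → Circuit n w → Fin w → Bool
val ρ C i = Vec.lookup (evalNodes C ρ) i

Decides : ∀ {n} → Vec.Vec Bool n → List Block → Fin n → Set
Decides ρ Bs v = T (inputIs (Vec.lookup ρ v) Bs (toℕ v))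

not-≡ : ∀ {a b} → not a ≡ b → a ≡ not b
not-≡ {true}  refl = refl
not-≡ {false} refl = refl

if⁺ : ∀ {l a b} → (T l → T a) → (¬ T l → T b) → T (if l then a else b)
if⁺ {true}  t _ = t tt
if⁺ {false} _ f = f (λ ())

if⁻ : ∀ {l a b} → T l → T (if l then a else b) → T a
if⁻ {true} _ t = t

else⁻ : ∀ {l a b} → ¬ T l → T (if l then a else b) → T b
else⁻ {true}  ¬l _ = ⊥-elim (¬l tt)
else⁻ {false} _  t = t

gate-decided : ∀ {n w} (ρ : Vec.Vec Bool n) S Bs (C : Circuit n w) g →
  (∀ {i} → i ∈ operands g → T (is (val ρ C i) (entry S Bs C i))) →
  ∀ b → evalGate (evalNodes C ρ) g ≡ b → T (gateIs (env S Bs C) (rawGate g) b)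
gate-decided ρ S Bs C g operand b e with mode g b
... | negation i =
  subst T (sym (gateIs-negation S Bs C i b)) (subst (λ c → T (is c (entry S Bs C i))) (not-≡ e) (operand (here refl)))
... | universal {is = is′} u =
  subst T (sym (gateIs-universal S Bs C u)) (operands-all⁺ S Bs C (is b) is′ λ {i} i∈ →
    subst (λ c → T (is c (entry S Bs C i))) (universal-value⁻ (evalNodes C ρ) u e i∈)
      (operand (subst (i ∈_) (sym (universal-operands u)) i∈)))
... | existential u =
  let i , i∈ , v = existential-value⁻ (evalNodes C ρ) u e in
  subst T (sym (gateIs-existential S Bs C u)) (operands-any⁺ S Bs C (is b) i∈
    (subst (λ c → T (is c (entry S Bs C i))) v (operand (subst (i ∈_) (sym (existential-operands u)) i∈))))

-- The list of inputs has to work for all blocks that decide it, because it is found first and the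
-- blocks are then chosen to suit it.
DecidedBy : ∀ {n w} → Vec.Vec Bool n → Circuit n w → Fin w → List (Fin n) → Set
DecidedBy ρ C i vs = ∀ S Bs → (∀ {v} → v ∈ vs → Decides ρ Bs v) → T (is (val ρ C i) (entry S Bs C i))

decided : ∀ {n w} (ρ : Vec.Vec Bool n) (C : Circuit n w) i d → weftAt C i ≤ 0 → depthAt C i ≤ d →
          Σ[ vs ∈ List (Fin n) ] length vs ≤ 2 ^ d × DecidedBy ρ C i vs
decided ρ inputs i d _ _ = i ∷ [] , m^n>0 2 d , λ S Bs f →
  subst T (sym (is-input S Bs (Vec.lookup ρ i) i)) (f (here refl))
decided ρ (C ▷ g) (suc i) d weft≤ depth≤ = decided ρ C i d weft≤ depth≤
decided {n} {suc w} ρ (C ▷ g) zero (suc d) weft≤ (s≤s depth≤) =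
  let vs , vs≤ , f = gather (operands g) (λ i∈ → i∈)
  in vs , ≤-trans vs≤ (*-monoˡ-≤ (2 ^ d) (small-gate g small)) ,
     λ S Bs h → subst T (sym (is-gate S Bs (val ρ (C ▷ g) zero) C g))
       (gate-decided ρ S Bs C g (λ i∈ → f i∈ S Bs h) (val ρ (C ▷ g) zero) refl)
  where
  small : ¬ T (2 <ᵇ length (operands g))
  small t = 1+n≰n (≤-trans (≤-reflexive (sym (largeCost≡1 g t))) (≤-trans (m≤m+n (largeCost g) _) weft≤))
  gather : ∀ is′ → (∀ {i} → i ∈ is′ → i ∈ operands g) →
           Σ[ vs ∈ List (Fin n) ] length vs ≤ length is′ * 2 ^ d × (∀ {i} → i ∈ is′ → DecidedBy ρ C i vs)
  gather []        ⊆ = [] , z≤n , λ ()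
  gather (i ∷ is′) ⊆ =
    let i∈ = ⊆ (here refl)
        vs , vs≤ , f = decided ρ C i d (≤-trans (≤-trans (m≤n+m _ (largeCost g)) (operand-weft C g i∈)) weft≤)
                                       (≤-trans (≤-maximum (depthAt C) i∈) depth≤)
        us , us≤ , h = gather is′ (⊆ ∘ there)
    in vs ++ us , ≤-trans (≤-reflexive (List.length-++ vs)) (+-mono-≤ vs≤ us≤) ,
       λ { (here refl) S Bs k → f S Bs (λ v∈ → k (∈-++⁺ˡ v∈))
         ; (there j∈)  S Bs k → h j∈ S Bs (λ v∈ → k (∈-++⁺ʳ vs v∈)) }

module _ {n : ℕ} (ρ : Vec.Vec Bool n) (S : List Claim) (d : ℕ) where

  -- The blocks may vary with the inputs to be decided, as a bounded number of them cannot decide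
  -- all inputs at once. Only `ρ` and the claims stay the same.
  Accepting : ∀ {w} → Circuit n w → Set
  Accepting C = ∀ vs → length vs ≤ 2 ^ d → Σ[ Bs ∈ List Block ] AllOK S Bs C × (∀ {v} → v ∈ vs → Decides ρ Bs v)

  -- By induction along the circuit the claims on operands are true, and they imply the claims they
  -- support. The exception is a large gate whose claimed value all operands must share: an operand
  -- with the other value would be noticed for a suitable choice of blocks.
  claims-true : ∀ {w} (C : Circuit n w) → Accepting C → ∀ i b → weftAt C i ≤ 1 → depthAt C i ≤ d →
                (level C i , b) ∈ S → val ρ C i ≡ b
  claims-true inputs acc v b _ _ c with Bool._≟_ (Vec.lookup ρ v) b
  ... | yes e = e
  ... | no ne with acc (v ∷ []) (m^n>0 2 d)
  ...   | Bs , okay , decides = ⊥-elim (T-not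
            (subst T (trans (cong (ok b) (entry-input S Bs v)) (ok-input {n} S Bs b (toℕ v))) (okAt S Bs inputs okay b v))
            (Equivalence.from T-∧ (claimed⁺ {S} {toℕ v} {b} c , subst (λ a → T (inputIs a Bs (toℕ v))) (¬-not ne) (decides (here refl)))))
  claims-true (C ▷ g) acc (suc i) b weft≤ depth≤ c =
    claims-true C (λ vs vs≤ → let Bs , okay , f = acc vs vs≤ in Bs , AllOK-prefix S Bs C g okay , λ {v} → f {v}) i b weft≤ depth≤ c
  claims-true (_▷_ {w = w} C g) acc zero b weft≤ depth≤ c = by-mode (mode g b) refl
    where
    acc′ : Accepting C
    acc′ vs vs≤ = let Bs , okay , f = acc vs vs≤ in Bs , AllOK-prefix S Bs C g okay , λ {v} → f {v}

    support : ∀ Bs → AllOK S Bs (C ▷ g) → T (gateSupport (env S Bs C) (rawGate g) b)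
    support Bs okay = imp⁻ {claimed S w b} (subst T (ok-gate S Bs b C g) (okAt S Bs (C ▷ g) okay b zero)) (claimed⁺ c)

    -- Which claims are made does not depend on the blocks, so for support by claims any accepted
    -- list of blocks will do.
    Bs₀ : List Block
    Bs₀ = proj₁ (acc [] z≤n)

    support₀ : T (gateSupport (env S Bs₀ C) (rawGate g) b)
    support₀ = support Bs₀ (proj₁ (proj₂ (acc [] z≤n)))

    depth-operand : ∀ {i} → i ∈ operands g → depthAt C i ≤ d
    depth-operand i∈ = ≤-trans (≤-trans (n≤1+n _) (operand-depth C g i∈)) depth≤

    operand : ∀ {i c} → i ∈ operands g → T (cl c (entry S Bs₀ C i)) → val ρ C i ≡ c
    operand {i} {c} i∈ t = claims-true C acc′ i c
      (≤-trans (≤-trans (m≤n+m _ (largeCost g)) (operand-weft C g i∈)) weft≤)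
      (depth-operand i∈)
      (claimed⁻ (subst T (cl-entry S Bs₀ c C i) t))

    ∈operands : ∀ {is′} → Universal g b is′ → ∀ {i} → i ∈ is′ → i ∈ operands g
    ∈operands u {i} = subst (i ∈_) (sym (universal-operands u))

    weft₀ : ∀ {is′} → Universal g b is′ → T (2 <ᵇ length is′) → ∀ {i} → i ∈ is′ → weftAt C i ≤ 0
    weft₀ u large {i} i∈ = s≤s⁻¹ (≤-trans (≤-trans (≤-reflexive (cong (_+ weftAt C i) (sym (largeCost≡1 g
      (subst (λ js → T (2 <ᵇ length js)) (sym (universal-operands u)) large)))))
      (operand-weft C g (∈operands u i∈))) weft≤)

    by-universal : ∀ {is′} → Universal g b is′ → ∀ {i} → i ∈ is′ → val ρ C i ≡ b
    by-universal {is′} u {i} i∈ with T? (2 <ᵇ length is′)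
    ... | no small = operand (∈operands u i∈)
                    (operands-all⁻ S Bs₀ C (cl b)
                      (else⁻ {2 <ᵇ length is′} small (subst T (support-universal S Bs₀ C u) support₀)) i∈)
    ... | yes large with Bool._≟_ (val ρ C i) b
    ...   | yes e = e
    ...   | no ne = ⊥-elim (refuted (decided ρ C i d (weft₀ u large i∈) (depth-operand (∈operands u i∈))))
      where
      -- The blocks are chosen to decide the inputs on which the operand depends. They force its
      -- wrong value, which the test of the large gate forbids.
      refuted : ¬ (Σ[ vs ∈ List (Fin n) ] length vs ≤ 2 ^ d × DecidedBy ρ C i vs)
      refuted (vs , vs≤ , forced) with acc vs vs≤
      ... | Bs , okay , decides = T-not
        (operands-all⁻ S Bs C (λ e → not (is (not b) e))
          (if⁻ {2 <ᵇ length is′} large (subst T (support-universal S Bs C u) (support Bs okay))) i∈)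
        (subst (λ a → T (is a (entry S Bs C i))) (¬-not ne) (forced S Bs decides))

    by-mode : ∀ {g′} → Mode g′ b → g ≡ g′ → evalGate (evalNodes C ρ) g ≡ b
    by-mode (negation i) refl =
      trans (cong not (operand (here refl) (subst T (support-negation S Bs₀ C i b) support₀))) (Bool.not-involutive b)
    by-mode (universal u) refl = universal-value⁺ (evalNodes C ρ) u (by-universal u)
    by-mode (existential u) refl =
      let i , i∈ , t = operands-any⁻ S Bs₀ C (cl b) _ (subst T (support-existential S Bs₀ C u) support₀)
      in existential-value⁺ (evalNodes C ρ) u i∈ (operand (subst (i ∈_) (sym (existential-operands u)) i∈) t)

  soundness : ∀ {w} (C : Circuit n (suc w)) → weftAt C zero ≤ 1 → depthAt C zero ≤ d →
    (∀ vs → length vs ≤ 2 ^ d → Σ[ Bs ∈ List Block ] T (accepts S Bs n (raw C)) × (∀ {v} → v ∈ vs → Decides ρ Bs v)) →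
    val ρ C zero ≡ true
  soundness C weft≤ depth≤ acc = claims-true C
    (λ vs vs≤ → let Bs , a , f = acc vs vs≤ in Bs , proj₁ (Equivalence.to T-∧ a) , λ {v} → f {v})
    zero true weft≤ depth≤
    (let Bs , a , _ = acc [] z≤n
     in claimed⁻ (subst T (cl-entry S Bs true C zero) (proj₂ (Equivalence.to (T-∧ {all (λ e → ok true e ∧ ok false e) (env S Bs C)}) a))))

-- Every claim is supported by at most two claims one level further down, so the
-- claims that support a given one form a binary tree.
cap : ℕ → ℕ
cap zero    = 1
cap (suc d) = 1 + 2 * cap d

1≤cap : ∀ d → 1 ≤ cap d
1≤cap zero    = s≤s z≤n
1≤cap (suc d) = s≤s z≤n

-- Completeness: a small set of true claims passes every test

module _ {n : ℕ} (ρ : Vec.Vec Bool n) where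

  ModeSupported : ∀ {w g b} → List Claim → Circuit n w → Mode {w} g b → Set
  ModeSupported {b = b} S C (negation i) = (level C i , not b) ∈ S
  ModeSupported {b = b} S C (universal {is = is′} _) = ¬ T (2 <ᵇ length is′) → ∀ {i} → i ∈ is′ → (level C i , b) ∈ S
  ModeSupported {w} {b = b} S C (existential {is = is′} _) = Σ[ i ∈ Fin w ] i ∈ is′ × (level C i , b) ∈ S

  Supported : ∀ {w} → List Claim → Circuit n w → Fin w → Bool → Set
  Supported S inputs  i       b = ⊤
  Supported S (C ▷ g) zero    b = ModeSupported S C (mode g b)
  Supported S (C ▷ g) (suc i) b = Supported S C i b

  Good : ∀ {w} → List Claim → Circuit n w → Set
  Good S C = ∀ i b → (level C i , b) ∈ S → val ρ C i ≡ b × Supported S C i b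

  Bounded : List Claim → ℕ → Set
  Bounded S m = ∀ {ℓ b} → (ℓ , b) ∈ S → ℓ < m

  module _ {S S′ : List Claim} (⊆ : ∀ {c} → c ∈ S → c ∈ S′) where

    ModeSupported-mono : ∀ {w} (C : Circuit n w) {g b} (m : Mode g b) → ModeSupported S C m → ModeSupported S′ C m
    ModeSupported-mono C (negation i)    s            = ⊆ s
    ModeSupported-mono C (universal u)   s            = λ small i∈ → ⊆ (s small i∈)
    ModeSupported-mono C (existential u) (i , i∈ , s) = i , i∈ , ⊆ s

    Supported-mono : ∀ {w} (C : Circuit n w) i b → Supported S C i b → Supported S′ C i b
    Supported-mono inputs  i       b s = tt
    Supported-mono (C ▷ g) zero    b s = ModeSupported-mono C (mode g b) s
    Supported-mono (C ▷ g) (suc i) b s = Supported-mono C i b s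

  Good-++ : ∀ {w} (C : Circuit n w) R S → Good R C → Good S C → Good (R ++ S) C
  Good-++ C R S good good′ i b c with ∈-++⁻ R c
  ... | inj₁ c∈ = let v , s = good i b c∈ in v , Supported-mono ∈-++⁺ˡ C i b s
  ... | inj₂ c∈ = let v , s = good′ i b c∈ in v , Supported-mono (∈-++⁺ʳ R) C i b s

  Good-cong : ∀ {w} (C : Circuit n w) {R S} → (∀ {c} → c ∈ R → c ∈ S) → (∀ {c} → c ∈ S → c ∈ R) → Good R C → Good S C
  Good-cong C ⊆ ⊇ good i b c = let v , s = good i b (⊇ c) in v , Supported-mono ⊆ C i b s

  -- A large gate whose operands all have its value needs no supporters: the
  -- values of its operands are controlled by the blocks instead.
  supporters : ∀ {w} (C : Circuit n w) {g b} (m : Mode g b) → evalGate (evalNodes C ρ) g ≡ b →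
    Σ[ js ∈ List (Fin w) ] length js ≤ 2 × (∀ {j} → j ∈ js → j ∈ operands g)
      × (∀ R → (∀ {j} → j ∈ js → (level C j , val ρ C j) ∈ R) → ModeSupported R C m)
  supporters C {b = b} (negation i) e =
    i ∷ [] , s≤s z≤n , (λ j∈ → j∈) , λ R f → subst (λ c → (level C i , c) ∈ R) (not-≡ e) (f (here refl))
  supporters {w} C {g} {b} (universal {is = is′} u) e = pick (T? (2 <ᵇ length is′))
    where
    ∈operands : ∀ {j} → j ∈ is′ → j ∈ operands g
    ∈operands {j} = subst (j ∈_) (sym (universal-operands u))
    pick : Dec (T (2 <ᵇ length is′)) → Σ[ js ∈ List (Fin w) ] length js ≤ 2 × (∀ {j} → j ∈ js → j ∈ operands g)
      × (∀ R → (∀ {j} → j ∈ js → (level C j , val ρ C j) ∈ R) → ModeSupported R C (universal u))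
    pick (yes large) = [] , z≤n , (λ ()) , λ R f small → ⊥-elim (small large)
    pick (no small)  = is′ , ≮⇒≥ (small ∘ <⇒<ᵇ) , ∈operands ,
      λ R f _ {j} j∈ → subst (λ c → (level C j , c) ∈ R) (universal-value⁻ (evalNodes C ρ) u e j∈) (f j∈)
  supporters C (existential u) e =
    let i , i∈ , v = existential-value⁻ (evalNodes C ρ) u e
    in i ∷ [] , s≤s z≤n , (λ { (here refl) → subst (i ∈_) (sym (existential-operands u)) i∈ }) ,
       λ R f → i , i∈ , subst (λ c → (level C i , c) ∈ R) v (f (here refl))

  Claims : ∀ {w} → Circuit n w → ℕ → (List Claim → Set) → Set
  Claims {w} C m P = Σ[ S ∈ List Claim ] length S ≤ m × Bounded S w × Good S C × P S

  -- The claims gathered for the operands are `Bounded` by the level of the new gate and hence say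
  -- nothing about it. They keep the support they already have, so only the claim at the root
  -- remains to be justified.
  claims : ∀ {w} (C : Circuit n w) i d → depthAt C i ≤ d → Claims C (cap d) ((level C i , val ρ C i) ∈_)
  claims inputs i d _ =
    (toℕ i , Vec.lookup ρ i) ∷ [] , 1≤cap d , (λ { (here refl) → Fin.toℕ<n i }) ,
    (λ { j b (here e) → trans (cong (Vec.lookup ρ) (Fin.toℕ-injective (cong proj₁ e))) (sym (cong proj₂ e)) , tt }) ,
    here refl
  claims (C ▷ g) (suc i) d depth≤ =
    let S , S≤ , bounded , good , ∈S = claims C i d depth≤
    in S , S≤ , (λ c → m≤n⇒m≤1+n (bounded c)) ,
       (λ { zero b c → ⊥-elim (<-irrefl refl (bounded c)) ; (suc j) b c → good j b c }) , ∈S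
  claims (_▷_ {w = w} C g) zero (suc d) (s≤s depth≤) =
    (w , b) ∷ R , s≤s (≤-trans R≤ (*-monoˡ-≤ (cap d) js≤)) ,
    (λ { (here refl) → n<1+n w ; (there c) → m≤n⇒m≤1+n (bounded c) }) ,
    good′ , here refl
    where
    b = val ρ (C ▷ g) zero
    sup = supporters C (mode g b) refl
    js = proj₁ sup
    js≤ = proj₁ (proj₂ sup)
    js⊆ = proj₁ (proj₂ (proj₂ sup))

    gather : ∀ js → (∀ {j} → j ∈ js → j ∈ operands g) →
             Claims C (length js * cap d) (λ R → ∀ {j} → j ∈ js → (level C j , val ρ C j) ∈ R)
    gather []       _ = [] , z≤n , (λ ()) , (λ i b ()) , λ ()
    gather (j ∷ js) ⊆ =
      let S , S≤ , bounded , good , ∈S = claims C j d (≤-trans (≤-maximum (depthAt C) (⊆ (here refl))) depth≤)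
          R , R≤ , bounded′ , good′ , ∈R = gather js (⊆ ∘ there)
      in S ++ R , ≤-trans (≤-reflexive (List.length-++ S)) (+-mono-≤ S≤ R≤) ,
         (λ c → [ bounded , bounded′ ]′ (∈-++⁻ S c)) , Good-++ C S R good good′ ,
         λ { (here refl) → ∈-++⁺ˡ ∈S ; (there j∈) → ∈-++⁺ʳ S (∈R j∈) }

    G = gather js js⊆
    R = proj₁ G
    R≤ = proj₁ (proj₂ G)

    bounded : Bounded R w
    bounded = proj₁ (proj₂ (proj₂ G))

    supported : ModeSupported R C (mode g b)
    supported = proj₂ (proj₂ (proj₂ sup)) R (proj₂ (proj₂ (proj₂ (proj₂ G))))

    good′ : Good ((w , b) ∷ R) (C ▷ g)
    good′ zero    c (here refl) = refl , ModeSupported-mono there C (mode g b) supported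
    good′ zero    c (there c∈)  = ⊥-elim (<-irrefl refl (bounded c∈))
    good′ (suc i) c (here e)    = ⊥-elim (<⇒≢ (level< C i) (cong proj₁ e))
    good′ (suc i) c (there c∈)  =
      let v , s = proj₁ (proj₂ (proj₂ (proj₂ G))) i c c∈ in v , Supported-mono there C i c s

  module _ (Bs : List Block) (sound : ∀ v b → T (inputIs b Bs (toℕ v)) → Vec.lookup ρ v ≡ b) (S : List Claim) where

    -- As long as no block misstates an input, the three-valued evaluation never errs, however few
    -- blocks there are. Hence no choice of such blocks refutes a true claim, and one claim set
    -- serves for all tests.
    is-sound : ∀ {w} (C : Circuit n w) i b → T (is b (entry S Bs C i)) → val ρ C i ≡ b
    is-sound inputs  i       b t = sound i b (subst T (is-input S Bs b i) t)
    is-sound (C ▷ g) (suc i) b t = is-sound C i b t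
    is-sound (C ▷ g) zero    b t = by (mode g b) (subst T (is-gate S Bs b C g) t)
      where
      by : ∀ {g} → Mode g b → T (gateIs (env S Bs C) (rawGate g) b) → evalGate (evalNodes C ρ) g ≡ b
      by (negation i) t =
        trans (cong not (is-sound C i (not b) (subst T (gateIs-negation S Bs C i b) t))) (Bool.not-involutive b)
      by (universal u) t = universal-value⁺ (evalNodes C ρ) u λ {i} i∈ →
        is-sound C i b (operands-all⁻ S Bs C (is b) (subst T (gateIs-universal S Bs C u) t) i∈)
      by (existential u) t =
        let i , i∈ , t′ = operands-any⁻ S Bs C (is b) _ (subst T (gateIs-existential S Bs C u) t)
        in existential-value⁺ (evalNodes C ρ) u i∈ (is-sound C i b t′)

    supported⇒ok : ∀ {w} (C : Circuit n w) {g b} (m : Mode g b) → evalGate (evalNodes C ρ) g ≡ b → ModeSupported S C m →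
                   T (gateSupport (env S Bs C) (rawGate g) b)
    supported⇒ok C {b = b} (negation i) e s =
      subst T (sym (trans (support-negation S Bs C i b) (cl-entry S Bs (not b) C i))) (claimed⁺ s)
    supported⇒ok C {g} {b} (universal {is = is′} u) e s = subst T (sym (support-universal S Bs C u)) (if⁺ {2 <ᵇ length is′}
      (λ _ → operands-all⁺ S Bs C (λ e → not (is (not b) e)) is′ λ {i} i∈ → not-T λ t →
        Bool.not-¬ (universal-value⁻ (evalNodes C ρ) u e i∈) (is-sound C i (not b) t))
      (λ small → operands-all⁺ S Bs C (cl b) is′ λ {i} i∈ →
        subst T (sym (cl-entry S Bs b C i)) (claimed⁺ (s small i∈))))
    supported⇒ok C {b = b} (existential u) e (i , i∈ , s) =
      subst T (sym (support-existential S Bs C u))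
        (operands-any⁺ S Bs C (cl b) i∈ (subst T (sym (cl-entry S Bs b C i)) (claimed⁺ s)))

    all-ok : ∀ {w} (C : Circuit n w) → Good S C → AllOK S Bs C
    all-ok inputs good = all⁺ (λ e → ok true e ∧ ok false e) (env S Bs inputs) λ x∈ → entry-ok (∈-map⁻ (inputEntry S Bs) x∈)
      where
      input-ok : ∀ b {v} → v < n → T (ok b (inputEntry S Bs v))
      input-ok b {v} v<n = subst T (sym (ok-input {n} S Bs b v)) (not-T λ t →
        let c , t′ = Equivalence.to (T-∧ {claimed S v b}) t
            v≡ = Fin.toℕ-fromℕ< v<n
        in Bool.not-¬ (proj₁ (good (fromℕ< v<n) b (subst (λ u → (u , b) ∈ S) (sym v≡) (claimed⁻ c))))
             (sound (fromℕ< v<n) (not b) (subst (λ u → T (inputIs (not b) Bs u)) (sym v≡) t′)))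
      entry-ok : ∀ {x} → Σ[ v ∈ ℕ ] v ∈ upTo n × x ≡ inputEntry S Bs v → T (ok true x ∧ ok false x)
      entry-ok (v , v∈ , refl) = Equivalence.from T-∧ (input-ok true (∈-upTo⁻ v∈) , input-ok false (∈-upTo⁻ v∈))
    all-ok (_▷_ {w = w} C g) good = Equivalence.from T-∧
      (Equivalence.from T-∧ (gate-ok true , gate-ok false) , all-ok C (λ i → good (suc i)))
      where
      gate-ok : ∀ b → T (ok b (entry S Bs (C ▷ g) zero))
      gate-ok b = subst T (sym (ok-gate S Bs b C g)) (imp⁺ {claimed S w b} λ c →
        let v , s = good zero b (claimed⁻ c) in supported⇒ok C (mode g b) v s)

    completeness : ∀ {w} (C : Circuit n (suc w)) → Good S C → (level C zero , true) ∈ S → T (accepts S Bs n (raw C))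
    completeness C good c = Equivalence.from T-∧ (all-ok C good , subst T (sym (cl-entry S Bs true C zero)) (claimed⁺ c))

-- Assignments of weight k as systems of k + 1 blocks

Gives : Bool → ℕ × ℕ → ℕ → Set
Gives true  (s , e) v = e ≡ v
Gives false (s , e) v = s ≤ v × v < e

inputIs⁺ : ∀ b {Bs p x v} → (p , x) ∈ Bs → Gives b x v → T (inputIs b Bs v)
inputIs⁺ true  {x = s , e} {v} x∈ e≡v = any⁺ (λ x → proj₂ (proj₂ x) ≡ᵇ v) x∈ (≡⇒≡ᵇ e v e≡v)
inputIs⁺ false {v = v} x∈ (s≤v , v<e) =
  any⁺ (λ x → (proj₁ (proj₂ x) ≤ᵇ v) ∧ (v <ᵇ proj₂ (proj₂ x))) x∈ (Equivalence.from T-∧ (≤⇒≤ᵇ s≤v , <⇒<ᵇ v<e))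

inputIs⁻ : ∀ b {Bs v} → T (inputIs b Bs v) → Σ[ x ∈ Block ] x ∈ Bs × Gives b (proj₂ x) v
inputIs⁻ true {Bs} {v} t =
  let x , x∈ , e = any⁻ (λ x → proj₂ (proj₂ x) ≡ᵇ v) Bs t in x , x∈ , ≡ᵇ⇒≡ _ v e
inputIs⁻ false {Bs} {v} t =
  let x , x∈ , le = any⁻ (λ x → (proj₁ (proj₂ x) ≤ᵇ v) ∧ (v <ᵇ proj₂ (proj₂ x))) Bs t
      s≤ , <e = Equivalence.to (T-∧ {proj₁ (proj₂ x) ≤ᵇ v}) le
  in x , x∈ , ≤ᵇ⇒≤ (proj₁ (proj₂ x)) v s≤ , <ᵇ⇒< v (proj₂ (proj₂ x)) <e

-- The closed intervals from the start to the end of each block tile `0, …, n`. The last block ends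
-- at the fictitious position `n`, which stands in for a closing true input.
record BlockSystem (k n : ℕ) (γ : ℕ → ℕ × ℕ) : Set where
  field
    first   : proj₁ (γ 0) ≡ 0
    chain   : ∀ {p} → p < k → proj₁ (γ (suc p)) ≡ suc (proj₂ (γ p))
    last    : proj₂ (γ k) ≡ n
    ordered : ∀ {p} → p ≤ k → proj₁ (γ p) ≤ proj₂ (γ p)

  end≤ : ∀ j {p} → j + p ≡ k → proj₂ (γ p) ≤ n
  end≤ zero    refl = ≤-reflexive last
  end≤ (suc j) {p} e = ≤-trans (n≤1+n _) (≤-trans (≤-reflexive (sym (chain p<k)))
                         (≤-trans (ordered p<k) (end≤ j (trans (+-suc j p) e))))
    where
    p<k : p < k
    p<k = subst (suc p ≤_) e (s≤s (m≤n+m p j))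

  end< : ∀ j {p} → suc j + p ≡ k → proj₂ (γ p) < n
  end< j {p} e = ≤-trans (≤-reflexive (sym (chain p<k))) (≤-trans (ordered p<k) (end≤ j (trans (+-suc j p) e)))
    where
    p<k : p < k
    p<k = subst (suc p ≤_) e (s≤s (m≤n+m p j))

  bounded : ∀ {p} → p ≤ k → proj₂ (γ p) ≤ n
  bounded {p} p≤k = end≤ (k ∸ p) (m∸n+n≡m p≤k)

  -- Position c lies in block p, and j blocks are still to come.
  assignmentFrom : ∀ m c p j → c + m ≡ n → j + p ≡ k → proj₁ (γ p) ≤ c → c ≤ proj₂ (γ p) →
    Σ[ ρ ∈ Subset m ] ∣ ρ ∣ˢ ≡ j × (∀ v → Σ[ p′ ∈ ℕ ] p′ ≤ k × Gives (Vec.lookup ρ v) (γ p′) (c + toℕ v))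
  assignmentFrom zero    c p zero    _   _   _   _   = Vec.[] , refl , λ ()
  assignmentFrom zero    c p (suc j) c≡n p+j _   c≤e =
    ⊥-elim (<-irrefl (trans (sym (+-identityʳ c)) c≡n) (≤-<-trans c≤e (end< j p+j)))
  assignmentFrom (suc m) c p j c+m p+j s≤c c≤e with m≤n⇒m<n∨m≡n c≤e
  ... | inj₁ c<e =
    let ρ , ∣ρ∣ , gives = assignmentFrom m (suc c) p j (trans (sym (+-suc c m)) c+m) p+j (m≤n⇒m≤1+n s≤c) c<e
    in false Vec.∷ ρ , ∣ρ∣ ,
       λ { zero → p , subst (p ≤_) p+j (m≤n+m p j) ,
                  subst (proj₁ (γ p) ≤_) (sym (+-identityʳ c)) s≤c , subst (_< proj₂ (γ p)) (sym (+-identityʳ c)) c<e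
         ; (suc v) → let p′ , p′≤ , g = gives v in p′ , p′≤ , subst (Gives (Vec.lookup ρ v) (γ p′)) (sym (+-suc c (toℕ v))) g }
  assignmentFrom (suc m) c p zero c+m refl s≤c c≤e | inj₂ c≡e =
    ⊥-elim (m+1+n≢m c (trans c+m (sym (trans c≡e last))))
  assignmentFrom (suc m) c p (suc j) c+m p+j s≤c c≤e | inj₂ c≡e =
    let p<k = subst (suc p ≤_) p+j (s≤s (m≤n+m p j))
        s≡ = trans (chain p<k) (cong suc (sym c≡e))
        ρ , ∣ρ∣ , gives = assignmentFrom m (suc c) (suc p) j (trans (sym (+-suc c m)) c+m) (trans (+-suc j p) p+j)
                            (≤-reflexive s≡) (≤-trans (≤-reflexive (sym s≡)) (ordered p<k))
    in true Vec.∷ ρ , cong suc ∣ρ∣ ,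
       λ { zero → p , <⇒≤ p<k , trans (sym c≡e) (sym (+-identityʳ c))
         ; (suc v) → let p′ , p′≤ , g = gives v in p′ , p′≤ , subst (Gives (Vec.lookup ρ v) (γ p′)) (sym (+-suc c (toℕ v))) g }

  assignment : Σ[ ρ ∈ Subset n ] ∣ ρ ∣ˢ ≡ k × (∀ v → Σ[ p ∈ ℕ ] p ≤ k × Gives (Vec.lookup ρ v) (γ p) (toℕ v))
  assignment = assignmentFrom n 0 0 k refl (+-identityʳ k) (≤-reflexive first) z≤n

-- The blocks of ρ read from position c on, the current one having started at s.
blocks : ∀ {m} → ℕ → ℕ → Subset m → ℕ → ℕ × ℕ
blocks s c Vec.[]            p       = s , c
blocks s c (false Vec.∷ ρ) p       = blocks s (suc c) ρ p
blocks s c (true  Vec.∷ ρ) zero    = s , c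
blocks s c (true  Vec.∷ ρ) (suc p) = blocks (suc c) (suc c) ρ p

blocks-first : ∀ {m} s c (ρ : Subset m) → proj₁ (blocks s c ρ 0) ≡ s
blocks-first s c Vec.[]            = refl
blocks-first s c (false Vec.∷ ρ) = blocks-first s (suc c) ρ
blocks-first s c (true  Vec.∷ ρ) = refl

blocks-chain : ∀ {m} s c (ρ : Subset m) {p} → p < ∣ ρ ∣ˢ → proj₁ (blocks s c ρ (suc p)) ≡ suc (proj₂ (blocks s c ρ p))
blocks-chain s c (false Vec.∷ ρ) p<            = blocks-chain s (suc c) ρ p<
blocks-chain s c (true  Vec.∷ ρ) {zero}  _        = blocks-first (suc c) (suc c) ρ
blocks-chain s c (true  Vec.∷ ρ) {suc p} (s≤s p<) = blocks-chain (suc c) (suc c) ρ p<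

blocks-last : ∀ {m} s c (ρ : Subset m) → proj₂ (blocks s c ρ ∣ ρ ∣ˢ) ≡ c + m
blocks-last s c Vec.[]                        = sym (+-identityʳ c)
blocks-last {suc m} s c (false Vec.∷ ρ) = trans (blocks-last s (suc c) ρ) (sym (+-suc c m))
blocks-last {suc m} s c (true  Vec.∷ ρ) = trans (blocks-last (suc c) (suc c) ρ) (sym (+-suc c m))

blocks-start≥ : ∀ {m} s c (ρ : Subset m) p → s ≤ c → s ≤ proj₁ (blocks s c ρ p)
blocks-start≥ s c Vec.[]            p       s≤c = ≤-refl
blocks-start≥ s c (false Vec.∷ ρ) p       s≤c = blocks-start≥ s (suc c) ρ p (m≤n⇒m≤1+n s≤c)
blocks-start≥ s c (true  Vec.∷ ρ) zero    s≤c = ≤-refl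
blocks-start≥ s c (true  Vec.∷ ρ) (suc p) s≤c = ≤-trans (m≤n⇒m≤1+n s≤c) (blocks-start≥ (suc c) (suc c) ρ p ≤-refl)

blocks-end≥ : ∀ {m} s c (ρ : Subset m) p → c ≤ proj₂ (blocks s c ρ p)
blocks-end≥ s c Vec.[]            p       = ≤-refl
blocks-end≥ s c (false Vec.∷ ρ) p       = <⇒≤ (blocks-end≥ s (suc c) ρ p)
blocks-end≥ s c (true  Vec.∷ ρ) zero    = ≤-refl
blocks-end≥ s c (true  Vec.∷ ρ) (suc p) = <⇒≤ (blocks-end≥ (suc c) (suc c) ρ p)

blocks-ordered : ∀ {m} s c (ρ : Subset m) p → s ≤ c → proj₁ (blocks s c ρ p) ≤ proj₂ (blocks s c ρ p)
blocks-ordered s c Vec.[]            p       s≤c = s≤c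
blocks-ordered s c (false Vec.∷ ρ) p       s≤c = blocks-ordered s (suc c) ρ p (m≤n⇒m≤1+n s≤c)
blocks-ordered s c (true  Vec.∷ ρ) zero    s≤c = s≤c
blocks-ordered s c (true  Vec.∷ ρ) (suc p) s≤c = blocks-ordered (suc c) (suc c) ρ p ≤-refl

blocks-system : ∀ {n} (ρ : Subset n) → BlockSystem ∣ ρ ∣ˢ n (blocks 0 0 ρ)
blocks-system ρ = record
  { first   = blocks-first 0 0 ρ
  ; chain   = blocks-chain 0 0 ρ
  ; last    = blocks-last 0 0 ρ
  ; ordered = λ {p} _ → blocks-ordered 0 0 ρ p z≤n
  }

-- A position belongs to only one block, which was cut from `ρ` there, so what a block says about an
-- input is right. The index `p` is unrestricted because indices beyond the last block return the
-- last block again.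
blocks-sound : ∀ {m} s c (ρ : Subset m) p v b → Gives b (blocks s c ρ p) (c + toℕ v) → Vec.lookup ρ v ≡ b
blocks-sound s c (false Vec.∷ ρ) p zero    false _ = refl
blocks-sound s c (false Vec.∷ ρ) p zero    true  e =
  ⊥-elim (<⇒≢ (blocks-end≥ s (suc c) ρ p) (sym (trans e (+-identityʳ c))))
blocks-sound s c (false Vec.∷ ρ) p (suc v) b     g =
  blocks-sound s (suc c) ρ p v b (subst (Gives b (blocks s (suc c) ρ p)) (+-suc c (toℕ v)) g)
blocks-sound s c (true Vec.∷ ρ) zero zero    true  _ = refl
blocks-sound s c (true Vec.∷ ρ) zero zero    false (_ , lt) = ⊥-elim (m+n≮m c 0 lt)
blocks-sound s c (true Vec.∷ ρ) zero (suc v) true  e = ⊥-elim (m+1+n≢m c (sym e))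
blocks-sound s c (true Vec.∷ ρ) zero (suc v) false (_ , lt) = ⊥-elim (m+n≮m c _ lt)
blocks-sound s c (true Vec.∷ ρ) (suc p) zero true  _ = refl
blocks-sound s c (true Vec.∷ ρ) (suc p) zero false (le , _) =
  ⊥-elim (<-irrefl refl (≤-trans (blocks-start≥ (suc c) (suc c) ρ p ≤-refl) (≤-trans le (≤-reflexive (+-identityʳ c)))))
blocks-sound s c (true Vec.∷ ρ) (suc p) (suc v) b g =
  blocks-sound (suc c) (suc c) ρ p v b (subst (Gives b (blocks (suc c) (suc c) ρ p)) (+-suc c (toℕ v)) g)

-- From solutions to assignments and back

∈-tuples⁺ : ∀ {A : Set} {l : List A} q {xs} → length xs ≡ q → (∀ {x} → x ∈ xs → x ∈ l) → xs ∈ tuples q l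
∈-tuples⁺ zero    {[]}     _ _ = here refl
∈-tuples⁺ (suc q) {x ∷ xs} e ⊆ = ∈-cartesianProductWith⁺ _∷_ (⊆ (here refl)) (∈-tuples⁺ q (suc-injective e) (⊆ ∘ there))

∈-tuples⁻ : ∀ {A : Set} {l : List A} q {xs} → xs ∈ tuples q l → length xs ≡ q × (∀ {x} → x ∈ xs → x ∈ l)
∈-tuples⁻ zero (here refl) = refl , λ ()
∈-tuples⁻ {l = l} (suc q) xs∈ with ∈-cartesianProductWith⁻ _∷_ l (tuples q l) xs∈
... | y , ys , y∈ , ys∈ , refl =
  let e , ⊆ = ∈-tuples⁻ q ys∈ in cong suc e , λ { (here refl) → y∈ ; (there x∈) → ⊆ x∈ }

length-cartesianProductWith : ∀ {A B C : Set} (f : A → B → C) xs ys →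
                              length (cartesianProductWith f xs ys) ≡ length xs * length ys
length-cartesianProductWith f []       ys = refl
length-cartesianProductWith f (x ∷ xs) ys =
  trans (List.length-++ (map (f x) ys)) (cong₂ _+_ (List.length-map (f x) ys) (length-cartesianProductWith f xs ys))

length-tuples : ∀ {A : Set} q (l : List A) → length (tuples q l) ≡ length l ^ q
length-tuples zero    l = refl
length-tuples (suc q) l = trans (length-cartesianProductWith _∷_ l (tuples q l)) (cong (length l *_) (length-tuples q l))

∈⇒nth : ∀ {A : Set} (d : A) {xs x} → x ∈ xs → Σ[ m ∈ ℕ ] m < length xs × nth d xs m ≡ x
∈⇒nth d (here refl) = 0 , s≤s z≤n , refl
∈⇒nth d (there x∈) = let m , m< , e = ∈⇒nth d x∈ in suc m , s≤s m< , e

∈-replicate⁻ : ∀ {A : Set} {d x : A} m → x ∈ replicate m d → x ≡ d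
∈-replicate⁻ (suc m) (here e)   = e
∈-replicate⁻ (suc m) (there x∈) = ∈-replicate⁻ m x∈

pad : {A : Set} → A → ℕ → List A → List A
pad d m xs = xs ++ replicate (m ∸ length xs) d

length-pad : ∀ {A : Set} (d : A) {m xs} → length xs ≤ m → length (pad d m xs) ≡ m
length-pad d {m} {xs} le = trans (List.length-++ xs)
  (trans (cong (length xs +_) (List.length-replicate (m ∸ length xs))) (m+[n∸m]≡n le))

∈-pad⁻ : ∀ {A : Set} (d : A) {m xs x} → x ∈ pad d m xs → x ∈ xs ⊎ x ≡ d
∈-pad⁻ d {m} {xs} x∈ = [ inj₁ , (λ r → inj₂ (∈-replicate⁻ (m ∸ length xs) r)) ]′ (∈-++⁻ xs x∈)

map-nth-upTo : ∀ {A B : Set} (d : A) (f : A → B) xs → map (λ m → f (nth d xs m)) (upTo (length xs)) ≡ map f xs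
map-nth-upTo d f xs = trans (List.map-upTo _ (length xs)) (go xs)
  where
  go : ∀ xs → applyUpTo (λ m → f (nth d xs m)) (length xs) ≡ map f xs
  go []       = refl
  go (x ∷ xs) = cong (f x ∷_) (go xs)

blockAt : (ℕ → ℕ × ℕ) → ℕ → Block
blockAt γ p = p , γ p

blocksOf-map : ∀ γ q ps V → length ps ≡ q → (∀ m → m < q → nth (0 , 0) V m ≡ γ (nth 0 ps m)) →
               blocksOf q ps V ≡ map (blockAt γ) ps
blocksOf-map γ q ps V refl e = trans
  (List.map-cong-local (All.tabulate (λ {m} m∈ → cong (nth 0 ps m ,_) (e m (∈-upTo⁻ m∈)))))
  (map-nth-upTo 0 (blockAt γ) ps)

nth-map : ∀ {A B : Set} (d : A) (d′ : B) (f : A → B) xs {m} → m < length xs → nth d′ (map f xs) m ≡ f (nth d xs m)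
nth-map d d′ f (x ∷ xs) {zero}  _        = refl
nth-map d d′ f (x ∷ xs) {suc m} (s≤s m<) = nth-map d d′ f xs m<

system⇒blockOK : ∀ {k n γ p} → BlockSystem k n γ → p ≤ k → T (blockOK k n (blockAt γ p))
system⇒blockOK {k} {n} {γ} {p} sys p≤k = Equivalence.from T-∧ (≤⇒≤ᵇ (ordered p≤k) ,
  Equivalence.from (T-∧ {not (p ≡ᵇ 0) ∨ (proj₁ (γ p) ≡ᵇ 0)})
    ( imp⁺ {p ≡ᵇ 0} (λ e → ≡⇒≡ᵇ _ _ (trans (cong (proj₁ ∘ γ) (≡ᵇ⇒≡ p 0 e)) first))
    , imp⁺ {p ≡ᵇ k} (λ e → ≡⇒≡ᵇ _ _ (trans (cong (proj₂ ∘ γ) (≡ᵇ⇒≡ p k e)) last))))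
  where open BlockSystem sys

system⇒compatible : ∀ {k n γ p p′} → BlockSystem k n γ → p′ ≤ k → T (compatible (blockAt γ p) (blockAt γ p′))
system⇒compatible {k} {n} {γ} {p} {p′} sys p′≤k =
  Equivalence.from (T-∧ {not (p ≡ᵇ p′) ∨ ((proj₁ (γ p) ≡ᵇ proj₁ (γ p′)) ∧ (proj₂ (γ p) ≡ᵇ proj₂ (γ p′)))})
    ( imp⁺ {p ≡ᵇ p′} (λ e → let e′ = ≡ᵇ⇒≡ p p′ e in
        Equivalence.from T-∧ (≡⇒≡ᵇ _ _ (cong (proj₁ ∘ γ) e′) , ≡⇒≡ᵇ _ _ (cong (proj₂ ∘ γ) e′)))
    , imp⁺ {suc p ≡ᵇ p′} (λ e → let e′ = ≡ᵇ⇒≡ (suc p) p′ e in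
        ≡⇒≡ᵇ _ _ (sym (trans (cong (proj₁ ∘ γ) (sym e′)) (chain (subst (_≤ k) (sym e′) p′≤k))))))
  where open BlockSystem sys

module _ (q M k n : ℕ) (gs : List RawGate) where

  private
    I : Instance
    I = k , n , gs
    K N : ℕ
    K = numVariables q M I
    N = numValues q M I
    rel : ℕ → ℕ → ℕ → ℕ → Bool
    rel = relation q M I
    variableAt : ℕ → List ℕ
    variableAt = nth [] (variables q k)
    valueAt : ℕ → ℕ × List (ℕ × ℕ)
    valueAt = nth (0 , []) (values q M I)

    variableAt-tuple : ∀ (i : Fin K) → length (variableAt (toℕ i)) ≡ q × (∀ {p} → p ∈ variableAt (toℕ i) → p ≤ k)
    variableAt-tuple i =
      let e , ⊆ = ∈-tuples⁻ q (nth-∈ [] (variables q k) (Fin.toℕ<n i)) in e , λ p∈ → s≤s⁻¹ (∈-upTo⁻ (⊆ p∈))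

    variableIndex : ∀ {ps} → length ps ≡ q → (∀ {p} → p ∈ ps → p ≤ k) → Σ[ i ∈ Fin K ] variableAt (toℕ i) ≡ ps
    variableIndex {ps} e ⊆ =
      let i , i< , e′ = ∈⇒nth [] (∈-tuples⁺ {l = upTo (suc k)} q {ps} e (λ p∈ → ∈-upTo⁺ (s≤s (⊆ p∈))))
      in fromℕ< i< , trans (cong variableAt (Fin.toℕ-fromℕ< i<)) e′

  solution⁺ : ∀ {γ S} → BlockSystem k n γ → S ∈ claimSets M I →
    (∀ ps → (∀ {p} → p ∈ ps → p ≤ k) → T (accepts S (map (blockAt γ) ps) n gs)) → Solution K N rel
  solution⁺ {γ} {S} sys S∈ acc = record
    { α       = λ i → proj₁ (value i)
    ; α<N     = λ i → proj₁ (proj₂ (value i))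
    ; related = related
    }
    where
    open BlockSystem sys

    σ : Σ[ m ∈ ℕ ] m < length (claimSets M I) × nth [] (claimSets M I) m ≡ S
    σ = ∈⇒nth [] S∈

    ps : Fin K → List ℕ
    ps i = variableAt (toℕ i)

    value : ∀ i → Σ[ a ∈ ℕ ] a < N × valueAt a ≡ (proj₁ σ , map γ (ps i))
    value i = ∈⇒nth (0 , []) (∈-cartesianProduct⁺ (∈-upTo⁺ (proj₁ (proj₂ σ)))
      (∈-tuples⁺ q (trans (List.length-map γ (ps i)) (proj₁ (variableAt-tuple i))) λ x∈ → pair∈ (∈-map⁻ γ x∈)))
      where
      pair∈ : ∀ {x} → Σ[ p ∈ ℕ ] p ∈ ps i × x ≡ γ p → x ∈ cartesianProduct (upTo (suc n)) (upTo (suc n))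
      pair∈ (p , p∈ , refl) =
        let p≤k = proj₂ (variableAt-tuple i) p∈
        in ∈-cartesianProduct⁺ (∈-upTo⁺ (s≤s (≤-trans (ordered p≤k) (bounded p≤k)))) (∈-upTo⁺ (s≤s (bounded p≤k)))

    blocks≡ : ∀ i → blocksOf q (ps i) (proj₂ (valueAt (proj₁ (value i)))) ≡ map (blockAt γ) (ps i)
    blocks≡ i = trans (cong (blocksOf q (ps i) ∘ proj₂) (proj₂ (proj₂ (value i))))
      (blocksOf-map γ q (ps i) (map γ (ps i)) |ps| λ m m<q → nth-map 0 (0 , 0) γ (ps i) (subst (m <_) (sym |ps|) m<q))
      where
      |ps| = proj₁ (variableAt-tuple i)

    consistent⁺ : ∀ rs → (∀ {p} → p ∈ rs → p ≤ k) → T (consistent k n (map (blockAt γ) rs))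
    consistent⁺ rs ⊆ = Equivalence.from T-∧
      ( all⁺ (blockOK k n) (map (blockAt γ) rs) (λ x∈ → blockOK′ (∈-map⁻ (blockAt γ) x∈))
      , all⁺ _ (map (blockAt γ) rs) (λ x∈ → all⁺ _ (map (blockAt γ) rs) (λ y∈ →
          compatible′ (∈-map⁻ (blockAt γ) x∈) (∈-map⁻ (blockAt γ) y∈))))
      where
      blockOK′ : ∀ {x} → Σ[ p ∈ ℕ ] p ∈ rs × x ≡ blockAt γ p → T (blockOK k n x)
      blockOK′ (p , p∈ , refl) = system⇒blockOK sys (⊆ p∈)
      compatible′ : ∀ {x y} → Σ[ p ∈ ℕ ] p ∈ rs × x ≡ blockAt γ p → Σ[ p ∈ ℕ ] p ∈ rs × y ≡ blockAt γ p → T (compatible x y)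
      compatible′ (p , _ , refl) (p′ , p′∈ , refl) = system⇒compatible {p = p} sys (⊆ p′∈)

    related : ∀ i j → T (rel (toℕ i) (proj₁ (value i)) (toℕ j) (proj₁ (value j)))
    related i j = Equivalence.from T-∧
      ( ≡⇒≡ᵇ _ _ (trans (cong proj₁ (proj₂ (proj₂ (value i)))) (sym (cong proj₁ (proj₂ (proj₂ (value j))))))
      , subst₂ (λ S′ Bs → T (check I S′ Bs))
          (sym (trans (cong (nth [] (claimSets M I) ∘ proj₁) (proj₂ (proj₂ (value i)))) (proj₂ (proj₂ σ))))
          (trans (List.map-++ (blockAt γ) (ps i) (ps j)) (sym (cong₂ _++_ (blocks≡ i) (blocks≡ j))))
          (Equivalence.from T-∧ (consistent⁺ (ps i ++ ps j) ⊆ , acc (ps i ++ ps j) ⊆)))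
      where
      ⊆ : ∀ {p} → p ∈ ps i ++ ps j → p ≤ k
      ⊆ p∈ = [ proj₂ (variableAt-tuple i) , proj₂ (variableAt-tuple j) ]′ (∈-++⁻ (ps i) p∈)

  -- The block at position `p` is taken from the variable of the tuple `p, …, p`. Its compatibility
  -- with every other variable makes each of them show this very block wherever `p` occurs, so all
  -- values are restrictions of one system.
  solution⁻ : 0 < q → Solution K N rel →
    Σ[ γ ∈ (ℕ → ℕ × ℕ) ] Σ[ S ∈ List Claim ] BlockSystem k n γ ×
      (∀ ps → length ps ≤ q → (∀ {p} → p ∈ ps → p ≤ k) →
         Σ[ Bs ∈ List Block ] T (accepts S Bs n gs) × (∀ {p} → p ∈ ps → blockAt γ p ∈ Bs))
  solution⁻ 0<q sol = γ , S , system , accepted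
    where
    open Solution sol

    constant : ∀ {p} → p ≤ k → Σ[ i ∈ Fin K ] variableAt (toℕ i) ≡ replicate q p
    constant {p} p≤k = variableIndex (List.length-replicate q) (λ r∈ → subst (_≤ k) (sym (∈-replicate⁻ q r∈)) p≤k)

    -- γ is read off the constant tuples; beyond k it is arbitrary.
    γ′ : ∀ p → Dec (p ≤ k) → ℕ × ℕ
    γ′ p (yes p≤k) = nth (0 , 0) (proj₂ (valueAt (α (proj₁ (constant p≤k))))) 0
    γ′ p (no _)    = 0 , 0

    γ : ℕ → ℕ × ℕ
    γ p = γ′ p (p ≤? k)

    blocksAt : Fin K → List Block
    blocksAt i = blocksOf q (variableAt (toℕ i)) (proj₂ (valueAt (α i)))

    S : List Claim
    S = nth [] (claimSets M I) (proj₁ (valueAt (α (proj₁ (constant {0} z≤n)))))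

    checked : ∀ i j → T (check I S (blocksAt i ++ blocksAt j))
    checked i j = subst (λ σ → T (check I (nth [] (claimSets M I) σ) (blocksAt i ++ blocksAt j)))
      (≡ᵇ⇒≡ _ _ (proj₁ (Equivalence.to (T-∧ {proj₁ (valueAt (α i)) ≡ᵇ proj₁ (valueAt (α i₀))}) (related i i₀))))
      (proj₂ (Equivalence.to (T-∧ {proj₁ (valueAt (α i)) ≡ᵇ proj₁ (valueAt (α j))}) (related i j)))
      where
      i₀ = proj₁ (constant {0} z≤n)

    module _ (i j : Fin K) where

      private
        Bs = blocksAt i ++ blocksAt j
        parts : T (consistent k n Bs) × T (accepts S Bs n gs)
        parts = Equivalence.to (T-∧ {consistent k n Bs}) (checked i j)
        parts′ : T (all (blockOK k n) Bs) × T (all (λ x → all (compatible x) Bs) Bs)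
        parts′ = Equivalence.to (T-∧ {all (blockOK k n) Bs}) (proj₁ parts)

      blockOK∈ : ∀ {x} → x ∈ Bs → T (blockOK k n x)
      blockOK∈ = all⁻ (blockOK k n) (proj₁ parts′)

      compatible∈ : ∀ {x y} → x ∈ Bs → y ∈ Bs → T (compatible x y)
      compatible∈ {x} x∈ = all⁻ (compatible x) (all⁻ (λ x → all (compatible x) Bs) (proj₂ parts′) x∈)

      accepts∈ : T (accepts S Bs n gs)
      accepts∈ = proj₂ parts

    block∈ : ∀ i {m} → m < q → (nth 0 (variableAt (toℕ i)) m , nth (0 , 0) (proj₂ (valueAt (α i))) m) ∈ blocksAt i
    block∈ i m<q = ∈-map⁺ _ (∈-upTo⁺ m<q)

    nth-replicate : ∀ {m r} (p : ℕ) → r < m → nth 0 (replicate m p) r ≡ p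
    nth-replicate {suc m} {zero}  p _        = refl
    nth-replicate {suc m} {suc r} p (s≤s r<) = nth-replicate p r<

    γ∈ : ∀ {p} (p≤k : p ≤ k) → blockAt γ p ∈ blocksAt (proj₁ (constant p≤k))
    γ∈ {p} p≤k = subst (_∈ blocksAt i) (cong₂ _,_ position γ≡) (block∈ i 0<q)
      where
      i = proj₁ (constant p≤k)
      position : nth 0 (variableAt (toℕ i)) 0 ≡ p
      position = trans (cong (λ ps → nth 0 ps 0) (proj₂ (constant p≤k))) (nth-replicate p 0<q)
      γ≡ : nth (0 , 0) (proj₂ (valueAt (α i))) 0 ≡ γ p
      γ≡ = lem (p ≤? k)
        where
        lem : ∀ d → nth (0 , 0) (proj₂ (valueAt (α i))) 0 ≡ γ′ p d
        lem (yes le) = cong (λ l → nth (0 , 0) (proj₂ (valueAt (α (proj₁ (constant l))))) 0) (≤-irrelevant p≤k le)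
        lem (no ¬le) = ⊥-elim (¬le p≤k)

    compatible-same : ∀ {p x y} → T (compatible (p , x) (p , y)) → x ≡ y
    compatible-same {p} {s , e} {s′ , e′} c =
      let t , _ = Equivalence.to (T-∧ {not (p ≡ᵇ p) ∨ ((s ≡ᵇ s′) ∧ (e ≡ᵇ e′))}) c
          es , ee = Equivalence.to (T-∧ {s ≡ᵇ s′}) (imp⁻ {p ≡ᵇ p} t (≡⇒≡ᵇ p p refl))
      in cong₂ _,_ (≡ᵇ⇒≡ s s′ es) (≡ᵇ⇒≡ e e′ ee)

    compatible-next : ∀ {p x y} → T (compatible (p , x) (suc p , y)) → proj₁ y ≡ suc (proj₂ x)
    compatible-next {p} {s , e} {s′ , e′} c =
      sym (≡ᵇ⇒≡ (suc e) s′ (imp⁻ {p ≡ᵇ p} (proj₂ (Equivalence.to (T-∧ {not (p ≡ᵇ suc p) ∨ ((s ≡ᵇ s′) ∧ (e ≡ᵇ e′))}) c)) (≡⇒≡ᵇ p p refl)))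

    blocksAt≡ : ∀ i → blocksAt i ≡ map (blockAt γ) (variableAt (toℕ i))
    blocksAt≡ i = blocksOf-map γ q (variableAt (toℕ i)) (proj₂ (valueAt (α i))) |i| λ m m<q →
      let p≤k = proj₂ (variableAt-tuple i) (nth-∈ 0 (variableAt (toℕ i)) (subst (m <_) (sym |i|) m<q))
          j = proj₁ (constant p≤k)
      in compatible-same {nth 0 (variableAt (toℕ i)) m}
           (compatible∈ i j (∈-++⁺ˡ (block∈ i m<q)) (∈-++⁺ʳ (blocksAt i) (γ∈ p≤k)))
      where
      |i| = proj₁ (variableAt-tuple i)

    system : BlockSystem k n γ
    system = record { first = first ; chain = chain ; last = last ; ordered = ordered }
      where
      okAt′ : ∀ {p} → p ≤ k → T (blockOK k n (blockAt γ p))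
      okAt′ p≤k = let i = proj₁ (constant p≤k) in blockOK∈ i i (∈-++⁺ˡ (γ∈ p≤k))
      ends : ∀ {p} → p ≤ k → T (not (p ≡ᵇ 0) ∨ (proj₁ (γ p) ≡ᵇ 0)) × T (not (p ≡ᵇ k) ∨ (proj₂ (γ p) ≡ᵇ n))
      ends {p} p≤k = Equivalence.to (T-∧ {not (p ≡ᵇ 0) ∨ (proj₁ (γ p) ≡ᵇ 0)})
                       (proj₂ (Equivalence.to (T-∧ {proj₁ (γ p) ≤ᵇ proj₂ (γ p)}) (okAt′ p≤k)))
      first : proj₁ (γ 0) ≡ 0
      first = ≡ᵇ⇒≡ _ 0 (proj₁ (ends z≤n))
      last : proj₂ (γ k) ≡ n
      last = ≡ᵇ⇒≡ _ n (imp⁻ {k ≡ᵇ k} (proj₂ (ends ≤-refl)) (≡⇒≡ᵇ k k refl))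
      ordered : ∀ {p} → p ≤ k → proj₁ (γ p) ≤ proj₂ (γ p)
      ordered {p} p≤k = ≤ᵇ⇒≤ _ _ (proj₁ (Equivalence.to (T-∧ {proj₁ (γ p) ≤ᵇ proj₂ (γ p)}) (okAt′ p≤k)))
      chain : ∀ {p} → p < k → proj₁ (γ (suc p)) ≡ suc (proj₂ (γ p))
      chain {p} p<k =
        let i = proj₁ (constant (<⇒≤ p<k))
            j = proj₁ (constant p<k)
        in compatible-next {p} {γ p} (compatible∈ i j (∈-++⁺ˡ (γ∈ (<⇒≤ p<k))) (∈-++⁺ʳ (blocksAt i) (γ∈ p<k)))

    accepted : ∀ ps → length ps ≤ q → (∀ {p} → p ∈ ps → p ≤ k) →
               Σ[ Bs ∈ List Block ] T (accepts S Bs n gs) × (∀ {p} → p ∈ ps → blockAt γ p ∈ Bs)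
    accepted ps ps≤ ⊆ =
      -- Position `0` exists for every `k` and fills the list up to a full tuple. The constraint of
      -- this variable with itself contains the required test.
      let i , e = variableIndex (length-pad 0 {q} {ps} ps≤) (λ p∈ → [ ⊆ , (λ e → subst (_≤ k) (sym e) z≤n) ]′ (∈-pad⁻ 0 {q} {ps} p∈))
      in blocksAt i ++ blocksAt i , accepts∈ i i ,
         λ {p} p∈ → ∈-++⁺ˡ (subst (blockAt γ p ∈_) (sym (trans (blocksAt≡ i) (cong (map (blockAt γ)) e))) (∈-map⁺ (blockAt γ) (∈-++⁺ˡ p∈)))

head≡lookup : ∀ {A : Set} {m} (xs : Vec.Vec A (suc m)) → Vec.head xs ≡ Vec.lookup xs zero
head≡lookup (x Vec.∷ xs) = refl

-- Equivalence of the circuit and the constraint satisfaction problem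

module _ {d : ℕ} (W : WCSInstance 1 d) where

  open WCSInstance W

  private
    q M : ℕ
    q = 2 ^ d
    M = cap d
    I : Instance
    I = k , n , raw circuit

    weft₀ : weftAt circuit zero ≤ 1
    weft₀ = subst (_≤ 1) (head≡lookup (pathCosts largeCost circuit)) weft≤
    depth₀ : depthAt circuit zero ≤ d
    depth₀ = subst (_≤ d) (head≡lookup (pathCosts (λ _ → 1) circuit)) depth≤

    SAT : Set
    SAT = ParamProblem.Yes (WCS 1 d) W

    CSP : Set
    CSP = Solution (numVariables q M I) (numValues q M I) (relation q M I)

  satisfiable⇒solution : SAT → CSP
  satisfiable⇒solution (ρ , weight , out) =
    solution⁺ q M k n (raw circuit) {γ} {S′} system S′∈ λ ps _ → completeness ρ (map (blockAt γ) ps) (sound ps) S′ circuit good′ root′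
    where
    γ = blocks 0 0 ρ
    root = claims ρ circuit zero d depth₀
    S = proj₁ root
    good : Good ρ S circuit
    good = proj₁ (proj₂ (proj₂ (proj₂ root)))
    root∈ : (level circuit zero , true) ∈ S
    root∈ = subst (λ b → (level circuit zero , b) ∈ S) (trans (sym (head≡lookup (evalNodes circuit ρ))) out)
              (proj₂ (proj₂ (proj₂ (proj₂ root))))
    -- Claim sets are listed as tuples of length exactly `M`; repeating the root claim fills one up
    -- without changing its members.
    S′ = pad (level circuit zero , true) M S
    S′⊆ : ∀ {c} → c ∈ S′ → c ∈ S
    S′⊆ c∈ = [ (λ c∈ → c∈) , (λ e → subst (_∈ S) (sym e) root∈) ]′ (∈-pad⁻ (level circuit zero , true) {M} {S} c∈)
    good′ : Good ρ S′ circuit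
    good′ = Good-cong ρ circuit ∈-++⁺ˡ S′⊆ good
    root′ : (level circuit zero , true) ∈ S′
    root′ = ∈-++⁺ˡ root∈
    system : BlockSystem k n γ
    system = subst (λ k → BlockSystem k n γ) weight (blocks-system ρ)
    bool∈ : ∀ b → b ∈ true ∷ false ∷ []
    bool∈ true  = here refl
    bool∈ false = there (here refl)
    S′∈ : S′ ∈ claimSets M I
    S′∈ = ∈-tuples⁺ M (length-pad (level circuit zero , true) {M} {S} (proj₁ (proj₂ root))) λ {(ℓ , b)} c∈ →
      ∈-cartesianProduct⁺ (∈-upTo⁺ (subst (ℓ <_) (sym (length-raw circuit)) (proj₁ (proj₂ (proj₂ root)) (S′⊆ c∈)))) (bool∈ b)
    sound : ∀ ps v b → T (inputIs b (map (blockAt γ) ps) (toℕ v)) → Vec.lookup ρ v ≡ b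
    sound ps v b t = gives (inputIs⁻ b t)
      where
      gives : Σ[ x ∈ Block ] x ∈ map (blockAt γ) ps × Gives b (proj₂ x) (toℕ v) → Vec.lookup ρ v ≡ b
      gives (x , x∈ , g) with ∈-map⁻ (blockAt γ) x∈
      ... | p , _ , refl = blocks-sound 0 0 ρ p v b g

  solution⇒satisfiable : CSP → SAT
  solution⇒satisfiable sol = ρ , weight , trans (head≡lookup (evalNodes circuit ρ)) (soundness ρ S d circuit weft₀ depth₀ accepting)
    where
    found = solution⁻ q M k n (raw circuit) (m^n>0 2 d) sol
    γ = proj₁ found
    S = proj₁ (proj₂ found)
    system : BlockSystem k n γ
    system = proj₁ (proj₂ (proj₂ found))
    accepted = proj₂ (proj₂ (proj₂ found))
    ρ = proj₁ (BlockSystem.assignment system)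
    weight = proj₁ (proj₂ (BlockSystem.assignment system))
    gives = proj₂ (proj₂ (BlockSystem.assignment system))
    accepting : ∀ vs → length vs ≤ 2 ^ d → Σ[ Bs ∈ List Block ] T (accepts S Bs n (raw circuit)) × (∀ {v} → v ∈ vs → Decides ρ Bs v)
    accepting vs vs≤ =
      -- An input is decided by the one block that contains it, so `2 ^ d` inputs ask for at most
      -- `q` positions.
      let Bs , acc , f = accepted (map (proj₁ ∘ gives) vs) (subst (_≤ q) (sym (List.length-map _ vs)) vs≤)
                           (λ p∈ → bound (∈-map⁻ (proj₁ ∘ gives) p∈))
      in Bs , acc , λ {v} v∈ → inputIs⁺ (Vec.lookup ρ v) (f (∈-map⁺ (proj₁ ∘ gives) v∈)) (proj₂ (proj₂ (gives v)))
      where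
      bound : ∀ {p} → Σ[ v ∈ Fin n ] v ∈ vs × p ≡ proj₁ (gives v) → p ≤ k
      bound (v , _ , refl) = proj₁ (proj₂ (gives v))

theorem7p2 : (H : Graph) → NonZero (Graph.order H) → IsComplete H →
    W[ 1 ]-Hard (InducedGraphMatching H (star 4 -Free))
theorem7p2 H nonZero complete A (d , A≤WCS) =
  -- The depth `d` comes with the problem `A`, so the program may depend on it. The new parameter is
  -- `K * K` with `K = (k + 1) ^ (2 ^ d)`, whence the square of `number`.
  ≤fpt-polyTime A≤WCS (reductionᵖ (2 ^ d) (cap d) h) (number ⊠ number) λ W →
    let open WCSInstance W
        I = k , n , raw circuit
        K = numVariables q M I
        N = numValues q M I
        rel = relation q M I
        0<h = >-nonZero⁻¹ h {{nonZero}}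
    in I ,
       record { graph = CSPGraph.cspGraph h K N rel ; in-class = CSPGraph.cspGraph-K₁₄-free h K N rel ; k = K * K } ,
       cong (λ x → encodeℕ k ∙ encodeℕ n ∙ x) (encode-raw circuit) ,
       cong (encodeℕ (K * K) ∙_) (sym (CSPGraph.encode-cspGraph h K N rel)) ,
       ≤-reflexive (cong₂ _*_ (number≡ k) (number≡ k)) ,
       mk⇔ (λ sat → solution⇒matching H complete K N rel 0<h (satisfiable⇒solution W sat))
           (λ M → solution⇒satisfiable W (matching⇒solution H complete K N rel 0<h M))
  where
  h = Graph.order H
  q = 2 ^ d
  M = cap d
  number : Poly
  number = power q ⊙ (con 1 ⊞ X)
  number≡ : ∀ k → length (variables q k) ≡ ⟪ number ⟫ k
  number≡ k = trans (length-tuples q (upTo (suc k)))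
    (trans (cong (_^ q) (List.length-upTo (suc k))) (sym (⟪power⟫ q (suc k))))
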